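{- There is a deterministic Karp (polynomial-time many-one) reduction from the Permutation Code Equivalence problem (PCE) to the Signed Permutation Code Equivalence problem (SPCE) that runs in time $\mathrm{poly}(n,\log q)$, where $n$ is the blocklength and $q$ is the field size of the input code pair. That is, there is a deterministic algorithm that, given a PCE instance $(\mathbf{G},\mathbf{H})$ of generator matrices in $\mathbb{F}_q^{k\times n}$, outputs in time $\mathrm{poly}(n,\log q)$ an SPCE instance $(\mathbf{G}',\mathbf{H}')$ such that $(\mathbf{G},\mathbf{H})$ is a YES instance of PCE if and only if $(\mathbf{G}',\mathbf{H}')$ is a YES instance of SPCE.
   Context: Let $q$ be a prime power and $\mathbb{F}_q$ the field of size $q$. A linear code $\mathcal{C}\subseteq\mathbb{F}_q^n$ of blocklength $n$ and dimension $k$ is a $k$-dimensional linear subspace of $\mathbb{F}_q^n$; a generator matrix of it is a matrix in $\mathbb{F}_q^{k\times n}$ whose row span is $\mathcal{C}$. $\mathcal{GL}_k(\mathbb{F}_q)$ is the group of invertible $k\times k$ matrices; $\mathcal{P}_n(\mathbb{F}_q)$ is the set of $n\times n$ permutation matrices (exactly one $1$ in each row and column, zeros elsewhere); $\mathcal{SP}_n(\mathbb{F}_q)$ is the set of $n\times n$ signed permutation matrices (exactly one non-zero entry in each row and column, each of these being $1$ or $-1$). PCE is the decision problem: given generator matrices $\mathbf{G},\mathbf{H}\in\mathbb{F}_q^{k\times n}$, decide whether there exist $\mathbf{S}\in\mathcal{GL}_k(\mathbb{F}_q)$ and $\mathbf{P}\in\mathcal{P}_n(\mathbb{F}_q)$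 with $\mathbf{S}\mathbf{G}\mathbf{P}=\mathbf{H}$. SPCE is the decision problem: given generator matrices $\mathbf{G},\mathbf{H}\in\mathbb{F}_q^{k\times n}$, decide whether there exist $\mathbf{S}\in\mathcal{GL}_k(\mathbb{F}_q)$ and $\mathbf{P}\in\mathcal{SP}_n(\mathbb{F}_q)$ with $\mathbf{S}\mathbf{G}\mathbf{P}=\mathbf{H}$. In both problems the parameters $k,n,q$ are part of the instance, and field elements are encoded in the standard way with $O(\log q)$ bits. -}

module Defs where

open import Level using (Level; 0ℓ)
open import Algebra.Bundles using (RawSemiring; RawRing)
import Algebra.Definitions.RawMonoid as RawMonoidDefinitions
import Algebra.Definitions.RawSemiring as RawSemiringDefinitions
open import Data.Bool using (Bool; true; false; if_then_else_)
open import Data.Fin using (Fin; zero; suc; toℕ; _≟_)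
open import Data.List using (List; []; _∷_; _++_; concatMap; replicate; tabulate)
import Data.List as List
open import Data.Maybe using (Maybe; just; nothing)
import Data.Maybe as Maybe
open import Data.Nat using (ℕ; zero; suc; NonZero; _∸_)
import Data.Nat as ℕ
open import Data.Nat.DivMod using (_mod_)
open import Data.Nat.Primality using (Prime; prime⇒nonZero)
open import Data.Product using (∃!; ∃-syntax; _×_; _,_)
open import Data.Sum using (_⊎_)
open import Data.Vec using (Vec; []; _∷_; init; last; toList; lookup)
import Data.Vec as Vec
open import Data.Vec.Functional using (Vector)
open import Function using (_⇔_; _↔_)
open import Relation.Binary.PropositionalEquality using (_≡_)
open import Relation.Nullary using (does)

------------------------------------------------------------------------
-- Prime fields and polynomials over them

module ModularArithmetic (p : ℕ) .{{_ : NonZero p}} where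

  ℤ/ : RawRing 0ℓ 0ℓ
  ℤ/ = record
    { Carrier = Fin p
    ; _≈_     = _≡_
    ; _+_     = λ a b → (toℕ a ℕ.+ toℕ b) mod p
    ; _*_     = λ a b → (toℕ a ℕ.* toℕ b) mod p
    ; -_      = λ a → (p ∸ toℕ a) mod p
    ; 0#      = 0 mod p
    ; 1#      = 1 mod p
    }

-- Polynomials are coefficient lists, constant term first.  Trailing zeros
-- are allowed, so equality is equality of all coefficients.

module Polynomials (R : RawRing 0ℓ 0ℓ) where
  open RawRing R

  coeff : List Carrier → ℕ → Carrier
  coeff []       _       = 0#
  coeff (a ∷ as) zero    = a
  coeff (a ∷ as) (suc i) = coeff as i

  _+ₚ_ : List Carrier → List Carrier → List Carrier
  []       +ₚ bs       = bs
  (a ∷ as) +ₚ []       = a ∷ as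
  (a ∷ as) +ₚ (b ∷ bs) = (a + b) ∷ (as +ₚ bs)

  _*ₚ_ : List Carrier → List Carrier → List Carrier
  []       *ₚ bs = []
  (a ∷ as) *ₚ bs = List.map (a *_) bs +ₚ (0# ∷ (as *ₚ bs))

  polynomials : RawSemiring 0ℓ 0ℓ
  polynomials = record
    { Carrier = List Carrier
    ; _≈_     = λ as bs → ∀ i → coeff as i ≈ coeff bs i
    ; _+_     = _+ₚ_
    ; _*_     = _*ₚ_
    ; 0#      = []
    ; 1#      = 1# ∷ []
    }

  open RawSemiringDefinitions polynomials public using (Irreducible)

  -- monic (f₀ ∷ … ∷ fᵣ₋₁ ∷ []) is f₀ + f₁ x + … + fᵣ₋₁ xʳ⁻¹ + xʳ.

  monic : ∀ {r} → Vec Carrier r → List Carrier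
  monic f = toList f ++ 1# ∷ []

  -- Arithmetic in R[x]/(monic f).  The vector (a₀ ∷ … ∷ aᵣ₋₁ ∷ []) stands for
  -- the residue class of a₀ + a₁ x + … + aᵣ₋₁ xʳ⁻¹.

  constant : ∀ {r} → Carrier → Vec Carrier r
  constant {zero}  a = []
  constant {suc r} a = a ∷ Vec.replicate r 0#

  -- Multiplication by x, using xʳ = -(f₀ + f₁ x + … + fᵣ₋₁ xʳ⁻¹).

  timesX : ∀ {r} → Vec Carrier r → Vec Carrier r → Vec Carrier r
  timesX {zero}  f a = []
  timesX {suc r} f a =
    Vec.zipWith (λ s fᵢ → s + (- (last a * fᵢ))) (0# ∷ init a) f

  -- Horner's scheme: the first factor is an arbitrary polynomial.

  horner : ∀ {m r} → Vec Carrier r → Vec Carrier m → Vec Carrier r → Vec Carrier r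
  horner {r = r} f []       b = Vec.replicate r 0#
  horner         f (a ∷ as) b =
    Vec.zipWith _+_ (Vec.map (a *_) b) (timesX f (horner f as b))

  quotientRing : ∀ {r} → Vec Carrier r → RawRing 0ℓ 0ℓ
  quotientRing {r} f = record
    { Carrier = Vec Carrier r
    ; _≈_     = _≡_
    ; _+_     = Vec.zipWith _+_
    ; _*_     = horner f
    ; -_      = Vec.map -_
    ; 0#      = constant 0#
    ; 1#      = constant 1#
    }

------------------------------------------------------------------------
-- Finite fields

-- The field with q = pʳ elements, presented as 𝔽ₚ[x]/(f) for a monic
-- irreducible f of degree r.  (Irreducibility excludes r = 0.)

record FiniteField : Set where
  field
    p       : ℕ
    r       : ℕ
    p-prime : Prime p

  𝔽ₚ : RawRing 0ℓ 0ℓ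
  𝔽ₚ = ModularArithmetic.ℤ/ p {{prime⇒nonZero p-prime}}

  field
    modulus     : Vec (Fin p) r
    irreducible : Polynomials.Irreducible 𝔽ₚ (Polynomials.monic 𝔽ₚ modulus)

  q : ℕ
  q = p ℕ.^ r

  𝔽 : RawRing 0ℓ 0ℓ
  𝔽 = Polynomials.quotientRing 𝔽ₚ modulus

------------------------------------------------------------------------
-- Matrices and linear codes

module Matrices {c ℓ : Level} (R : RawRing c ℓ) where
  open RawRing R
  open RawMonoidDefinitions +-rawMonoid using (sum)

  Matrix : ℕ → ℕ → Set c
  Matrix m n = Vector (Vector Carrier n) m

  infix  4 _≋_
  infixl 7 _⊗_

  _≋_ : ∀ {m n} → Matrix m n → Matrix m n → Set ℓ
  A ≋ B = ∀ i j → A i j ≈ B i j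

  _⊗_ : ∀ {l m n} → Matrix l m → Matrix m n → Matrix l n
  (A ⊗ B) i j = sum (λ s → A i s * B s j)

  identity : ∀ {n} → Matrix n n
  identity i j = if does (i ≟ j) then 1# else 0#

  Invertible : ∀ {k} → Matrix k k → Set _
  Invertible S = ∃[ T ] (S ⊗ T ≋ identity × T ⊗ S ≋ identity)

  IsPermutationMatrix : ∀ {n} → Matrix n n → Set _
  IsPermutationMatrix P =
      (∀ i j → P i j ≈ 0# ⊎ P i j ≈ 1#)
    × (∀ i → ∃! _≡_ λ j → P i j ≈ 1#)
    × (∀ j → ∃! _≡_ λ i → P i j ≈ 1#)

  IsSignedPermutationMatrix : ∀ {n} → Matrix n n → Set _
  IsSignedPermutationMatrix P =
      (∀ i j → P i j ≈ 0# ⊎ P i j ≈ 1# ⊎ P i j ≈ - 1#)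
    × (∀ i → ∃! _≡_ λ j → P i j ≉ 0#)
    × (∀ j → ∃! _≡_ λ i → P i j ≉ 0#)

  -- combination c A is the row vector c A.

  combination : ∀ {m n} → Vector Carrier m → Matrix m n → Vector Carrier n
  combination c A j = sum (λ i → c i * A i j)

  RowSpan : ∀ {m n} → Matrix m n → Vector Carrier n → Set _
  RowSpan A v = ∃[ c ] (∀ j → v j ≈ combination c A j)

  LinearlyIndependentRows : ∀ {m n} → Matrix m n → Set _
  LinearlyIndependentRows A =
    ∀ c → (∀ j → combination c A j ≈ 0#) → ∀ i → c i ≈ 0#

  HasDimension : ∀ {n} {a} → (Vector Carrier n → Set a) → ℕ → Set _
  HasDimension {n} V k = ∃[ B ]
    (LinearlyIndependentRows {k} {n} B × (∀ v → V v ⇔ RowSpan B v))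

  -- A k × n matrix generates a code of dimension k.

  IsGeneratorMatrix : ∀ {k n} → Matrix k n → Set _
  IsGeneratorMatrix {k} G = HasDimension (RowSpan G) k

------------------------------------------------------------------------
-- The decision problems PCE and SPCE

-- Both problems have the same instances.

record CodePair : Set where
  field
    field-q : FiniteField
    k n     : ℕ

  open FiniteField field-q public
  open Matrices 𝔽 public

  field
    G H         : Matrix k n
    G-generator : IsGeneratorMatrix G
    H-generator : IsGeneratorMatrix H

PCE : CodePair → Set
PCE I = ∃[ S ] ∃[ P ] (Invertible S × IsPermutationMatrix P × S ⊗ G ⊗ P ≋ H)
  where open CodePair I

SPCE : CodePair → Set
SPCE I = ∃[ S ] ∃[ P ] (Invertible S × IsSignedPermutationMatrix P × S ⊗ G ⊗ P ≋ H)
  where open CodePair I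

------------------------------------------------------------------------
-- Encoding of instances as words

data Symbol : Set where
  bit                              : Bool → Symbol
  endCoeff endElem endRow endBlock : Symbol

-- Binary numerals, least significant bit first, without leading zeros
-- (so 0 is the empty numeral).

increment : List Bool → List Bool
increment []           = true ∷ []
increment (false ∷ bs) = true ∷ bs
increment (true  ∷ bs) = false ∷ increment bs

binary : ℕ → List Bool
binary zero    = []
binary (suc m) = increment (binary m)

encodeUnary : ℕ → List Symbol
encodeUnary m = replicate m (bit true)

encodeBinary : ℕ → List Symbol
encodeBinary m = List.map bit (binary m)

-- An element of 𝔽 is written as the list of its r coefficients, using
-- O(r log p) = O(log q) symbols.

encodeElem : ∀ {p r} → Vec (Fin p) r → List Symbol
encodeElem a =
  concatMap (λ aᵢ → encodeBinary (toℕ aᵢ) ++ endCoeff ∷ []) (toList a) ++ endElem ∷ []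

encodeRow : ∀ {p r n} → Vector (Vec (Fin p) r) n → List Symbol
encodeRow v = concatMap encodeElem (tabulate v) ++ endRow ∷ []

encodeMatrix : ∀ {p r m n} → Vector (Vector (Vec (Fin p) r) n) m → List Symbol
encodeMatrix A = concatMap encodeRow (tabulate A)

-- The dimensions k and n are in unary; this is no longer than the matrices
-- themselves (when k ≠ 0), and running times are measured in n anyway.

encode : CodePair → List Symbol
encode I =
     encodeUnary k      ++ endBlock
  ∷  encodeUnary n      ++ endBlock
  ∷  encodeBinary p     ++ endBlock
  ∷  encodeElem modulus ++ endBlock
  ∷  encodeMatrix G     ++ endBlock
  ∷  encodeMatrix H     ++ endBlock
  ∷  []
  where open CodePair I

------------------------------------------------------------------------
-- Deterministic multi-tape Turing machines

-- nothing is the blank.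

Cell : Set
Cell = Maybe Symbol

data Move : Set where
  left stay right : Move

-- Tapes are infinite in both directions.  The cells to the left of the head
-- are listed nearest first, as are those to the right; all cells not listed
-- are blank.

record Tape : Set where
  constructor tape
  field
    before : List Cell
    head   : Cell
    after  : List Cell

open Tape public using (head)

act : Cell × Move → Tape → Tape
act (c , left)  (tape []       _ rs)       = tape [] nothing (c ∷ rs)
act (c , left)  (tape (l ∷ ls) _ rs)       = tape ls l (c ∷ rs)
act (c , stay)  (tape ls       _ rs)       = tape ls c rs
act (c , right) (tape ls       _ [])       = tape (c ∷ ls) nothing []
act (c , right) (tape ls       _ (r ∷ rs)) = tape (c ∷ ls) r rs

blankTape : Tape
blankTape = tape [] nothing []

-- A word is written on (read from) a tape starting at the head; when reading,
-- it ends before the first blank.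

written : List Symbol → Tape
written []       = blankTape
written (s ∷ ss) = tape [] (just s) (List.map just ss)

uptoBlank : List Cell → List Symbol
uptoBlank []             = []
uptoBlank (nothing ∷ _)  = []
uptoBlank (just s  ∷ cs) = s ∷ uptoBlank cs

wordAtHead : Tape → List Symbol
wordAtHead (tape _ c rs) = uptoBlank (c ∷ rs)

-- The first tape holds the input, the second one the output, and the
-- remaining ones are work tapes.  All tapes can be read and written.

record TuringMachine : Set₁ where
  field
    State     : Set
    stateSize : ℕ
    finite    : State ↔ Fin stateSize
    start     : State
    workTapes : ℕ

  tapes : ℕ
  tapes = 2 ℕ.+ workTapes

  -- nothing means that the machine halts.
  field
    δ : State → Vec Cell tapes → Maybe (State × Vec (Cell × Move) tapes)

  Config : Set
  Config = State × Vec Tape tapes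

  initial : List Symbol → Config
  initial w = start , written w ∷ Vec.replicate (suc workTapes) blankTape

  step : Config → Maybe Config
  step (s , ts) =
    Maybe.map (λ (s′ , as) → s′ , Vec.zipWith act as ts) (δ s (Vec.map head ts))

  output : Config → List Symbol
  output (s , ts) = wordAtHead (lookup ts (suc zero))

  -- Starting from the given configuration, the machine makes exactly t steps,
  -- halts, and outputs w.

  data _Halts_Steps-with_ : Config → ℕ → List Symbol → Set where
    halt : ∀ {c} → step c ≡ nothing → c Halts 0 Steps-with output c
    next : ∀ {c c′ t w} → step c ≡ just c′ →
           c′ Halts t Steps-with w → c Halts suc t Steps-with w

  _maps_to_in-time_ : List Symbol → List Symbol → ℕ → Set
  _maps_to_in-time_ v w t = initial v Halts t Steps-with w

-- Proof idea.  Replace every column g of G by the five columns (0,g), (0,g),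
-- (1,g), (1,0), (1,0), where the first entry belongs to a new row on top, and
-- add one further column (1,0).  A permutation of the columns of G clearly
-- induces one of the enlarged matrix.  Conversely, let S′ G′ P′ = H′ with P′ a
-- signed permutation, and let (τ, u) be the top row and (τ, v) the first column
-- of S′.  The top row of H′ has exactly 2n zeros; that of S′ G′ has more if τ = 0,
-- and fewer if τ ≠ 0 but u g ≠ 0 for some column g.  Hence u G = 0, and τ = ±1,
-- so one may take τ = 1.  The columns with a nonzero top are then matched with
-- sign 1 and lie over 1; more than two thirds of them are (1,0) in H′ and
-- (1,v) in S′ G′, so v = 0.  Cancelling these copies matches the columns of
-- S G with those of H, where S is S′ without its first row and column.
--
-- This uses only that 𝔽 is a (possibly nonassociative) ring with 1 ≠ 0.  For the
-- running time, k ≤ n because the rows of a basis are independent, so the output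
-- has size O((1 + n + log q)³), and the machine makes boundedly many steps per
-- symbol that it writes.

module Submission where

open import Defs
open import Algebra.Bundles using (RawRing; AbelianGroup)
import Algebra.Consequences.Propositional as Consequences
open import Algebra.Core using (Op₁; Op₂)
import Algebra.Properties.AbelianGroup as AbelianGroupProperties
import Algebra.Properties.CommutativeMonoid.Sum as FiniteSum
import Algebra.Properties.CommutativeSemigroup as CommutativeSemigroupProperties
open import Algebra.Structures using (IsNonAssociativeRing)
open import Data.Bool using (Bool; true; false; not; if_then_else_)
open import Data.Empty using (⊥-elim)
open import Data.Fin as Fin using (Fin; zero; suc; toℕ; remQuot; combine; punchIn; funToFin; finToFun)
open import Data.Fin.Patterns
open import Data.Fin.Permutation as Perm
  using (Permutation′; _⟨$⟩ʳ_; _⟨$⟩ˡ_; insert; insert-punchIn)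
import Data.Fin.Properties as Fin
open import Data.List as List
  using (List; []; _∷_; _++_; _ʳ++_; length; reverse; replicate; concatMap)
import Data.List.Properties as List
open import Data.List.Relation.Unary.All as All using (All; []; _∷_)
import Data.List.Relation.Unary.All.Properties as All
open import Data.Maybe as Maybe using (Maybe; just; nothing)
open import Data.Nat as ℕ using (ℕ; zero; suc; _≤_; _<_; z≤n; s≤s)
import Data.Nat.DivMod as ℕ
open import Data.Nat.Logarithm using (⌈log₂_⌉; ⌈log₂⌉-mono-≤; ⌈log₂2^n⌉≡n)
open import Data.Nat.Primality using (prime⇒nonZero; prime⇒nonTrivial)
import Data.Nat.Properties as ℕ
open import Data.Nat.Solver using (module +-*-Solver)
open import Data.Product using (Σ-syntax; ∃-syntax; ∃!; _×_; _,_; proj₁; proj₂; uncurry)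
open import Data.Product.Function.NonDependent.Propositional using (_×-↔_)
open import Data.Sum as Sum using (_⊎_; inj₁; inj₂)
open import Data.Sum.Function.Propositional using (_⊎-↔_)
open import Data.Unit using (⊤; tt)
open import Data.Vec as Vec
  using (Vec; []; _∷_; lookup; tabulate; init; last; zipWith; toList; updateAt; _[_]≔_)
open import Data.Vec.Functional using (Vector)
import Data.Vec.Properties as Vec
open import Function using (_∘_; _⇔_; _↔_; mk⇔; Equivalence)
open import Function.Construct.Composition using (_↔-∘_)
open import Function.Construct.Identity using (↔-id)
open import Function.Construct.Symmetry using (↔-sym)
open import Function.Definitions using (Injective)
open import Level using (0ℓ)
open import Relation.Binary using (DecidableEquality)
open import Relation.Binary.PropositionalEquality
open import Relation.Nullary using (Dec; yes; no; does)
open import Relation.Nullary.Decidable using (dec-true; dec-false; does-⇔)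

-- Sums of natural numbers

open FiniteSum ℕ.+-0-commutativeMonoid using () renaming
  ( sum to ∑; sum-cong-≗ to ∑-cong; sum-remove to ∑-remove
  ; sum-permute to ∑-permute; ∑-distrib-+ to ∑-+ )

-- The signs are the obstacle: a column (0,g) may be negated, and nothing in it betrays this. A
-- column with a known nonzero top does betray it, since (1,g) and -(1,g) differ there unless 1 =
-- -1, when negation is harmless. So the columns of G and H are compared only through (1,g).
--
-- The other columns of a block serve the count of zeros. If u g ≠ 0, both zeros at the columns
-- (0,g) are lost, and the one zero that may appear at (1,g), where τ + u g stands, cannot make up
-- for them; with a single (0,g) it could. If τ = 0, the two columns (1,0) alone give each block the
-- two zeros that it has in H′, and the one further column tips the balance, even for n = 0.
--
-- The machine does no arithmetic in the field. Entries are only copied, and the constants come from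
-- the input: zero is the encoded modulus with all bits erased, because 0 is the empty numeral, and
-- one is a single bit followed by that word.

∑-mono : ∀ {n} {f g : Fin n → ℕ} → (∀ i → f i ≤ g i) → ∑ f ≤ ∑ g
∑-mono {zero}  f≤g = z≤n
∑-mono {suc n} f≤g = ℕ.+-mono-≤ (f≤g zero) (∑-mono (f≤g ∘ suc))

∑-const : ∀ n c → ∑ {n} (λ _ → c) ≡ n ℕ.* c
∑-const zero    c = refl
∑-const (suc n) c = cong (c ℕ.+_) (∑-const n c)

-- A strict inequality at one index could not be made up at the others. This turns a count of zeros
-- over the whole row into a statement about each block.
∑-tight : ∀ {n} {f g : Fin n → ℕ} → (∀ i → f i ≤ g i) → ∑ g ≤ ∑ f → ∀ i → g i ≤ f i
∑-tight {suc n} {f} {g} f≤g g≤f zero =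
  ℕ.+-cancelʳ-≤ (∑ (g ∘ suc)) (g zero) (f zero)
    (ℕ.≤-trans g≤f (ℕ.+-monoʳ-≤ (f zero) (∑-mono (f≤g ∘ suc))))
∑-tight {suc n} {f} {g} f≤g g≤f (suc i) =
  ∑-tight (f≤g ∘ suc)
    (ℕ.+-cancelˡ-≤ (g zero) _ _ (ℕ.≤-trans g≤f (ℕ.+-monoˡ-≤ _ (f≤g zero)))) i

-- `remQuot` computes on the first five indices, so a block peels off by definition and only
-- reassociation is left.
∑-blocks : ∀ n (f : Fin n × Fin 5 → ℕ) →
  ∑ (f ∘ remQuot {n} 5) ≡
  ∑ (λ i → f (i , 0F) ℕ.+ (f (i , 1F) ℕ.+ (f (i , 2F) ℕ.+ (f (i , 3F) ℕ.+ f (i , 4F)))))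
∑-blocks zero    f = refl
∑-blocks (suc n) f = trans
  (cong (λ s → a 0F ℕ.+ (a 1F ℕ.+ (a 2F ℕ.+ (a 3F ℕ.+ (a 4F ℕ.+ s)))))
    (∑-blocks n (λ (i , c) → f (suc i , c))))
  (solve 6 (λ x₀ x₁ x₂ x₃ x₄ s →
      x₀ :+ (x₁ :+ (x₂ :+ (x₃ :+ (x₄ :+ s)))) :=
      (x₀ :+ (x₁ :+ (x₂ :+ (x₃ :+ x₄)))) :+ s) refl
    (a 0F) (a 1F) (a 2F) (a 3F) (a 4F) _)
  where
  open +-*-Solver
  a : Fin 5 → ℕ
  a c = f (zero , c)

-- Multiplicities and matchings of finite families

module Counting {A : Set} (_≟_ : DecidableEquality A) where

  δ : A → A → ℕ
  δ a b = if does (a ≟ b) then 1 else 0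

  δ-≡ : ∀ {a b} → a ≡ b → δ a b ≡ 1
  δ-≡ {a} {b} a≡b = cong (if_then 1 else 0) (dec-true (a ≟ b) a≡b)

  δ-≢ : ∀ {a b} → a ≢ b → δ a b ≡ 0
  δ-≢ {a} {b} a≢b = cong (if_then 1 else 0) (dec-false (a ≟ b) a≢b)

  δ-⇔ : ∀ {a b c d} → (a ≡ b ⇔ c ≡ d) → δ a b ≡ δ c d
  δ-⇔ {a} {b} {c} {d} e = cong (if_then 1 else 0) (does-⇔ e (a ≟ b) (c ≟ d))

  δ-≤1 : ∀ a b → δ a b ≤ 1
  δ-≤1 a b = bound (does (a ≟ b))
    where
    bound : ∀ t → (if t then 1 else 0) ≤ 1
    bound true  = s≤s z≤n
    bound false = z≤n

  count : ∀ {n} → (Fin n → A) → A → ℕ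
  count f x = ∑ (λ i → δ (f i) x)

  count-positive : ∀ {n} (f : Fin n → A) x → 0 < count f x → ∃[ i ] f i ≡ x
  count-positive {suc n} f x 0<c = found (f zero ≟ x)
    where
    found : Dec (f zero ≡ x) → ∃[ i ] f i ≡ x
    found (yes eq) = zero , eq
    found (no  ne) =
      let (i , eq) = count-positive (f ∘ suc) x
            (subst (λ d → 0 < d ℕ.+ count (f ∘ suc) x) (δ-≢ ne) 0<c)
      in suc i , eq

  -- Greedy choice: `f zero` has positive multiplicity in `g`, so it occurs there at some `j`, and
  -- deleting both occurrences keeps the multiplicities equal.
  matching : ∀ {n} (f g : Fin n → A) → (∀ x → count f x ≡ count g x) →
             Σ[ π ∈ Permutation′ n ] (∀ i → f i ≡ g (π ⟨$⟩ʳ i))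
  matching {zero}  f g _   = Perm.id , λ ()
  matching {suc n} f g f≡g = insert zero j π , matched
    where
    hit = count-positive g (f zero) (subst (0 <_) (f≡g (f zero))
      (ℕ.m≤n⇒m≤n+o _ (ℕ.≤-reflexive (sym (δ-≡ {f zero} refl)))))
    j  = proj₁ hit
    rest : ∀ x → count (f ∘ suc) x ≡ count (g ∘ punchIn j) x
    rest x = ℕ.+-cancelˡ-≡ (δ (f zero) x) _ _ (trans (f≡g x)
      (trans (∑-remove {i = j} (λ i → δ (g i) x))
             (cong (λ y → δ y x ℕ.+ count (g ∘ punchIn j) x) (proj₂ hit))))
    ih = matching (f ∘ suc) (g ∘ punchIn j) rest
    π = proj₁ ih
    matched : ∀ i → f i ≡ g (insert zero j π ⟨$⟩ʳ i)
    matched zero    = sym (proj₂ hit)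
    matched (suc i) = trans (proj₂ ih i) (cong g (sym (insert-punchIn zero j π i)))

-- The choices made by rows and by columns are inverse to each other. `Q` is left open because
-- permutation matrices single out the entries equal to one, signed ones the nonzero entries.
uniquePositions : ∀ {n} {Q : Fin n → Fin n → Set} →
  (∀ i → ∃! _≡_ λ j → Q i j) → (∀ j → ∃! _≡_ λ i → Q i j) →
  Σ[ π ∈ Permutation′ n ] (∀ j → Q (π ⟨$⟩ʳ j) j × (∀ {i} → Q i j → π ⟨$⟩ʳ j ≡ i))
uniquePositions rows columns =
    Perm.permutation (λ j → proj₁ (columns j)) (λ i → proj₁ (rows i))
      (λ i → proj₂ (proj₂ (columns _)) (proj₁ (proj₂ (rows i))))
      (λ j → proj₂ (proj₂ (rows _)) (proj₁ (proj₂ (columns j))))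
  , λ j → proj₂ (columns j)

-- Matrices over a nonassociative ring

module MatrixProperties {A : Set} {_+_ _*_ : Op₂ A} { -_ : Op₁ A} {0# 1# : A}
  (isRing : IsNonAssociativeRing _≡_ _+_ _*_ -_ 0# 1#)
  (_≟_ : DecidableEquality A) (1≢0 : 1# ≢ 0#) where

  open IsNonAssociativeRing isRing public
    using (+-identityˡ; +-identityʳ; +-comm; +-assoc; -‿inverseˡ; -‿inverseʳ
          ; zeroˡ; zeroʳ; distribˡ; distribʳ; *-identity)

  R : RawRing 0ℓ 0ℓ
  R = record { Carrier = A ; _≈_ = _≡_ ; _+_ = _+_ ; _*_ = _*_ ; -_ = -_ ; 0# = 0# ; 1# = 1# }

  +-abelianGroup : AbelianGroup 0ℓ 0ℓ
  +-abelianGroup = record { isAbelianGroup = IsNonAssociativeRing.+-isAbelianGroup isRing }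

  open AbelianGroupProperties +-abelianGroup public
    using (⁻¹-involutive; ε⁻¹≈ε; ⁻¹-∙-comm; ∙-cancelˡ; inverseʳ-unique)
  open FiniteSum (AbelianGroup.commutativeMonoid +-abelianGroup) public
    using (sum; sum-cong-≗; sum-remove; sum-replicate-zero)
  open Matrices R public

  *-identityʳ : ∀ x → x * 1# ≡ x
  *-identityʳ = proj₂ *-identity

  -‿distribˡ : ∀ x y → (- x) * y ≡ - (x * y)
  -‿distribˡ x y = inverseʳ-unique (x * y) ((- x) * y)
    (trans (sym (distribʳ y x (- x))) (trans (cong (_* y) (-‿inverseʳ x)) (zeroˡ y)))

  -‿distribʳ : ∀ x y → x * (- y) ≡ - (x * y)
  -‿distribʳ x y = inverseʳ-unique (x * y) (x * (- y))
    (trans (sym (distribˡ x y (- y))) (trans (cong (x *_) (-‿inverseʳ y)) (zeroʳ x)))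

  x*-1≡-x : ∀ x → x * (- 1#) ≡ - x
  x*-1≡-x x = trans (-‿distribʳ x 1#) (cong -_ (*-identityʳ x))

  -x≡0⇒x≡0 : ∀ {x} → - x ≡ 0# → x ≡ 0#
  -x≡0⇒x≡0 {x} -x≡0 = trans (sym (⁻¹-involutive x)) (trans (cong -_ -x≡0) ε⁻¹≈ε)

  sum-zero : ∀ {n} {f : Fin n → A} → (∀ i → f i ≡ 0#) → sum f ≡ 0#
  sum-zero {n} f≡0 = trans (sum-cong-≗ f≡0) (sum-replicate-zero n)

  sum-single : ∀ {n} (f : Fin n → A) k → (∀ i → i ≢ k → f i ≡ 0#) → sum f ≡ f k
  sum-single {suc n} f k f≡0 = trans (sum-remove {i = k} f)
    (trans (cong (f k +_) (sum-zero (λ i → f≡0 (punchIn k i) (Fin.punchInᵢ≢i k i))))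
           (+-identityʳ (f k)))

  sum-neg : ∀ {n} (f : Fin n → A) → sum (λ i → - f i) ≡ - sum f
  sum-neg {zero}  f = sym ε⁻¹≈ε
  sum-neg {suc n} f = trans (cong ((- f zero) +_) (sum-neg (f ∘ suc))) (⁻¹-∙-comm _ _)

  sum-+ : ∀ {n} (f g : Fin n → A) → sum (λ i → f i + g i) ≡ sum f + sum g
  sum-+ = FiniteSum.∑-distrib-+ (AbelianGroup.commutativeMonoid +-abelianGroup)

  combination-+ : ∀ {m n} (c d : Vector A m) (B : Matrix m n) j →
    combination (λ i → c i + d i) B j ≡ combination c B j + combination d B j
  combination-+ c d B j = trans (sum-cong-≗ λ i → distribʳ (B i j) (c i) (d i))
    (sum-+ (λ i → c i * B i j) (λ i → d i * B i j))

  combination-neg : ∀ {m n} (c : Vector A m) (B : Matrix m n) j →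
    combination (λ i → - c i) B j ≡ - combination c B j
  combination-neg c B j = trans (sum-cong-≗ λ i → -‿distribˡ (c i) (B i j))
    (sum-neg λ i → c i * B i j)

  combination-zero : ∀ {m n} {c : Vector A m} (B : Matrix m n) →
    (∀ i → c i ≡ 0#) → ∀ j → combination c B j ≡ 0#
  combination-zero B c≡0 j = sum-zero λ i → trans (cong (_* B i j) (c≡0 i)) (zeroˡ _)

  -- The difference of the two coefficient vectors combines to zero. The injectivity later bounds
  -- `k` by `n`.
  combination-injective : ∀ {m n} (B : Matrix m n) → LinearlyIndependentRows B →
    ∀ c d → (∀ j → combination c B j ≡ combination d B j) → ∀ i → c i ≡ d i
  combination-injective B independent c d same i =
    trans (sym (⁻¹-involutive (c i))) (sym (inverseʳ-unique (- c i) (d i)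
      (trans (+-comm _ _) (independent (λ i → d i + (- c i)) difference≡0 i))))
    where
    difference≡0 : ∀ j → combination (λ i → d i + (- c i)) B j ≡ 0#
    difference≡0 j = trans (combination-+ d (λ i → - c i) B j)
      (trans (cong₂ _+_ (sym (same j)) (combination-neg c B j)) (-‿inverseʳ _))

  -- Column `j` has its one in row `π ⟨$⟩ʳ j`, so that multiplication from the right puts column
  -- `π ⟨$⟩ʳ j` of the other matrix at `j`.
  permutationMatrix : ∀ {n} → Permutation′ n → Matrix n n
  permutationMatrix π i j = if does (i Fin.≟ π ⟨$⟩ʳ j) then 1# else 0#

  permutationMatrix-one : ∀ {n} (π : Permutation′ n) {i j} → i ≡ π ⟨$⟩ʳ j → permutationMatrix π i j ≡ 1#
  permutationMatrix-one π {i} {j} eq = cong (if_then 1# else 0#) (dec-true (i Fin.≟ π ⟨$⟩ʳ j) eq)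

  permutationMatrix-zero : ∀ {n} (π : Permutation′ n) {i j} → i ≢ π ⟨$⟩ʳ j → permutationMatrix π i j ≡ 0#
  permutationMatrix-zero π {i} {j} ne = cong (if_then 1# else 0#) (dec-false (i Fin.≟ π ⟨$⟩ʳ j) ne)

  permutationMatrix-nonzero : ∀ {n} (π : Permutation′ n) {i j} → permutationMatrix π i j ≢ 0# → i ≡ π ⟨$⟩ʳ j
  permutationMatrix-nonzero π {i} {j} P≢0 = decide (i Fin.≟ π ⟨$⟩ʳ j)
    where
    decide : Dec (i ≡ π ⟨$⟩ʳ j) → i ≡ π ⟨$⟩ʳ j
    decide (yes eq) = eq
    decide (no  ne) = ⊥-elim (P≢0 (permutationMatrix-zero π ne))

  permutationMatrix-values : ∀ {n} (π : Permutation′ n) i j →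
    permutationMatrix π i j ≡ 0# ⊎ permutationMatrix π i j ≡ 1#
  permutationMatrix-values π i j = value (does (i Fin.≟ π ⟨$⟩ʳ j))
    where
    value : ∀ b → (if b then 1# else 0#) ≡ 0# ⊎ (if b then 1# else 0#) ≡ 1#
    value true  = inj₂ refl
    value false = inj₁ refl

  module _ {n : ℕ} (π : Permutation′ n) where
    private
      P : Matrix n n
      P = permutationMatrix π

      P≡1⇒P≢0 : ∀ i j → P i j ≡ 1# → P i j ≢ 0#
      P≡1⇒P≢0 i j P≡1 P≡0 = 1≢0 (trans (sym P≡1) P≡0)

      unique-row : ∀ i j → P i j ≢ 0# → π ⟨$⟩ʳ j ≡ i
      unique-row i j P≢0 = sym (permutationMatrix-nonzero π {i} {j} P≢0)

      unique-column : ∀ i j → P i j ≢ 0# → π ⟨$⟩ˡ i ≡ j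
      unique-column i j P≢0 =
        trans (cong (π ⟨$⟩ˡ_) (permutationMatrix-nonzero π {i} {j} P≢0)) (Perm.inverseˡ π)

      at-row : ∀ i → P i (π ⟨$⟩ˡ i) ≡ 1#
      at-row i = permutationMatrix-one π {i} {π ⟨$⟩ˡ i} (sym (Perm.inverseʳ π))

      at-column : ∀ j → P (π ⟨$⟩ʳ j) j ≡ 1#
      at-column j = permutationMatrix-one π {π ⟨$⟩ʳ j} {j} refl

    permutationMatrix-isPermutation : IsPermutationMatrix P
    permutationMatrix-isPermutation =
        permutationMatrix-values π
      , (λ i → π ⟨$⟩ˡ i , at-row i , λ {j} → unique-column i j ∘ P≡1⇒P≢0 i j)
      , (λ j → π ⟨$⟩ʳ j , at-column j , λ {i} → unique-row i j ∘ P≡1⇒P≢0 i j)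

    permutationMatrix-isSigned : IsSignedPermutationMatrix P
    permutationMatrix-isSigned =
        (λ i j → weaken (permutationMatrix-values π i j))
      , (λ i → π ⟨$⟩ˡ i , P≡1⇒P≢0 i (π ⟨$⟩ˡ i) (at-row i) , λ {j} → unique-column i j)
      , (λ j → π ⟨$⟩ʳ j , P≡1⇒P≢0 (π ⟨$⟩ʳ j) j (at-column j) , λ {i} → unique-row i j)
      where
      weaken : ∀ {x} → x ≡ 0# ⊎ x ≡ 1# → x ≡ 0# ⊎ x ≡ 1# ⊎ x ≡ - 1#
      weaken (inj₁ x≡0) = inj₁ x≡0
      weaken (inj₂ x≡1) = inj₂ (inj₁ x≡1)

  ⊗-single : ∀ {m n} (M : Matrix m n) (P : Matrix n n) (f : Fin n → Fin n) →
    (∀ i j → i ≢ f j → P i j ≡ 0#) → ∀ i j → (M ⊗ P) i j ≡ M i (f j) * P (f j) j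
  ⊗-single M P f P≡0 i j = sum-single (λ s → M i s * P s j) (f j)
    λ s s≢fj → trans (cong (M i s *_) (P≡0 s j s≢fj)) (zeroʳ _)

  ⊗-permutationMatrix : ∀ {m n} (M : Matrix m n) (π : Permutation′ n) i j →
    (M ⊗ permutationMatrix π) i j ≡ M i (π ⟨$⟩ʳ j)
  ⊗-permutationMatrix M π i j = trans
    (⊗-single M (permutationMatrix π) (π ⟨$⟩ʳ_) (λ i j → permutationMatrix-zero π {i} {j}) i j)
    (trans (cong (M i (π ⟨$⟩ʳ j) *_) (permutationMatrix-one π {π ⟨$⟩ʳ j} {j} refl)) (*-identityʳ _))

  -- The sign is the only nonzero entry of column `j` of `P`, hence common to all rows; this is why
  -- the alternative stands outside the quantifier over `i`.
  signedPermutation-columns : ∀ {m n} (M N : Matrix m n) (P : Matrix n n) →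
    IsSignedPermutationMatrix P → M ⊗ P ≋ N →
    Σ[ π ∈ Permutation′ n ]
      ∀ j → (∀ i → N i j ≡ M i (π ⟨$⟩ʳ j)) ⊎ (∀ i → N i j ≡ - M i (π ⟨$⟩ʳ j))
  signedPermutation-columns {n = n} M N P (values , rows , columns) MP≡N =
    π , λ j → sign j (values (π ⟨$⟩ʳ j) j)
    where
    positions = uniquePositions rows columns
    π = proj₁ positions

    off : ∀ i j → i ≢ π ⟨$⟩ʳ j → P i j ≡ 0#
    off i j i≢πj = decide (P i j ≟ 0#)
      where
      decide : Dec (P i j ≡ 0#) → P i j ≡ 0#
      decide (yes eq) = eq
      decide (no  ne) = ⊥-elim (i≢πj (sym (proj₂ (proj₂ positions j) ne)))

    N≡ : ∀ i j {x} → P (π ⟨$⟩ʳ j) j ≡ x → N i j ≡ M i (π ⟨$⟩ʳ j) * x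
    N≡ i j eq = trans (sym (MP≡N i j))
      (trans (⊗-single M P (π ⟨$⟩ʳ_) off i j) (cong (M i (π ⟨$⟩ʳ j) *_) eq))

    sign : ∀ j → P (π ⟨$⟩ʳ j) j ≡ 0# ⊎ P (π ⟨$⟩ʳ j) j ≡ 1# ⊎ P (π ⟨$⟩ʳ j) j ≡ - 1# →
           (∀ i → N i j ≡ M i (π ⟨$⟩ʳ j)) ⊎ (∀ i → N i j ≡ - M i (π ⟨$⟩ʳ j))
    sign j (inj₁ eq)        = ⊥-elim (proj₁ (proj₂ positions j) eq)
    sign j (inj₂ (inj₁ eq)) = inj₁ λ i → trans (N≡ i j eq) (*-identityʳ _)
    sign j (inj₂ (inj₂ eq)) = inj₂ λ i → trans (N≡ i j eq) (x*-1≡-x _)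

  permutation-columns : ∀ {m n} (M N : Matrix m n) (P : Matrix n n) →
    IsPermutationMatrix P → M ⊗ P ≋ N →
    Σ[ π ∈ Permutation′ n ] (∀ i j → N i j ≡ M i (π ⟨$⟩ʳ j))
  permutation-columns {n = n} M N P (values , rows , columns) MP≡N =
    π , λ i j → trans (sym (MP≡N i j)) (trans (⊗-single M P (π ⟨$⟩ʳ_) off i j)
      (trans (cong (M i (π ⟨$⟩ʳ j) *_) (proj₁ (proj₂ positions j))) (*-identityʳ _)))
    where
    positions = uniquePositions rows columns
    π = proj₁ positions

    off : ∀ i j → i ≢ π ⟨$⟩ʳ j → P i j ≡ 0#
    off i j i≢πj = decide (values i j)
      where
      decide : P i j ≡ 0# ⊎ P i j ≡ 1# → P i j ≡ 0#
      decide (inj₁ eq) = eq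
      decide (inj₂ eq) = ⊥-elim (i≢πj (sym (proj₂ (proj₂ positions j) eq)))

-- The enlarged generator matrix and its row space

module CodeGadget {A : Set} {_+_ _*_ : Op₂ A} { -_ : Op₁ A} {0# 1# : A}
  (isRing : IsNonAssociativeRing _≡_ _+_ _*_ -_ 0# 1#)
  (_≟_ : DecidableEquality A) (1≢0 : 1# ≢ 0#) where

  open MatrixProperties isRing _≟_ 1≢0

  marks : Fin 5 → A
  marks 0F = 0#
  marks 1F = 0#
  marks 2F = 1#
  marks 3F = 1#
  marks 4F = 1#

  copies : A → Fin 5 → A
  copies x 0F = x
  copies x 1F = x
  copies x 2F = x
  copies x 3F = 0#
  copies x 4F = 0#

  -- The five columns made from one column stay adjacent, so that a machine can write them while its
  -- input head is at a single entry.
  gadget : ∀ {k n} → Matrix k n → Matrix (suc k) (suc (n ℕ.* 5))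
  gadget     G zero    zero    = 1#
  gadget {n = n} G zero    (suc j) = marks (proj₂ (remQuot {n} 5 j))
  gadget     G (suc i) zero    = 0#
  gadget {n = n} G (suc i) (suc j) = uncurry (λ l → copies (G i l)) (remQuot {n} 5 j)

  -- The linear combination of the rows of gadget G with coefficients u and c
  -- is spread u (c G).

  entry : A → A → Fin 5 → A
  entry u y 0F = y
  entry u y 1F = y
  entry u y 2F = u + y
  entry u y 3F = u
  entry u y 4F = u

  spread : ∀ {n} → A → Vector A n → Vector A (suc (n ℕ.* 5))
  spread u y zero    = u
  spread {n} u y (suc j) = uncurry (λ l → entry u (y l)) (remQuot {n} 5 j)

  entry-cong : ∀ {u v x y} → u ≡ v → x ≡ y → ∀ c → entry u x c ≡ entry v y c
  entry-cong u≡v x≡y c = cong₂ (λ u x → entry u x c) u≡v x≡y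

  spread-cong : ∀ {n u v} {x y : Vector A n} → u ≡ v → (∀ j → x j ≡ y j) →
                ∀ j → spread u x j ≡ spread v y j
  spread-cong u≡v x≡y zero        = u≡v
  spread-cong {n} u≡v x≡y (suc j) = entry-cong u≡v (x≡y _) (proj₂ (remQuot {n} 5 j))

  gadget-zero : ∀ {k n} (G : Matrix k n) j → gadget G zero j ≡ spread {n} 1# (λ _ → 0#) j
  gadget-zero G zero            = refl
  gadget-zero {n = n} G (suc j) = marks≡ (proj₂ (remQuot {n} 5 j))
    where
    marks≡ : ∀ c → marks c ≡ entry 1# 0# c
    marks≡ 0F = refl
    marks≡ 1F = refl
    marks≡ 2F = sym (+-identityʳ 1#)
    marks≡ 3F = refl
    marks≡ 4F = refl

  gadget-suc : ∀ {k n} (G : Matrix k n) i j → gadget G (suc i) j ≡ spread 0# (G i) j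
  gadget-suc G i zero            = refl
  gadget-suc {n = n} G i (suc j) = copies≡ (remQuot {n} 5 j)
    where
    copies≡ : ∀ ((l , c) : Fin n × Fin 5) → copies (G i l) c ≡ entry 0# (G i l) c
    copies≡ (l , 0F) = refl
    copies≡ (l , 1F) = refl
    copies≡ (l , 2F) = sym (+-identityˡ _)
    copies≡ (l , 3F) = refl
    copies≡ (l , 4F) = refl

  combination-gadget : ∀ {k n} (G : Matrix k n) (c : Vector A (suc k)) j →
    combination c (gadget G) j ≡ spread (c zero) (combination (c ∘ suc) G) j
  combination-gadget G c zero = trans
    (cong₂ _+_ (*-identityʳ _) (sum-zero λ i → zeroʳ (c (suc i)))) (+-identityʳ _)
  combination-gadget {n = n} G c (suc j) = at (proj₂ (remQuot {n} 5 j))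
    where
    u = c zero
    l = proj₁ (remQuot {n} 5 j)
    y = combination (c ∘ suc) G l
    z = sum λ i → c (suc i) * 0#
    zeros : u + z ≡ u
    zeros = trans (cong (u +_) (sum-zero λ i → zeroʳ (c (suc i)))) (+-identityʳ u)
    at : ∀ d → (u * marks d) + sum (λ i → c (suc i) * copies (G i l) d)
             ≡ entry u (combination (c ∘ suc) G l) d
    at 0F = trans (cong (_+ y) (zeroʳ u)) (+-identityˡ y)
    at 1F = trans (cong (_+ y) (zeroʳ u)) (+-identityˡ y)
    at 2F = cong (_+ y) (*-identityʳ u)
    at 3F = trans (cong (_+ z) (*-identityʳ u)) zeros
    at 4F = trans (cong (_+ z) (*-identityʳ u)) zeros

  -- The leading column isolates `c zero`, and copy `0F` of each column of `B` stands below a zero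
  -- and so involves only the other coefficients.
  gadget-independent : ∀ {k n} {B : Matrix k n} →
    LinearlyIndependentRows B → LinearlyIndependentRows (gadget B)
  gadget-independent {n = n} {B} independent c cB≡0 = λ where
      zero    → c₀≡0
      (suc i) → independent (c ∘ suc) rest≡0 i
    where
    c₀≡0 : c zero ≡ 0#
    c₀≡0 = trans (sym (combination-gadget B c zero)) (cB≡0 zero)
    rest≡0 : ∀ l → combination (c ∘ suc) B l ≡ 0#
    rest≡0 l = trans
      (cong (uncurry (λ l → entry (c zero) (combination (c ∘ suc) B l)))
        (sym (Fin.remQuot-combine {n} {5} l 0F)))
      (trans (sym (combination-gadget B c (suc (combine l 0F)))) (cB≡0 (suc (combine l 0F))))

  module _ {k n : ℕ} (B G : Matrix k n) where

    -- By `combination-gadget` a codeword of the enlarged code depends only on the top coefficient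
    -- and on a codeword of the old code, whose coefficients may be exchanged for others.
    RowSpan-gadget : (∀ {v} → RowSpan G v → RowSpan B v) →
                     ∀ {v} → RowSpan (gadget G) v → RowSpan (gadget B) v
    RowSpan-gadget G⊆B {v} (c , v≡cG) = d , v≡dB
      where
      inB = G⊆B {combination (c ∘ suc) G} (c ∘ suc , λ _ → refl)
      d : Vector A (suc k)
      d zero    = c zero
      d (suc i) = proj₁ inB i
      v≡dB : ∀ j → v j ≡ combination d (gadget B) j
      v≡dB j = trans (v≡cG j) (trans (combination-gadget G c j)
        (trans (spread-cong refl (proj₂ inB) j) (sym (combination-gadget B d j))))

  -- `IsGeneratorMatrix` provides some basis `B` of the row span, possibly other than the rows of
  -- `G`; enlarging `B` in the same way gives a basis of the new span.
  gadget-generator : ∀ {k n} (G : Matrix k n) → IsGeneratorMatrix G → IsGeneratorMatrix (gadget G)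
  gadget-generator G (B , independent , span) =
    gadget B , gadget-independent independent ,
    λ v → mk⇔ (RowSpan-gadget B G (λ {w} → Equivalence.to (span w)))
              (RowSpan-gadget G B (λ {w} → Equivalence.from (span w)))

-- From signed matchings of columns to permutations

module GadgetMatching {A : Set} {_+_ _*_ : Op₂ A} { -_ : Op₁ A} {0# 1# : A}
  (isRing : IsNonAssociativeRing _≡_ _+_ _*_ -_ 0# 1#)
  (_≟_ : DecidableEquality A) (1≢0 : 1# ≢ 0#) where

  open MatrixProperties isRing _≟_ 1≢0
  open CodeGadget isRing _≟_ 1≢0
  open Counting _≟_

  SignedMatching : ∀ {m n} → Matrix m n → Matrix m n → Permutation′ n → Set
  SignedMatching M N π =
    ∀ j → (∀ i → N i j ≡ M i (π ⟨$⟩ʳ j)) ⊎ (∀ i → N i j ≡ - M i (π ⟨$⟩ʳ j))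

  count-spread : ∀ {n} u (y : Vector A n) x → count (spread u y) x ≡
    δ u x ℕ.+ ∑ λ l → δ (y l) x ℕ.+ (δ (y l) x ℕ.+ (δ (u + y l) x ℕ.+ (δ u x ℕ.+ δ u x)))
  count-spread {n} u y x =
    cong (δ u x ℕ.+_) (∑-blocks n λ (l , c) → δ (entry u (y l) c) x)

  -- The left-hand row has 2n zeros, the right-hand one more if u ≡ 0, and fewer
  -- if u ≢ 0 and some y l ≢ 0.
  border-matching : ∀ {n} u (y : Vector A n) (π : Permutation′ (suc (n ℕ.* 5))) →
    (∀ j → spread {n} 1# (λ _ → 0#) j ≡ spread u y (π ⟨$⟩ʳ j) ⊎
           spread {n} 1# (λ _ → 0#) j ≡ - spread u y (π ⟨$⟩ʳ j)) →
    u ≢ 0# × (∀ l → y l ≡ 0#)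
  border-matching {n} u y π matched =
    u≢0 , λ l → y≡0 l (y l ≟ 0#) (∑-tight {f = t} t≤2 (ℕ.≤-reflexive (sym ∑t)) l)
    where
    t : Fin n → ℕ
    t l = δ (y l) 0# ℕ.+ (δ (y l) 0# ℕ.+ (δ (u + y l) 0# ℕ.+ (δ u 0# ℕ.+ δ u 0#)))

    zeros : count (spread {n} 1# (λ _ → 0#)) 0# ≡ ∑ {n} (λ _ → 2)
    zeros = trans (count-spread {n} 1# (λ _ → 0#) 0#)
      (cong₂ ℕ._+_ (δ-≢ 1≢0) (∑-cong {n} λ _ →
        cong₂ (λ a b → a ℕ.+ (a ℕ.+ b)) (δ-≡ {0#} refl)
          (cong₂ (λ a b → a ℕ.+ (b ℕ.+ b))
            (δ-≢ λ eq → 1≢0 (trans (sym (+-identityʳ 1#)) eq)) (δ-≢ 1≢0))))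

    -- Negation fixes zero, so this count does not see the unknown signs.
    same-zeros : count (spread {n} 1# (λ _ → 0#)) 0# ≡ count (spread u y) 0#
    same-zeros = trans (∑-cong λ j → δ-⇔ (zero⇔ (matched j)))
      (sym (∑-permute (λ j → δ (spread u y j) 0#) π))
      where
      zero⇔ : ∀ {a b} → a ≡ b ⊎ a ≡ - b → a ≡ 0# ⇔ b ≡ 0#
      zero⇔ (inj₁ refl) = mk⇔ (λ eq → eq) (λ eq → eq)
      zero⇔ (inj₂ refl) = mk⇔ -x≡0⇒x≡0 (λ b≡0 → trans (cong -_ b≡0) ε⁻¹≈ε)

    total : δ u 0# ℕ.+ ∑ t ≡ ∑ {n} (λ _ → 2)
    total = trans (sym (count-spread u y 0#)) (trans (sym same-zeros) zeros)

    -- If `u` vanished, the last two columns of every block and the leading column would give at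
    -- least `2n + 1` zeros.
    u≢0 : u ≢ 0#
    u≢0 u≡0 = ℕ.<-irrefl refl (ℕ.≤-trans
      (ℕ.+-mono-≤ (ℕ.≤-reflexive (sym (δ-≡ u≡0))) (∑-mono 2≤t)) (ℕ.≤-reflexive total))
      where
      2≤t : ∀ l → 2 ≤ t l
      2≤t l = ℕ.m≤n⇒m≤o+n (δ (y l) 0#) (ℕ.m≤n⇒m≤o+n (δ (y l) 0#) (ℕ.m≤n⇒m≤o+n (δ (u + y l) 0#)
        (ℕ.≤-reflexive (sym (cong₂ ℕ._+_ (δ-≡ u≡0) (δ-≡ u≡0))))))

    ∑t : ∑ t ≡ ∑ {n} (λ _ → 2)
    ∑t = trans (cong (ℕ._+ ∑ t) (sym (δ-≢ u≢0))) total

    u-terms : ∀ l → t l ≡ δ (y l) 0# ℕ.+ (δ (y l) 0# ℕ.+ δ (u + y l) 0#)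
    u-terms l = cong (λ d → δ (y l) 0# ℕ.+ (δ (y l) 0# ℕ.+ d))
      (trans (cong (λ d → δ (u + y l) 0# ℕ.+ (d ℕ.+ d)) (δ-≢ u≢0)) (ℕ.+-identityʳ _))

    -- Only `u + y l` can vanish here, which loses against the two zeros per block that are
    -- required.
    t≤1 : ∀ l → y l ≢ 0# → t l ≤ 1
    t≤1 l y≢0 = ℕ.≤-trans (ℕ.≤-reflexive (trans (u-terms l)
      (cong (λ d → d ℕ.+ (d ℕ.+ δ (u + y l) 0#)) (δ-≢ y≢0)))) (δ-≤1 (u + y l) 0#)

    t≤2 : ∀ l → t l ≤ 2
    t≤2 l = by (y l ≟ 0#)
      where
      by : Dec (y l ≡ 0#) → t l ≤ 2
      by (no  y≢0) = ℕ.≤-trans (t≤1 l y≢0) (s≤s z≤n)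
      by (yes y≡0) = ℕ.≤-reflexive (trans (u-terms l)
        (cong₂ (λ a b → a ℕ.+ (a ℕ.+ b)) (δ-≡ y≡0)
          (δ-≢ λ eq → u≢0 (trans (sym (+-identityʳ u)) (trans (cong (u +_) (sym y≡0)) eq)))))

    y≡0 : ∀ l → Dec (y l ≡ 0#) → 2 ≤ t l → y l ≡ 0#
    y≡0 l (yes eq)  _   = eq
    y≡0 l (no  y≢0) 2≤t = ⊥-elim (ℕ.<-irrefl refl (ℕ.≤-trans 2≤t (t≤1 l y≢0)))

  -- The common shape of both sides of the equation: `S ⊗ gadget G` has it with the first column of
  -- `S` as `u`, and `gadget H` has it with a unit vector as `u`.
  grid : ∀ {k n} → Vector A k → Matrix k n → Matrix k (suc (n ℕ.* 5))
  grid u Y i = spread (u i) (Y i)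

  -- Columns become vectors because these have decidable equality, without which they could not be
  -- counted.
  column : ∀ {k n} → Matrix k n → Fin n → Vec A k
  column M j = tabulate λ i → M i j

  _≟ᵥ_ : ∀ {k} → DecidableEquality (Vec A k)
  _≟ᵥ_ = Vec.≡-dec _≟_

  tabulate-injective : ∀ {k} {x y : Vector A k} → tabulate x ≡ tabulate y → ∀ i → x i ≡ y i
  tabulate-injective {x = x} {y} eq i =
    trans (sym (Vec.lookup∘tabulate x i)) (trans (cong (λ v → lookup v i) eq) (Vec.lookup∘tabulate y i))

  spread-values : ∀ {n u} {y : Vector A n} → (∀ l → y l ≡ 0#) →
                  ∀ j → spread u y j ≡ u ⊎ spread u y j ≡ 0#
  spread-values y≡0 zero = inj₁ refl
  spread-values {n} {u} {y} y≡0 (suc j) = entry-values (proj₂ (remQuot {n} 5 j))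
    where
    l = proj₁ (remQuot {n} 5 j)
    entry-values : ∀ c → entry u (y l) c ≡ u ⊎ entry u (y l) c ≡ 0#
    entry-values 0F = inj₂ (y≡0 l)
    entry-values 1F = inj₂ (y≡0 l)
    entry-values 2F = inj₁ (trans (cong (u +_) (y≡0 l)) (+-identityʳ u))
    entry-values 3F = inj₁ refl
    entry-values 4F = inj₁ refl

  module _ {k : ℕ} where
    open Counting (_≟ᵥ_ {suc k}) using () renaming
      (δ to δᵥ; δ-≡ to δᵥ-≡; δ-≢ to δᵥ-≢; δ-⇔ to δᵥ-⇔; δ-≤1 to δᵥ-≤1; count to countᵥ; matching to matchingᵥ)

    shifted : ∀ {n} → Vector A (suc k) → Matrix (suc k) n → Matrix (suc k) n
    shifted u Y i l = u i + Y i l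

    -- Only the columns with a 1 on top are counted; of the five columns made
    -- from Y _ l these are the last three.
    count-grid : ∀ {n} (u : Vector A (suc k)) (Y : Matrix (suc k) n) →
      (∀ l → Y zero l ≡ 0#) → ∀ X → lookup X zero ≡ 1# →
      countᵥ (column (grid u Y)) X ≡
      δᵥ (tabulate u) X ℕ.+ ∑ λ l →
        δᵥ (column (shifted u Y) l) X ℕ.+ (δᵥ (tabulate u) X ℕ.+ δᵥ (tabulate u) X)
    count-grid {n} u Y Y₀≡0 X X₀≡1 = cong (δᵥ (tabulate u) X ℕ.+_) (trans
      (∑-blocks n λ (l , c) → δᵥ (tabulate λ i → entry (u i) (Y i l) c) X)
      (∑-cong λ l → cong (λ d → d ℕ.+ (d ℕ.+
          (δᵥ (column (shifted u Y) l) X ℕ.+ (δᵥ (tabulate u) X ℕ.+ δᵥ (tabulate u) X))))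
        (δᵥ-≢ {column Y l} {X} λ eq → 1≢0 (trans (sym X₀≡1) (trans (cong (λ v → lookup v zero) (sym eq)) (Y₀≡0 l))))))

    spread-binary : ∀ {n u} {y : Vector A n} → u ≡ 1# → (∀ l → y l ≡ 0#) →
                    ∀ j → spread u y j ≡ 1# ⊎ spread u y j ≡ 0#
    spread-binary u≡1 y≡0 j = Sum.map₁ (λ eq → trans eq u≡1) (spread-values y≡0 j)

    -- In a column with a 1 on top the sign can only be 1, up to the case
    -- where 1 and -1 coincide.
    count-signed : ∀ {n} (u v : Vector A (suc k)) (Y Z : Matrix (suc k) n) π →
      u zero ≡ 1# → v zero ≡ 1# → (∀ l → Y zero l ≡ 0#) → (∀ l → Z zero l ≡ 0#) →
      SignedMatching (grid u Y) (grid v Z) π →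
      ∀ X → lookup X zero ≡ 1# →
      countᵥ (column (grid v Z)) X ≡ countᵥ (column (grid u Y)) X
    count-signed u v Y Z π u₀ v₀ Y₀ Z₀ matched X X₀≡1 = trans
      (∑-cong λ j → by j (matched j))
      (sym (∑-permute (λ j → δᵥ (column (grid u Y) j) X) π))
      where
      M = grid u Y
      N = grid v Z

      equal : ∀ j → (∀ i → N i j ≡ M i (π ⟨$⟩ʳ j)) →
              δᵥ (column N j) X ≡ δᵥ (column M (π ⟨$⟩ʳ j)) X
      equal j N≡M = cong (λ c → δᵥ c X) (Vec.tabulate-cong N≡M)

      1≡-1⇒x≡-x : 1# ≡ - 1# → ∀ x → - x ≡ x
      1≡-1⇒x≡-x eq x = trans (sym (x*-1≡-x x)) (trans (cong (x *_) (sym eq)) (*-identityʳ x))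

      not-one : 1# ≢ - 1# → ∀ {a b} → a ≡ - b → b ≡ 1# ⊎ b ≡ 0# → a ≢ 1#
      not-one 1≢-1 a≡-b (inj₁ b≡1) a≡1 = 1≢-1 (trans (sym a≡1) (trans a≡-b (cong -_ b≡1)))
      not-one 1≢-1 a≡-b (inj₂ b≡0) a≡1 =
        1≢0 (trans (sym a≡1) (trans a≡-b (trans (cong -_ b≡0) ε⁻¹≈ε)))

      top : ∀ {m} (K : Matrix (suc k) m) j → column K j ≡ X → K zero j ≡ 1#
      top K j eq = trans (cong (λ c → lookup c zero) eq) X₀≡1

      by : ∀ j → (∀ i → N i j ≡ M i (π ⟨$⟩ʳ j)) ⊎ (∀ i → N i j ≡ - M i (π ⟨$⟩ʳ j)) →
           δᵥ (column N j) X ≡ δᵥ (column M (π ⟨$⟩ʳ j)) X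
      by j (inj₁ N≡M)  = equal j N≡M
      by j (inj₂ N≡-M) = split (1# ≟ (- 1#))
        where
        split : Dec (1# ≡ - 1#) → δᵥ (column N j) X ≡ δᵥ (column M (π ⟨$⟩ʳ j)) X
        split (yes eq) = equal j λ i → trans (N≡-M i) (1≡-1⇒x≡-x eq _)
        -- All tops are `1#` or `0#`, so a negated column has no `1#` on top on either side, and
        -- both indicators vanish.
        split (no 1≢-1) = trans
          (δᵥ-≢ {column N j} {X} λ eq → not-one 1≢-1 (N≡-M zero) (spread-binary u₀ Y₀ (π ⟨$⟩ʳ j)) (top N j eq))
          (sym (δᵥ-≢ {column M (π ⟨$⟩ʳ j)} {X} λ eq → not-one 1≢-1
            (trans (sym (⁻¹-involutive _)) (cong -_ (sym (N≡-M zero))))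
            (spread-binary v₀ Z₀ j) (top M (π ⟨$⟩ʳ j) eq)))

    -- More than half of the columns of grid v Z with a 1 on top are v.
    grid-matching : ∀ {n} (u v : Vector A (suc k)) (Y Z : Matrix (suc k) n) π →
      u zero ≡ 1# → v zero ≡ 1# → (∀ l → Y zero l ≡ 0#) → (∀ l → Z zero l ≡ 0#) →
      SignedMatching (grid u Y) (grid v Z) π →
      (∀ i → u i ≡ v i) × Σ[ ρ ∈ Permutation′ n ] (∀ i l → Z i l ≡ Y i (ρ ⟨$⟩ʳ l))
    grid-matching {n} u v Y Z π u₀ v₀ Y₀ Z₀ matched =
      u≡v , proj₁ blocks , λ i l → ∙-cancelˡ (v i) _ _ (trans
        (tabulate-injective {x = λ i → shifted v Z i l} {λ i → shifted u Y i (proj₁ blocks ⟨$⟩ʳ l)}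
          (proj₂ blocks l) i)
        (cong (_+ Y i (proj₁ blocks ⟨$⟩ʳ l)) (u≡v i)))
      where
      D E : Vec A (suc k) → ℕ
      D X = δᵥ (tabulate u) X
      E X = δᵥ (tabulate v) X

      counts : ∀ X → lookup X zero ≡ 1# →
        E X ℕ.+ ∑ (λ l → δᵥ (column (shifted v Z) l) X ℕ.+ (E X ℕ.+ E X)) ≡
        D X ℕ.+ ∑ (λ l → δᵥ (column (shifted u Y) l) X ℕ.+ (D X ℕ.+ D X))
      counts X X₀≡1 = trans (sym (count-grid v Z Z₀ X X₀≡1))
        (trans (count-signed u v Y Z π u₀ v₀ Y₀ Z₀ matched X X₀≡1) (count-grid u Y Y₀ X X₀≡1))

      tabulate≡ : tabulate u ≡ tabulate v
      tabulate≡ = by (tabulate u ≟ᵥ tabulate v)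
        where
        X = tabulate v
        by : Dec (tabulate u ≡ tabulate v) → tabulate u ≡ tabulate v
        by (yes eq) = eq
        -- Count the column `v`. It occurs `2n + 1` times in `grid v Z`, of which `n + 1` are enough
        -- here; if `u` differs from `v`, then in `grid u Y` it can occur only among the `n` columns
        -- of `shifted u Y`.
        by (no  ne) = ⊥-elim (ℕ.<-irrefl refl (begin-strict
          ∑ {n} (λ _ → 1)
            <⟨ s≤s (∑-mono {n} λ l → ℕ.≤-trans (s≤s z≤n)
                 (ℕ.≤-trans (ℕ.≤-reflexive (sym (cong₂ ℕ._+_ E≡1 E≡1)))
                   (ℕ.m≤n+m _ (δᵥ (column (shifted v Z) l) X)))) ⟩
          1 ℕ.+ ∑ (λ l → δᵥ (column (shifted v Z) l) X ℕ.+ (E X ℕ.+ E X))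
            ≡⟨ cong (ℕ._+ ∑ (λ l → δᵥ (column (shifted v Z) l) X ℕ.+ (E X ℕ.+ E X))) (sym E≡1) ⟩
          E X ℕ.+ ∑ (λ l → δᵥ (column (shifted v Z) l) X ℕ.+ (E X ℕ.+ E X))
            ≡⟨ counts X v₀ ⟩
          D X ℕ.+ ∑ (λ l → δᵥ (column (shifted u Y) l) X ℕ.+ (D X ℕ.+ D X))
            ≡⟨ cong₂ ℕ._+_ D≡0 (∑-cong λ l → trans
                 (cong (λ d → δᵥ (column (shifted u Y) l) X ℕ.+ (d ℕ.+ d)) D≡0) (ℕ.+-identityʳ _)) ⟩
          ∑ (λ l → δᵥ (column (shifted u Y) l) X)
            ≤⟨ ∑-mono (λ l → δᵥ-≤1 (column (shifted u Y) l) X) ⟩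
          ∑ {n} (λ _ → 1) ∎))
          where
          open ℕ.≤-Reasoning
          D≡0 : D X ≡ 0
          D≡0 = δᵥ-≢ ne
          E≡1 : E X ≡ 1
          E≡1 = δᵥ-≡ {tabulate v} refl

      u≡v : ∀ i → u i ≡ v i
      u≡v = tabulate-injective tabulate≡

      -- For `X` with `1#` on top, the equal numbers of copies of `u` and `v` cancel. Any other `X`
      -- is missing on both sides, since shifted columns have `1#` on top.
      block-counts : ∀ X →
        countᵥ (column (shifted v Z)) X ≡ countᵥ (column (shifted u Y)) X
      block-counts X = by (lookup X zero ≟ 1#)
        where
        misses : ∀ (w : Vector A (suc k)) (W : Matrix (suc k) n) → w zero ≡ 1# → (∀ l → W zero l ≡ 0#) →
                 lookup X zero ≢ 1# → countᵥ (column (shifted w W)) X ≡ 0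
        misses w W w₀ W₀ X₀≢1 = trans
          (∑-cong λ l → δᵥ-≢ {column (shifted w W) l} {X} λ eq →
            X₀≢1 (trans (cong (λ c → lookup c zero) (sym eq))
              (trans (cong₂ _+_ w₀ (W₀ l)) (+-identityʳ 1#))))
          (trans (∑-const n 0) (ℕ.*-zeroʳ n))

        by : Dec (lookup X zero ≡ 1#) →
             countᵥ (column (shifted v Z)) X ≡ countᵥ (column (shifted u Y)) X
        by (no  X₀≢1) = trans (misses v Z v₀ Z₀ X₀≢1) (sym (misses u Y u₀ Y₀ X₀≢1))
        by (yes X₀≡1) = ℕ.+-cancelʳ-≡ (∑ {n} (λ _ → E X ℕ.+ E X)) _ _
          (trans (sym (∑-+ (λ l → δᵥ (column (shifted v Z) l) X) (λ _ → E X ℕ.+ E X)))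
            (trans (ℕ.+-cancelˡ-≡ (E X) _ _ (trans (counts X X₀≡1)
                     (cong (λ d → d ℕ.+ ∑ (λ l → δᵥ (column (shifted u Y) l) X ℕ.+ (d ℕ.+ d)))
                       (cong (λ c → δᵥ c X) tabulate≡))))
                   (∑-+ (λ l → δᵥ (column (shifted u Y) l) X) (λ _ → E X ℕ.+ E X))))

      blocks = matchingᵥ (column (shifted v Z)) (column (shifted u Y)) block-counts

-- Correctness of the gadget

module GadgetCorrectness {A : Set} {_+_ _*_ : Op₂ A} { -_ : Op₁ A} {0# 1# : A}
  (isRing : IsNonAssociativeRing _≡_ _+_ _*_ -_ 0# 1#)
  (_≟_ : DecidableEquality A) (1≢0 : 1# ≢ 0#) where

  open MatrixProperties isRing _≟_ 1≢0
  open CodeGadget isRing _≟_ 1≢0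
  open GadgetMatching isRing _≟_ 1≢0

  bordered : ∀ {k} → Matrix k k → Matrix (suc k) (suc k)
  bordered S zero    zero    = 1#
  bordered S zero    (suc j) = 0#
  bordered S (suc i) zero    = 0#
  bordered S (suc i) (suc j) = S i j

  bordered-inverse : ∀ {k} (S T : Matrix k k) → S ⊗ T ≋ identity →
                     bordered S ⊗ bordered T ≋ identity
  bordered-inverse {k} S T ST≡1 zero zero =
    trans (cong₂ _+_ (*-identityʳ 1#) (sum-zero {k} λ _ → zeroʳ 0#)) (+-identityʳ 1#)
  bordered-inverse S T ST≡1 zero (suc j) =
    trans (cong₂ _+_ (zeroʳ 1#) (sum-zero λ i → zeroˡ (T i j))) (+-identityʳ 0#)
  bordered-inverse S T ST≡1 (suc i) zero =
    trans (cong₂ _+_ (zeroˡ 1#) (sum-zero λ s → zeroʳ (S i s))) (+-identityʳ 0#)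
  bordered-inverse S T ST≡1 (suc i) (suc j) =
    trans (cong (_+ (S ⊗ T) i j) (zeroʳ 0#)) (trans (+-identityˡ _) (ST≡1 i j))

  blockwise : ∀ {n} → Permutation′ n → Permutation′ (suc (n ℕ.* 5))
  blockwise {n} π = Perm.lift₀ (↔-sym (Fin.*↔× {n} {5}) ↔-∘ ((π ×-↔ ↔-id (Fin 5)) ↔-∘ Fin.*↔× {n} {5}))

  spread-blockwise : ∀ {n} (π : Permutation′ n) u (y : Vector A n) j →
    spread u y (blockwise π ⟨$⟩ʳ j) ≡ spread u (y ∘ (π ⟨$⟩ʳ_)) j
  spread-blockwise π u y zero = refl
  spread-blockwise {n} π u y (suc j) =
    cong (uncurry λ l → entry u (y l))
      (Fin.remQuot-combine (π ⟨$⟩ʳ proj₁ (remQuot {n} 5 j)) (proj₂ (remQuot {n} 5 j)))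

  unit : ∀ {k} → Vector A (suc k)
  unit zero    = 1#
  unit (suc _) = 0#

  below : ∀ {k n} → Matrix k n → Matrix (suc k) n
  below H zero    _ = 0#
  below H (suc i)   = H i

  gadget≡grid : ∀ {k n} (H : Matrix k n) i j → gadget H i j ≡ grid unit (below H) i j
  gadget≡grid H zero    = gadget-zero H
  gadget≡grid H (suc i) = gadget-suc H i

  gadget-complete : ∀ {k n} (G H : Matrix k n) →
    (∃[ S ] ∃[ P ] (Invertible S × IsPermutationMatrix P × S ⊗ G ⊗ P ≋ H)) →
    ∃[ S ] ∃[ P ] (Invertible S × IsSignedPermutationMatrix P × S ⊗ gadget G ⊗ P ≋ gadget H)
  gadget-complete {k} {n} G H (S , P , (T , ST≡1 , TS≡1) , isPermutation , SGP≡H) =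
      bordered S , permutationMatrix σ
    , (bordered T , bordered-inverse S T ST≡1 , bordered-inverse T S TS≡1)
    , permutationMatrix-isSigned σ
    , λ i j → trans (⊗-permutationMatrix (bordered S ⊗ gadget G) σ i j)
        (trans (combination-gadget G (bordered S i) (σ ⟨$⟩ʳ j))
          (trans (spread-blockwise π (bordered S i zero) (combination (bordered S i ∘ suc) G) j)
            (trans (rows i j) (sym (gadget≡grid H i j)))))
    where
    columns = permutation-columns (S ⊗ G) H P isPermutation SGP≡H
    π = proj₁ columns
    σ = blockwise π
    rows : ∀ i j → spread (bordered S i zero)
                     (combination (bordered S i ∘ suc) G ∘ (π ⟨$⟩ʳ_)) j
                   ≡ grid unit (below H) i j
    rows zero    = spread-cong refl λ l → combination-zero G (λ _ → refl) (π ⟨$⟩ʳ l)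
    rows (suc i) = spread-cong refl λ l → sym (proj₂ columns i l)

  neg-entry : ∀ u y c → entry (- u) (- y) c ≡ - entry u y c
  neg-entry u y 0F = refl
  neg-entry u y 1F = refl
  neg-entry u y 2F = ⁻¹-∙-comm u y
  neg-entry u y 3F = refl
  neg-entry u y 4F = refl

  neg-spread : ∀ {n} u (y : Vector A n) j → spread (- u) (λ l → - y l) j ≡ - spread u y j
  neg-spread u y zero        = refl
  neg-spread {n} u y (suc j) = neg-entry u (y _) (proj₂ (remQuot {n} 5 j))

  module Soundness {k n : ℕ} (G H : Matrix k n) (π : Permutation′ (suc (n ℕ.* 5))) where

    tops : Matrix (suc k) (suc k) → Vector A (suc k)
    tops S i = S i zero

    rests : Matrix (suc k) (suc k) → Matrix (suc k) n
    rests S i = combination (S i ∘ suc) G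

    Matched : Matrix (suc k) (suc k) → Set
    Matched S = SignedMatching (grid (tops S) (rests S)) (grid unit (below H)) π

    Solution : Set
    Solution = ∃[ S ] ∃[ P ] (Invertible S × IsPermutationMatrix P × S ⊗ G ⊗ P ≋ H)

    -- By `grid-matching` the first column of `S` is a unit vector. So `S` is block triangular, and
    -- the lower right blocks of `S` and `T` are inverse to each other.
    normalised : ∀ S → Invertible S → tops S zero ≡ 1# → (∀ l → rests S zero l ≡ 0#) →
                 Matched S → Solution
    normalised S (T , ST≡1 , TS≡1) S₀₀≡1 y≡0 matched =
        core S , permutationMatrix ρ
      , ( core T
        , (λ i j → trans (drop (S (suc i)) (λ s → T s (suc j)) (column≡0 i)) (ST≡1 (suc i) (suc j)))
        , (λ i j → trans (drop (T (suc i)) (λ s → S s (suc j)) (T-column≡0 i)) (TS≡1 (suc i) (suc j))))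
      , permutationMatrix-isPermutation ρ
      , λ i l → trans (⊗-permutationMatrix (core S ⊗ G) ρ i l) (sym (proj₂ (proj₂ matching) (suc i) l))
      where
      core : Matrix (suc k) (suc k) → Matrix k k
      core S i j = S (suc i) (suc j)

      matching = grid-matching (tops S) unit (rests S) (below H) π
        S₀₀≡1 refl y≡0 (λ _ → refl) matched
      ρ = proj₁ (proj₂ matching)

      column≡0 : ∀ i → S (suc i) zero ≡ 0#
      column≡0 i = proj₁ matching (suc i)

      drop : (x y : Vector A (suc k)) → x zero ≡ 0# →
             sum (λ s → x (suc s) * y (suc s)) ≡ sum (λ s → x s * y s)
      drop x y x₀≡0 = sym (trans
        (cong (_+ sum (λ s → x (suc s) * y (suc s)))
          (trans (cong (_* y zero) x₀≡0) (zeroˡ (y zero))))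
        (+-identityˡ _))

      -- The first column of `S` is a unit vector, so `T ⊗ S` and `T` have the same first column.
      T-column≡0 : ∀ i → T (suc i) zero ≡ 0#
      T-column≡0 i = trans (sym (trans
          (cong₂ _+_ (trans (cong (T (suc i) zero *_) S₀₀≡1) (*-identityʳ _))
            (sum-zero λ s → trans (cong (T (suc i) (suc s) *_) (column≡0 s)) (zeroʳ _)))
          (+-identityʳ _)))
        (TS≡1 (suc i) zero)

    infix 8 ⊖_
    ⊖_ : Matrix (suc k) (suc k) → Matrix (suc k) (suc k)
    (⊖ S) i j = - S i j

    ⊖-inverse : ∀ S T → S ⊗ T ≋ identity → ⊖ S ⊗ ⊖ T ≋ identity
    ⊖-inverse S T ST≡1 i j = trans
      (sum-cong-≗ λ s → trans (-‿distribˡ (S i s) (- T s j))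
        (trans (cong -_ (-‿distribʳ (S i s) (T s j))) (⁻¹-involutive _)))
      (ST≡1 i j)

    ⊖-grid : ∀ S i j → grid (tops (⊖ S)) (rests (⊖ S)) i j ≡ - grid (tops S) (rests S) i j
    ⊖-grid S i j = trans
      (spread-cong refl (combination-neg (S i ∘ suc) G) j)
      (neg-spread (S i zero) (rests S i) j)

    -- Negating `S` negates every column of the product, which merely exchanges the two alternatives
    -- at each `j`.
    ⊖-matched : ∀ S → Matched S → Matched (⊖ S)
    ⊖-matched S matched j = Sum.swap (Sum.map
      (λ eq i → trans (eq i) (trans (sym (⁻¹-involutive _)) (cong -_ (sym (⊖-grid S i (π ⟨$⟩ʳ j))))))
      (λ eq i → trans (eq i) (sym (⊖-grid S i (π ⟨$⟩ʳ j)))) (matched j))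

    solution : ∀ S → Invertible S → Matched S → Solution
    -- The leading column of `gadget H` has `1#` on top, while the top row on the other side takes
    -- only the values `S zero zero` and `0#`. So `S zero zero` is `1#` or `- 1#`, and in the latter
    -- case `⊖ S` takes the place of `S`.
    solution S (T , ST≡1 , TS≡1) matched = by (matched zero) (spread-values y≡0 (π ⟨$⟩ʳ zero))
      where
      border = border-matching (S zero zero) (rests S zero) π
        λ j → Sum.map (λ eq → eq zero) (λ eq → eq zero) (matched j)
      y≡0 = proj₂ border
      M₀ = grid (tops S) (rests S) zero (π ⟨$⟩ʳ zero)

      positive : S zero zero ≡ 1# → Solution
      positive S₀₀≡1 = normalised S (T , ST≡1 , TS≡1) S₀₀≡1 y≡0 matched

      negative : - S zero zero ≡ 1# → Solution
      negative -S₀₀≡1 = normalised (⊖ S) (⊖ T , ⊖-inverse S T ST≡1 , ⊖-inverse T S TS≡1) -S₀₀≡1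
        (λ l → trans (combination-neg (S zero ∘ suc) G l) (trans (cong -_ (y≡0 l)) ε⁻¹≈ε))
        (⊖-matched S matched)

      by : (∀ i → unit i ≡ grid (tops S) (rests S) i (π ⟨$⟩ʳ zero)) ⊎
           (∀ i → unit i ≡ - grid (tops S) (rests S) i (π ⟨$⟩ʳ zero)) →
           M₀ ≡ S zero zero ⊎ M₀ ≡ 0# → Solution
      by (inj₁ eq) (inj₁ M₀≡) = positive (sym (trans (eq zero) M₀≡))
      by (inj₂ eq) (inj₁ M₀≡) = negative (sym (trans (eq zero) (cong -_ M₀≡)))
      by (inj₁ eq) (inj₂ M₀≡0) = ⊥-elim (1≢0 (trans (eq zero) M₀≡0))
      by (inj₂ eq) (inj₂ M₀≡0) = ⊥-elim (1≢0 (trans (eq zero) (trans (cong -_ M₀≡0) ε⁻¹≈ε)))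

  gadget-correct : ∀ {k n} (G H : Matrix k n) →
    (∃[ S ] ∃[ P ] (Invertible S × IsPermutationMatrix P × S ⊗ G ⊗ P ≋ H)) ⇔
    (∃[ S ] ∃[ P ] (Invertible S × IsSignedPermutationMatrix P × S ⊗ gadget G ⊗ P ≋ gadget H))
  gadget-correct G H = mk⇔ (gadget-complete G H) sound
    where
    sound : (∃[ S ] ∃[ P ] (Invertible S × IsSignedPermutationMatrix P × S ⊗ gadget G ⊗ P ≋ gadget H)) →
            ∃[ S ] ∃[ P ] (Invertible S × IsPermutationMatrix P × S ⊗ G ⊗ P ≋ H)
    sound (S , P , invertible , isSigned , SGP≡H) =
      Soundness.solution G H (proj₁ columns) S invertible λ j → Sum.map
        (λ eq i → trans (sym (gadget≡grid H i j)) (trans (eq i) (combination-gadget G (S i) (proj₁ columns ⟨$⟩ʳ j))))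
        (λ eq i → trans (sym (gadget≡grid H i j))
          (trans (eq i) (cong -_ (combination-gadget G (S i) (proj₁ columns ⟨$⟩ʳ j)))))
        (proj₂ columns j)
      where
      columns = signedPermutation-columns (S ⊗ gadget G) (gadget H) P isSigned SGP≡H

-- The ring structure of 𝔽

module ModularRing (p : ℕ) .{{_ : ℕ.NonZero p}} where
  open RawRing (ModularArithmetic.ℤ/ p)

  private
    toℕ-mod : ∀ m → toℕ (m ℕ.mod p) ≡ m ℕ.% p
    toℕ-mod m = Fin.toℕ-fromℕ< (ℕ.m%n<n m p)

    mod-toℕ : ∀ (a : Fin p) → toℕ a ℕ.mod p ≡ a
    mod-toℕ a = Fin.toℕ-injective (trans (toℕ-mod (toℕ a)) (ℕ.m<n⇒m%n≡m (Fin.toℕ<n a)))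

    mod-cong : ∀ {m n} → m ℕ.% p ≡ n ℕ.% p → m ℕ.mod p ≡ n ℕ.mod p
    mod-cong {m} {n} eq = Fin.toℕ-injective (trans (toℕ-mod m) (trans eq (sym (toℕ-mod n))))

    -- Together with `mod-toℕ`, which presents each element as a remainder, this carries the laws of
    -- addition over from the natural numbers.
    mod-+ : ∀ m n → (m ℕ.mod p) + (n ℕ.mod p) ≡ (m ℕ.+ n) ℕ.mod p
    mod-+ m n = mod-cong (trans (cong₂ (λ a b → (a ℕ.+ b) ℕ.% p) (toℕ-mod m) (toℕ-mod n))
      (sym (ℕ.%-distribˡ-+ m n p)))

    mod-* : ∀ m n → (m ℕ.mod p) * (n ℕ.mod p) ≡ (m ℕ.* n) ℕ.mod p
    mod-* m n = mod-cong (trans (cong₂ (λ a b → (a ℕ.* b) ℕ.% p) (toℕ-mod m) (toℕ-mod n))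
      (sym (ℕ.%-distribˡ-* m n p)))

    +-assoc : ∀ a b c → (a + b) + c ≡ a + (b + c)
    +-assoc a b c = begin
      (a + b) + c                           ≡⟨ cong ((a + b) +_) (mod-toℕ c) ⟨
      (a + b) + (toℕ c ℕ.mod p)             ≡⟨ mod-+ (toℕ a ℕ.+ toℕ b) (toℕ c) ⟩
      (toℕ a ℕ.+ toℕ b ℕ.+ toℕ c) ℕ.mod p   ≡⟨ cong (ℕ._mod p) (ℕ.+-assoc (toℕ a) (toℕ b) (toℕ c)) ⟩
      (toℕ a ℕ.+ (toℕ b ℕ.+ toℕ c)) ℕ.mod p ≡⟨ mod-+ (toℕ a) (toℕ b ℕ.+ toℕ c) ⟨
      (toℕ a ℕ.mod p) + (b + c)             ≡⟨ cong (_+ (b + c)) (mod-toℕ a) ⟩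
      a + (b + c)                           ∎
      where open ≡-Reasoning

    +-comm : ∀ a b → a + b ≡ b + a
    +-comm a b = cong (ℕ._mod p) (ℕ.+-comm (toℕ a) (toℕ b))

    +-identityˡ : ∀ a → 0# + a ≡ a
    +-identityˡ a = trans (cong (0# +_) (sym (mod-toℕ a))) (trans (mod-+ 0 (toℕ a)) (mod-toℕ a))

    +-inverseˡ : ∀ a → (- a) + a ≡ 0#
    +-inverseˡ a = begin
      (- a) + a                         ≡⟨ cong ((- a) +_) (mod-toℕ a) ⟨
      (- a) + (toℕ a ℕ.mod p)           ≡⟨ mod-+ (p ℕ.∸ toℕ a) (toℕ a) ⟩
      (p ℕ.∸ toℕ a ℕ.+ toℕ a) ℕ.mod p   ≡⟨ cong (ℕ._mod p) (ℕ.m∸n+n≡m (ℕ.<⇒≤ (Fin.toℕ<n a))) ⟩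
      p ℕ.mod p                         ≡⟨ mod-cong (trans (ℕ.n%n≡0 p) (sym (ℕ.m<n⇒m%n≡m (ℕ.>-nonZero⁻¹ p)))) ⟩
      0#                                ∎
      where open ≡-Reasoning

    *-comm : ∀ a b → a * b ≡ b * a
    *-comm a b = cong (ℕ._mod p) (ℕ.*-comm (toℕ a) (toℕ b))

    *-identityˡ : ∀ a → 1# * a ≡ a
    *-identityˡ a = trans (cong (1# *_) (sym (mod-toℕ a)))
      (trans (mod-* 1 (toℕ a)) (trans (cong (ℕ._mod p) (ℕ.*-identityˡ (toℕ a))) (mod-toℕ a)))

    *-zeroˡ : ∀ a → 0# * a ≡ 0#
    *-zeroˡ a = trans (cong (0# *_) (sym (mod-toℕ a))) (mod-* 0 (toℕ a))

    *-distribˡ : ∀ a b c → a * (b + c) ≡ (a * b) + (a * c)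
    *-distribˡ a b c = begin
      a * (b + c)                                     ≡⟨ cong (_* (b + c)) (mod-toℕ a) ⟨
      (toℕ a ℕ.mod p) * (b + c)                       ≡⟨ mod-* (toℕ a) (toℕ b ℕ.+ toℕ c) ⟩
      (toℕ a ℕ.* (toℕ b ℕ.+ toℕ c)) ℕ.mod p           ≡⟨ cong (ℕ._mod p) (ℕ.*-distribˡ-+ (toℕ a) (toℕ b) (toℕ c)) ⟩
      (toℕ a ℕ.* toℕ b ℕ.+ toℕ a ℕ.* toℕ c) ℕ.mod p   ≡⟨ mod-+ (toℕ a ℕ.* toℕ b) (toℕ a ℕ.* toℕ c) ⟨
      (a * b) + (a * c)                               ∎
      where open ≡-Reasoning

  ℤ/-isNonAssociativeRing : IsNonAssociativeRing _≡_ _+_ _*_ -_ 0# 1#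
  ℤ/-isNonAssociativeRing = record
    { +-isAbelianGroup = record
      { isGroup = record
        { isMonoid = record
          { isSemigroup = record
            { isMagma = record { isEquivalence = isEquivalence ; ∙-cong = cong₂ _+_ }
            ; assoc = +-assoc }
          ; identity = Consequences.comm∧idˡ⇒id +-comm +-identityˡ }
        ; inverse = Consequences.comm∧invˡ⇒inv +-comm +-inverseˡ
        ; ⁻¹-cong = cong -_ }
      ; comm = +-comm }
    ; *-cong = cong₂ _*_
    ; *-identity = Consequences.comm∧idˡ⇒id *-comm *-identityˡ
    ; distrib = *-distribˡ , λ a b c →
        trans (*-comm (b + c) a) (trans (*-distribˡ a b c) (cong₂ _+_ (*-comm a b) (*-comm a c)))
    ; zero = Consequences.comm∧zeˡ⇒ze *-comm *-zeroˡ }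

-- Quotients of polynomial rings by monic polynomials

module QuotientRing {A : Set} {_+_ _*_ : Op₂ A} { -_ : Op₁ A} {0# 1# : A}
  (isRing : IsNonAssociativeRing _≡_ _+_ _*_ -_ 0# 1#) where

  open IsNonAssociativeRing isRing
    using ( +-isAbelianGroup; +-assoc; +-comm; +-identityˡ; +-identityʳ; -‿inverseˡ
          ; distribˡ; distribʳ; zeroˡ; zeroʳ; *-identity)

  R : RawRing _ _
  R = record { Carrier = A ; _≈_ = _≡_ ; _+_ = _+_ ; _*_ = _*_ ; -_ = -_ ; 0# = 0# ; 1# = 1# }

  open Polynomials R using (constant; timesX; horner; quotientRing)

  private
    +-abelianGroup : AbelianGroup _ _
    +-abelianGroup = record { isAbelianGroup = +-isAbelianGroup }

    open AbelianGroupProperties +-abelianGroup using (ε⁻¹≈ε; ⁻¹-∙-comm)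
    open CommutativeSemigroupProperties
      (AbelianGroup.commutativeSemigroup +-abelianGroup) using () renaming (interchange to medial)

    infixl 6 _⊕_
    _⊕_ : ∀ {r} → Vec A r → Vec A r → Vec A r
    _⊕_ = zipWith _+_

    zeros : ∀ {r} → Vec A r
    zeros = Vec.replicate _ 0#

    ⊕-identityˡ : ∀ {r} (a : Vec A r) → zeros ⊕ a ≡ a
    ⊕-identityˡ = Vec.zipWith-identityˡ +-identityˡ

    ⊕-identityʳ : ∀ {r} (a : Vec A r) → a ⊕ zeros ≡ a
    ⊕-identityʳ = Vec.zipWith-identityʳ +-identityʳ

    ⊕-medial : ∀ {r} (a b c d : Vec A r) → (a ⊕ b) ⊕ (c ⊕ d) ≡ (a ⊕ c) ⊕ (b ⊕ d)
    ⊕-medial []       []       []       []       = refl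
    ⊕-medial (a ∷ as) (b ∷ bs) (c ∷ cs) (d ∷ ds) =
      cong₂ _∷_ (medial a b c d) (⊕-medial as bs cs ds)

    constant-zero : ∀ {r} → constant {r} 0# ≡ zeros
    constant-zero {zero}  = refl
    constant-zero {suc r} = refl

    init-⊕ : ∀ {r} (a b : Vec A (suc r)) → init (a ⊕ b) ≡ init a ⊕ init b
    init-⊕ {zero}  (a ∷ []) (b ∷ []) = refl
    init-⊕ {suc r} (a ∷ as) (b ∷ bs) = cong ((a + b) ∷_) (init-⊕ as bs)

    last-⊕ : ∀ {r} (a b : Vec A (suc r)) → last (a ⊕ b) ≡ last a + last b
    last-⊕ {zero}  (a ∷ []) (b ∷ []) = refl
    last-⊕ {suc r} (a ∷ as) (b ∷ bs) = last-⊕ as bs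

    -- The last stage of `timesX` with the overflowing coefficient `l` as an argument of its own,
    -- because additivity holds in `l` and the vector jointly.
    reduce : ∀ {r} → A → Vec A r → Vec A r → Vec A r
    reduce l = zipWith (λ s fᵢ → s + (- (l * fᵢ)))

    reduce-⊕ : ∀ {r} l m (a b f : Vec A r) →
      reduce (l + m) (a ⊕ b) f ≡ reduce l a f ⊕ reduce m b f
    reduce-⊕ l m []       []       []       = refl
    reduce-⊕ l m (a ∷ as) (b ∷ bs) (f ∷ fs) = cong₂ _∷_
      (trans (cong ((a + b) +_) (trans (cong -_ (distribʳ f l m)) (sym (⁻¹-∙-comm _ _))))
        (medial a b _ _))
      (reduce-⊕ l m as bs fs)

    reduce-zero : ∀ {r} (a f : Vec A r) → reduce 0# a f ≡ a
    reduce-zero []       []       = refl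
    reduce-zero (a ∷ as) (f ∷ fs) = cong₂ _∷_
      (trans (cong (λ x → a + (- x)) (zeroˡ f)) (trans (cong (a +_) ε⁻¹≈ε) (+-identityʳ a)))
      (reduce-zero as fs)

    timesX-⊕ : ∀ {r} (f a b : Vec A r) → timesX f (a ⊕ b) ≡ timesX f a ⊕ timesX f b
    timesX-⊕ {zero}  f a b = refl
    timesX-⊕ {suc r} f a b = trans
      (cong₂ (λ l v → reduce l v f) (last-⊕ a b)
        (cong₂ _∷_ (sym (+-identityˡ 0#)) (init-⊕ a b)))
      (reduce-⊕ (last a) (last b) (0# ∷ init a) (0# ∷ init b) f)

    last-zeros : ∀ r → last (zeros {suc r}) ≡ 0#
    last-zeros zero    = refl
    last-zeros (suc r) = last-zeros r

    init-zeros : ∀ r → init (zeros {suc r}) ≡ zeros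
    init-zeros zero    = refl
    init-zeros (suc r) = cong (0# ∷_) (init-zeros r)

    timesX-zeros : ∀ {r} (f : Vec A r) → timesX f zeros ≡ zeros
    timesX-zeros {zero}  f = refl
    timesX-zeros {suc r} f = trans
      (cong₂ (λ l v → reduce l (0# ∷ v) f) (last-zeros r) (init-zeros r))
      (reduce-zero zeros f)

    map-⊕ : ∀ {r} c (a b : Vec A r) → Vec.map (c *_) (a ⊕ b) ≡ Vec.map (c *_) a ⊕ Vec.map (c *_) b
    map-⊕ c []       []       = refl
    map-⊕ c (a ∷ as) (b ∷ bs) = cong₂ _∷_ (distribˡ c a b) (map-⊕ c as bs)

    map-+ : ∀ {r} c d (a : Vec A r) → Vec.map ((c + d) *_) a ≡ Vec.map (c *_) a ⊕ Vec.map (d *_) a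
    map-+ c d []       = refl
    map-+ c d (a ∷ as) = cong₂ _∷_ (distribʳ a c d) (map-+ c d as)

    map-zeros : ∀ r c → Vec.map (c *_) (zeros {r}) ≡ zeros
    map-zeros zero    c = refl
    map-zeros (suc r) c = cong₂ _∷_ (zeroʳ c) (map-zeros r c)

    map-zero : ∀ {r} (a : Vec A r) → Vec.map (0# *_) a ≡ zeros
    map-zero []       = refl
    map-zero (a ∷ as) = cong₂ _∷_ (zeroˡ a) (map-zero as)

    map-one : ∀ {r} (a : Vec A r) → Vec.map (1# *_) a ≡ a
    map-one []       = refl
    map-one (a ∷ as) = cong₂ _∷_ (proj₁ *-identity a) (map-one as)

    horner-distribˡ : ∀ {m r} (f : Vec A r) (a : Vec A m) b c →
      horner f a (b ⊕ c) ≡ horner f a b ⊕ horner f a c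
    horner-distribˡ f []       b c = sym (⊕-identityˡ zeros)
    horner-distribˡ f (a ∷ as) b c = trans
      (cong₂ _⊕_ (map-⊕ a b c) (trans (cong (timesX f) (horner-distribˡ f as b c)) (timesX-⊕ f _ _)))
      (⊕-medial _ _ _ _)

    horner-distribʳ : ∀ {m r} (f : Vec A r) (c : Vec A r) (a b : Vec A m) →
      horner f (a ⊕ b) c ≡ horner f a c ⊕ horner f b c
    horner-distribʳ f c []       []       = sym (⊕-identityˡ zeros)
    horner-distribʳ f c (a ∷ as) (b ∷ bs) = trans
      (cong₂ _⊕_ (map-+ a b c) (trans (cong (timesX f) (horner-distribʳ f c as bs)) (timesX-⊕ f _ _)))
      (⊕-medial _ _ _ _)

    horner-zeroˡ : ∀ {r} m (f : Vec A r) b → horner f (zeros {m}) b ≡ zeros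
    horner-zeroˡ zero    f b = refl
    horner-zeroˡ (suc m) f b = trans
      (cong₂ _⊕_ (map-zero b) (trans (cong (timesX f) (horner-zeroˡ m f b)) (timesX-zeros f)))
      (⊕-identityˡ zeros)

    horner-zeroʳ : ∀ {m r} (f : Vec A r) (a : Vec A m) → horner f a zeros ≡ zeros
    horner-zeroʳ         f []       = refl
    horner-zeroʳ {r = r} f (a ∷ as) = trans
      (cong₂ _⊕_ (map-zeros r a) (trans (cong (timesX f) (horner-zeroʳ f as)) (timesX-zeros f)))
      (⊕-identityˡ zeros)

    horner-identityˡ : ∀ {r} (f : Vec A r) b → horner f (constant {r} 1#) b ≡ b
    horner-identityˡ {zero}  f [] = refl
    horner-identityˡ {suc r} f b  = trans
      (cong₂ _⊕_ (map-one b) (trans (cong (timesX f) (horner-zeroˡ r f b)) (timesX-zeros f)))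
      (⊕-identityʳ b)

    -- Horner's scheme recurses on ever shorter suffixes of the first factor while the result keeps
    -- length `r`; `pad` names the result for such a suffix.
    pad : ∀ {m} r → Vec A m → Vec A r
    pad zero    a        = []
    pad (suc r) []       = 0# ∷ pad r []
    pad (suc r) (a ∷ as) = a ∷ pad r as

    pad-zeros : ∀ r → zeros ≡ pad r []
    pad-zeros zero    = refl
    pad-zeros (suc r) = cong (0# ∷_) (pad-zeros r)

    pad-full : ∀ {r} (a : Vec A r) → pad r a ≡ a
    pad-full []       = refl
    pad-full (a ∷ as) = cong (a ∷_) (pad-full as)

    init-pad : ∀ {m} r (a : Vec A m) → init (pad (suc r) a) ≡ pad r a
    init-pad zero    []       = refl
    init-pad zero    (a ∷ as) = refl
    init-pad (suc r) []       = cong (0# ∷_) (init-pad r [])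
    init-pad (suc r) (a ∷ as) = cong (a ∷_) (init-pad r as)

    last-pad : ∀ {m} r (a : Vec A m) → m ≤ r → last (pad (suc r) a) ≡ 0#
    last-pad zero    []       _         = refl
    last-pad (suc r) []       _         = last-pad r [] z≤n
    last-pad (suc r) (a ∷ as) (s≤s m≤r) = last-pad r as m≤r

    -- As long as the first factor has at most r coefficients, Horner's scheme
    -- never reduces modulo f when the second factor is 1.
    horner-one : ∀ {m r} (f : Vec A r) (a : Vec A m) → m ≤ r → horner f a (constant 1#) ≡ pad r a
    horner-one {r = r}     f []       _         = pad-zeros r
    horner-one {r = suc r} f (a ∷ as) (s≤s m≤r) = trans
      (cong₂ _⊕_
        (cong₂ _∷_ (proj₂ *-identity a) (map-zeros r a))
        (trans (cong (timesX f) (horner-one f as (ℕ.m≤n⇒m≤1+n m≤r)))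
          (trans (cong₂ (λ l v → reduce l (0# ∷ v) f) (last-pad r as m≤r) (init-pad r as))
            (reduce-zero (0# ∷ pad r as) f))))
      (cong₂ _∷_ (+-identityʳ a) (⊕-identityˡ (pad r as)))

  module _ {r : ℕ} (f : Vec A r) where

    open RawRing (quotientRing f) using () renaming (0# to 0ᶠ; 1# to 1ᶠ)

    ⊕-comm : ∀ (a b : Vec A r) → a ⊕ b ≡ b ⊕ a
    ⊕-comm = Vec.zipWith-comm +-comm

    quotientRing-isNonAssociativeRing :
      IsNonAssociativeRing _≡_ (zipWith _+_) (horner f) (Vec.map -_) 0ᶠ 1ᶠ
    quotientRing-isNonAssociativeRing = record
      { +-isAbelianGroup = record
        { isGroup = record
          { isMonoid = record
            { isSemigroup = record
              { isMagma = record { isEquivalence = isEquivalence ; ∙-cong = cong₂ _⊕_ }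
              ; assoc = Vec.zipWith-assoc +-assoc }
            -- `constant` computes only once `r` is split into cases, so the laws are proved for
            -- `zeros` and transported.
            ; identity = subst (λ z → (∀ a → z ⊕ a ≡ a) × (∀ a → a ⊕ z ≡ a)) (sym constant-zero)
                (⊕-identityˡ , ⊕-identityʳ) }
          ; inverse = Consequences.comm∧invˡ⇒inv ⊕-comm
              λ a → trans (Vec.zipWith-inverseˡ -‿inverseˡ a) (sym constant-zero)
          ; ⁻¹-cong = cong (Vec.map -_) }
        ; comm = ⊕-comm }
      ; *-cong = cong₂ (horner f)
      ; *-identity = horner-identityˡ f , λ a → trans (horner-one f a ℕ.≤-refl) (pad-full a)
      ; distrib = horner-distribˡ f , horner-distribʳ f
      ; zero = subst (λ z → (∀ a → horner f z a ≡ z) × (∀ a → horner f a z ≡ z)) (sym constant-zero)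
          (horner-zeroˡ r f , horner-zeroʳ f) }

-- Finite fields as nontrivial rings

module FieldProperties (F : FiniteField) where
  open FiniteField F

  private
    instance
      p≢0 : ℕ.NonZero p
      p≢0 = prime⇒nonZero p-prime

  open RawRing 𝔽 using () renaming
    (_+_ to _+ᶠ_; _*_ to _*ᶠ_; -_ to -ᶠ_; 0# to 0ᶠ; 1# to 1ᶠ)

  1<p : 1 < p
  1<p = ℕ.nonTrivial⇒n>1 p {{prime⇒nonTrivial p-prime}}

  toℕ-zero : toℕ (RawRing.0# 𝔽ₚ) ≡ 0
  toℕ-zero = trans (Fin.toℕ-fromℕ< (ℕ.m%n<n 0 p)) (ℕ.m<n⇒m%n≡m (ℕ.>-nonZero⁻¹ p))

  toℕ-one : toℕ (RawRing.1# 𝔽ₚ) ≡ 1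
  toℕ-one = trans (Fin.toℕ-fromℕ< (ℕ.m%n<n 1 p)) (ℕ.m<n⇒m%n≡m 1<p)

  -- For `r = 0` the monic polynomial is the constant one, a unit, and units are not irreducible.
  0<r : 0 < r
  0<r = positive modulus irreducible
    where
    open Polynomials 𝔽ₚ using (Irreducible; monic; polynomials)
    open ModularRing p using (ℤ/-isNonAssociativeRing)
    open IsNonAssociativeRing ℤ/-isNonAssociativeRing using (+-identityʳ; *-identity)
    positive : ∀ {r} (f : Vec (Fin p) r) → Irreducible (monic f) → 0 < r
    positive {suc r} f       _          = s≤s z≤n
    positive {zero}  []      f-irreducible =
      ⊥-elim (p∤1 record { quotient = RawRing.1# 𝔽ₚ List.∷ List.[]
                         ; equality = λ where
                             zero → trans (+-identityʳ _) (proj₁ *-identity (RawRing.1# 𝔽ₚ))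
                             (suc i) → refl })
      where
      open import Algebra.Definitions.RawSemiring polynomials using () renaming (module Irreducible to Irreducibility)
      open Irreducibility f-irreducible

  1≢0 : 1ᶠ ≢ 0ᶠ
  1≢0 = distinct 0<r
    where
    distinct : ∀ {r} → 0 < r →
      Polynomials.constant 𝔽ₚ {r} (RawRing.1# 𝔽ₚ) ≢ Polynomials.constant 𝔽ₚ (RawRing.0# 𝔽ₚ)
    distinct (s≤s _) eq = ℕ.1+n≢0
      (trans (sym toℕ-one) (trans (cong (λ v → toℕ (Vec.head v)) eq) toℕ-zero))

  isNonAssociativeRing : IsNonAssociativeRing _≡_ _+ᶠ_ _*ᶠ_ -ᶠ_ 0ᶠ 1ᶠ
  isNonAssociativeRing =
    QuotientRing.quotientRing-isNonAssociativeRing (ModularRing.ℤ/-isNonAssociativeRing p) modulus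

  _≟ᶠ_ : DecidableEquality (Vec (Fin p) r)
  _≟ᶠ_ = Vec.≡-dec Fin._≟_

-- While programs whose atomic instructions are single moves of a machine.

module Programs (workTapes : ℕ) where

  tapes : ℕ
  tapes = 2 ℕ.+ workTapes

  Cells Actions Tapes : Set
  Cells   = Vec Cell tapes
  Actions = Vec (Cell × Move) tapes
  Tapes   = Vec Tape tapes

  infixr 5 _⨾_

  data Program : Set where
    exec  : (Cells → Actions) → Program
    _⨾_   : Program → Program → Program
    while : (Cells → Bool) → Program → Program

  heads : Tapes → Cells
  heads = Vec.map head

  idle : Cells → Actions
  idle = Vec.map (_, stay)

  infix 4 _⊢_⇓[_]_

  -- The index counts machine steps, control included: one idle step hands over from `p` to `q`, and
  -- each round of a loop has one idle step into the body and one back to the test. A failed test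
  -- costs nothing, as the machine halts there.
  data _⊢_⇓[_]_ : Program → Tapes → ℕ → Tapes → Set where
    ⇓-exec   : ∀ {f a} → exec f ⊢ a ⇓[ 1 ] Vec.zipWith act (f (heads a)) a
    ⇓-⨾    : ∀ {p q a b c s t} → p ⊢ a ⇓[ s ] b → q ⊢ b ⇓[ t ] c → p ⨾ q ⊢ a ⇓[ s ℕ.+ suc t ] c
    ⇓-stop : ∀ {c p a} → c (heads a) ≡ false → while c p ⊢ a ⇓[ 0 ] a
    ⇓-loop : ∀ {c p a b d s t} → c (heads a) ≡ true → p ⊢ a ⇓[ s ] b →
             while c p ⊢ b ⇓[ t ] d → while c p ⊢ a ⇓[ suc (s ℕ.+ suc t) ] d

  -- Control points: for `exec` the Boolean tells whether the move has been made, and `inj₁ tt` in a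
  -- loop is its test.
  State : Program → Set
  State (exec f)      = Bool
  State (p ⨾ q)     = State p ⊎ State q
  State (while c p) = ⊤ ⊎ State p

  size : Program → ℕ
  size (exec f)      = 2
  size (p ⨾ q)     = size p ℕ.+ size q
  size (while c p) = 1 ℕ.+ size p

  State-finite : ∀ p → State p ↔ Fin (size p)
  State-finite (exec f)      = ↔-sym Fin.2↔Bool
  State-finite (p ⨾ q)     = ↔-sym Fin.+↔⊎ ↔-∘ (State-finite p ⊎-↔ State-finite q)
  State-finite (while c p) = ↔-sym Fin.+↔⊎ ↔-∘ (↔-sym Fin.1↔⊤ ⊎-↔ State-finite p)

  begin : ∀ p → State p
  begin (exec f)      = false
  begin (p ⨾ q)     = inj₁ (begin p)
  begin (while c p) = inj₁ tt

  -- inside ι e runs a component embedded by ι, and takes e where it halts.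

  inside : {S T : Set} → (S → T) → Maybe (T × Actions) → Maybe (S × Actions) → Maybe (T × Actions)
  inside ι e nothing          = e
  inside ι e (just (s , as)) = just (ι s , as)

  transition : ∀ p → State p → Cells → Maybe (State p × Actions)
  transition (exec f)      false    cs = just (true , f cs)
  transition (exec f)      true     cs = nothing
  transition (p ⨾ q)     (inj₁ s) cs =
    inside inj₁ (just (inj₂ (begin q) , idle cs)) (transition p s cs)
  transition (p ⨾ q)     (inj₂ s) cs = inside inj₂ nothing (transition q s cs)
  transition (while c p) (inj₁ _) cs =
    if c cs then just (inj₂ (begin p) , idle cs) else nothing
  transition (while c p) (inj₂ s) cs =
    inside inj₂ (just (inj₁ tt , idle cs)) (transition p s cs)

  machine : Program → TuringMachine
  machine p = record
    { State     = State p
    ; stateSize = size p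
    ; finite    = State-finite p
    ; start     = begin p
    ; workTapes = workTapes
    ; δ         = transition p
    }

  apply : {S : Set} → Tapes → Maybe (S × Actions) → Maybe (S × Tapes)
  apply a = Maybe.map λ (s , as) → s , Vec.zipWith act as a

  infix 4 _⊢_⟶[_]_

  data _⊢_⟶[_]_ (p : Program) : State p × Tapes → ℕ → State p × Tapes → Set where
    ⟶-refl : ∀ {x} → p ⊢ x ⟶[ 0 ] x
    ⟶-step : ∀ {s a y z t} → apply a (transition p s (heads a)) ≡ just y →
             p ⊢ y ⟶[ t ] z → p ⊢ (s , a) ⟶[ suc t ] z

  ⟶-trans : ∀ {p x y z s t} → p ⊢ x ⟶[ s ] y → p ⊢ y ⟶[ t ] z → p ⊢ x ⟶[ s ℕ.+ t ] z
  ⟶-trans ⟶-refl        yz = yz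
  ⟶-trans (⟶-step e xy) yz = ⟶-step e (⟶-trans xy yz)

  idle-apply : ∀ {n} (a : Vec Tape n) → Vec.zipWith act (Vec.map (_, stay) (Vec.map head a)) a ≡ a
  idle-apply []                 = refl
  idle-apply (tape _ _ _ ∷ ts) = cong (_ ∷_) (idle-apply ts)

  inside-apply : ∀ {S T : Set} (ι : S → T) e a m {s b} → apply a m ≡ just (s , b) →
                 apply a (inside ι e m) ≡ just (ι s , b)
  inside-apply ι e a (just _) refl = refl

  module _ {p q : Program} (ι : State p → State q) (e : Cells → Maybe (State q × Actions))
    (embeds : ∀ s cs → transition q (ι s) cs ≡ inside ι (e cs) (transition p s cs)) where

    ⟶-inside : ∀ {s a s′ b t} → p ⊢ (s , a) ⟶[ t ] (s′ , b) → q ⊢ (ι s , a) ⟶[ t ] (ι s′ , b)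
    ⟶-inside ⟶-refl = ⟶-refl
    ⟶-inside {s} {a} (⟶-step eq rest) = ⟶-step
      (trans (cong (apply a) (embeds s (heads a)))
        (inside-apply ι (e (heads a)) a (transition p s (heads a)) eq))
      (⟶-inside rest)

    -- The exit transition is idle and writes back what it reads, so leaving a component changes no
    -- tape.
    ⟶-leave : ∀ {s a} → transition p s (heads a) ≡ nothing → ∀ {s′} →
              e (heads a) ≡ just (s′ , idle (heads a)) →
              apply a (transition q (ι s) (heads a)) ≡ just (s′ , a)
    ⟶-leave {s} {a} halted exit = trans
      (cong (apply a) (trans (embeds s (heads a)) (trans (cong (inside ι _) halted) exit)))
      (cong (λ b → just (_ , b)) (idle-apply a))

  Run : ∀ p → Tapes → ℕ → Tapes → Set
  Run p a t b = Σ[ s ∈ State p ] (p ⊢ (begin p , a) ⟶[ t ] (s , b) × transition p s (heads b) ≡ nothing)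

  -- Induction on the execution. The halting state is kept in `Run` because the enclosing program
  -- takes its exit exactly where the component has no transition.
  run : ∀ {p a t b} → p ⊢ a ⇓[ t ] b → Run p a t b
  run ⇓-exec = true , ⟶-step refl ⟶-refl , refl
  run {p ⨾ q} (⇓-⨾ {b = b} {c} ab bc) =
    let (s , steps , halted) = run ab
        (s′ , steps′ , halted′) = run bc
        exit = λ cs → just (inj₂ (begin q) , idle cs)
    in inj₂ s′
     , ⟶-trans (⟶-inside inj₁ exit (λ _ _ → refl) steps)
         (⟶-step (⟶-leave {p} {p ⨾ q} inj₁ exit (λ _ _ → refl) {s} {b} halted refl)
           (⟶-inside inj₂ (λ _ → nothing) (λ _ _ → refl) steps′))
     , cong (inside inj₂ nothing) halted′
  run {while c p} (⇓-stop stop) =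
    inj₁ tt , ⟶-refl , cong (if_then _ else nothing) stop
  run {while c p} {a} (⇓-loop {b = b} continue ab bd) =
    let (s , steps , halted) = run ab
        (s′ , steps′ , halted′) = run bd
        exit = λ cs → just (inj₁ tt , idle cs)
    in s′
     , ⟶-step
         (trans (cong (λ t → apply a (if t then just (inj₂ (begin p) , idle (heads a)) else nothing)) continue)
           (cong (λ b → just (_ , b)) (idle-apply a)))
         (⟶-trans (⟶-inside inj₂ exit (λ _ _ → refl) steps)
           (⟶-step (⟶-leave {p} {while c p} inj₂ exit (λ _ _ → refl) {s} {b} halted refl) steps′))
     , halted′

  halts : ∀ {p a t b} → p ⊢ a ⇓[ t ] b →
          TuringMachine._Halts_Steps-with_ (machine p) (begin p , a) t
            (wordAtHead (lookup b (suc zero)))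
  halts {p} r = let (s , steps , halted) = run r in finish steps halted
    where
    finish : ∀ {x t s b} → p ⊢ x ⟶[ t ] (s , b) → transition p s (heads b) ≡ nothing →
             TuringMachine._Halts_Steps-with_ (machine p) x t (wordAtHead (lookup b (suc zero)))
    finish {b = b} ⟶-refl halted = TuringMachine.halt (cong (apply b) halted)
    finish (⟶-step eq rest) halted = TuringMachine.next eq (finish rest halted)

-- The transducer

All-ʳ++ : {A : Set} {P : A → Set} {xs ys : List A} → All P xs → All P ys → All P (xs ʳ++ ys)
All-ʳ++ []         pys = pys
All-ʳ++ (px ∷ pxs) pys = All-ʳ++ pxs (px ∷ pys)

-- The head is on the first cell of the second list, or on the blank beyond it if that list is
-- empty. A move to the right then shifts one cell from one list to the other, also at the end.
at : List Cell → List Cell → Tape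
at ls []       = tape ls nothing []
at ls (c ∷ cs) = tape ls c cs

act-right : ∀ ls b c cs → act (c , right) (at ls (b ∷ cs)) ≡ at (c ∷ ls) cs
act-right ls b c []       = refl
act-right ls b c (_ ∷ cs) = refl

written≡at : ∀ w → written w ≡ at [] (List.map just w)
written≡at []      = refl
written≡at (s ∷ w) = refl

module Rewinding (workTapes : ℕ) where
  open Programs workTapes

  move : Fin tapes → Move → Program
  move i m = exec λ cs → updateAt (idle cs) i λ (c , _) → (c , m)

  move-actions : ∀ {n} (a : Vec Tape n) i t m →
    Vec.zipWith act (updateAt (Vec.map (_, stay) (Vec.map head (a [ i ]≔ t))) i λ (c , _) → (c , m)) (a [ i ]≔ t)
      ≡ a [ i ]≔ act (head t , m) t
  move-actions (x ∷ a) zero    t m = cong (act (head t , m) t ∷_) (idle-apply a)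
  move-actions (x ∷ a) (suc i) t m = cong (x ∷_) (move-actions a i t m)

  move-⇓ : ∀ a i t m → move i m ⊢ a [ i ]≔ t ⇓[ 1 ] a [ i ]≔ act (head t , m) t
  move-⇓ a i t m = subst (λ b → move i m ⊢ a [ i ]≔ t ⇓[ 1 ] b) (move-actions a i t m) ⇓-exec

  -- The first move leaves the cell where a scan has ended, which may itself satisfy `stop`; the
  -- last one returns from the marker to the first cell of the word.
  seek rewind : Fin tapes → (Cell → Bool) → Program
  seek i stop   = while (λ cs → not (stop (lookup cs i))) (move i left)
  rewind i stop = move i left ⨾ seek i stop ⨾ move i right

  module _ (i : Fin tapes) (stop : Cell → Bool) where

    head-at : ∀ a t → lookup (heads (a [ i ]≔ t)) i ≡ head t
    head-at a t = trans (Vec.lookup-map i head (a [ i ]≔ t)) (cong head (Vec.lookup∘updateAt i a))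

    -- Three steps per cell: into the body, the move, and back to the test.
    seek-⇓ : ∀ a {u d ls y rs} → All (λ c → stop c ≡ false) u → stop d ≡ true → stop y ≡ false →
      seek i stop ⊢ a [ i ]≔ tape (u ++ d ∷ ls) y rs ⇓[ 3 ℕ.+ length u ℕ.* 3 ] a [ i ]≔ tape ls d (u ʳ++ y ∷ rs)
    seek-⇓ a {[]} {d} {ls} {y} {rs} [] stop-d go-y =
      ⇓-loop (cong not (trans (cong stop (head-at a _)) go-y)) (move-⇓ a i _ left)
        (⇓-stop (cong not (trans (cong stop (head-at a _)) stop-d)))
    seek-⇓ a {x ∷ u} (go-x ∷ go-u) stop-d go-y =
      ⇓-loop (cong not (trans (cong stop (head-at a _)) go-y)) (move-⇓ a i _ left)
        (seek-⇓ a go-u stop-d go-x)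

    rewind-⇓ : ∀ a {u d ls c rs} → All (λ c → stop c ≡ false) u → stop d ≡ true →
      rewind i stop ⊢ a [ i ]≔ tape (u ++ d ∷ ls) c rs ⇓[ 4 ℕ.+ length u ℕ.* 3 ] a [ i ]≔ at (d ∷ ls) (u ʳ++ c ∷ rs)
    rewind-⇓ a {[]} {d} {ls} {c} {rs} [] stop-d =
      ⇓-⨾ (move-⇓ a i (tape (d ∷ ls) c rs) left)
        (⇓-⨾ (⇓-stop (cong not (trans (cong stop (head-at a _)) stop-d))) (move-⇓ a i (tape ls d (c ∷ rs)) right))
    rewind-⇓ a {x ∷ u} {d} {ls} {c} {rs} (go-x ∷ go-u) stop-d =
      subst₂ (λ n t → rewind i stop ⊢ a [ i ]≔ tape (x ∷ u ++ d ∷ ls) c rs ⇓[ n ] a [ i ]≔ t)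
        (cong (5 ℕ.+_) (ℕ.+-comm (length u ℕ.* 3) 2))
        (act-right ls d d (u ʳ++ x ∷ c ∷ rs))
        (⇓-⨾ (move-⇓ a i (tape (x ∷ u ++ d ∷ ls) c rs) left)
          (⇓-⨾ (seek-⇓ a go-u stop-d go-x) (move-⇓ a i (tape ls d (u ʳ++ x ∷ c ∷ rs)) right)))

    -- A word that has been scanned lies reversed to the left of the head, whence the form
    -- `v ʳ++ d ∷ ls`.
    rewind-word-⇓ : ∀ a v {d ls c rs} → All (λ c → stop c ≡ false) v → stop d ≡ true →
      rewind i stop ⊢ a [ i ]≔ at (v ʳ++ d ∷ ls) (c ∷ rs) ⇓[ 4 ℕ.+ length v ℕ.* 3 ] a [ i ]≔ at (d ∷ ls) (v ++ c ∷ rs)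
    rewind-word-⇓ a v {d} {ls} {c} {rs} go-v stop-d =
      subst₂ (λ n t → rewind i stop ⊢ a [ i ]≔ at (v ʳ++ d ∷ ls) (c ∷ rs) ⇓[ 4 ℕ.+ n ℕ.* 3 ] a [ i ]≔ t)
        (List.length-reverse v)
        (cong (at (d ∷ ls)) (trans (List.ʳ++-defn (reverse v)) (cong (_++ c ∷ rs) (List.reverse-involutive v))))
        (subst (λ x → rewind i stop ⊢ a [ i ]≔ at x (c ∷ rs) ⇓[ 4 ℕ.+ length (reverse v) ℕ.* 3 ]
                        a [ i ]≔ at (d ∷ ls) (reverse v ʳ++ c ∷ rs))
          (sym (List.ʳ++-defn v)) (rewind-⇓ a (All-ʳ++ go-v []) stop-d))

-- The work tapes hold n in unary and the encoding of the field element 0.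

module Emission where
  open Programs 2
  open Rewinding 2

  record Scan : Set where
    constructor ⟨_,_,_⟩
    field
      input unary zeroElem : Tape

  -- Output is only appended: its head stays on the blank behind the word, and `out` lists the cells
  -- before it from right to left.
  config : Scan → List Cell → Tapes
  config ⟨ x , u , z ⟩ out = x ∷ tape out nothing [] ∷ u ∷ z ∷ []

  -- The time is bounded by 20 steps per emitted symbol.  The slack e pays for
  -- sequencing, and for rewinding tapes, which emits nothing.

  infix 4 _∶_⟶_emits_saving_

  record _∶_⟶_emits_saving_ (p : Program) (σ τ : Scan) (w : List Symbol) (e : ℕ) : Set where
    constructor emitting
    field
      execution : ∀ out →
        ∃[ t ] (p ⊢ config σ out ⇓[ t ] config τ (List.map just w ʳ++ out) × e ℕ.+ t ≤ length w ℕ.* 20)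

  open _∶_⟶_emits_saving_ public

  private
    add-lengths : ∀ a b c d v w → a ℕ.+ b ≤ length {A = Symbol} v ℕ.* 20 → c ℕ.+ d ≤ length w ℕ.* 20 →
              (a ℕ.+ b) ℕ.+ (c ℕ.+ d) ≤ length (v ++ w) ℕ.* 20
    add-lengths a b c d v w p q = ℕ.≤-trans (ℕ.+-mono-≤ p q) (ℕ.≤-reflexive
      (sym (trans (cong (ℕ._* 20) (List.length-++ v)) (ℕ.*-distribʳ-+ 20 (length v) (length w)))))

    output-++ : ∀ v w (out : List Cell) →
      List.map just w ʳ++ (List.map just v ʳ++ out) ≡ List.map {A = Symbol} just (v ++ w) ʳ++ out
    output-++ v w out = sym (trans (cong (_ʳ++ out) (List.map-++ just v w)) (List.++-ʳ++ (List.map just v)))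

  weaken : ∀ {p σ τ w d e} → d ≤ e → p ∶ σ ⟶ τ emits w saving e → p ∶ σ ⟶ τ emits w saving d
  weaken d≤e P = emitting λ out → let (t , run , e+t≤) = execution P out in t , run , ℕ.≤-trans (ℕ.+-monoˡ-≤ t d≤e) e+t≤

  infixr 5 _⨟_

  -- The step that hands over is paid by the second program, out of its slack.
  _⨟_ : ∀ {p q σ τ υ v w d e} → p ∶ σ ⟶ τ emits v saving d → q ∶ τ ⟶ υ emits w saving (suc e) →
        p ⨾ q ∶ σ ⟶ υ emits v ++ w saving (d ℕ.+ e)
  _⨟_ {p} {q} {σ} {υ = υ} {v} {w} {d} {e} P Q = emitting λ out →
    let (s , run-p , d+s≤) = execution P out
        (t , run-q , e+t≤) = execution Q (List.map just v ʳ++ out)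
    in s ℕ.+ suc t
     , subst (λ o → p ⨾ q ⊢ config σ out ⇓[ s ℕ.+ suc t ] config υ o) (output-++ v w out) (⇓-⨾ run-p run-q)
     , subst (_≤ length (v ++ w) ℕ.* 20)
         (solve 4 (λ d e s t → (d :+ s) :+ (con 1 :+ e :+ t) := (d :+ e) :+ (s :+ (con 1 :+ t))) refl d e s t)
         (add-lengths d s (suc e) t v w d+s≤ e+t≤)
    where open +-*-Solver

  -- As `q` writes nothing, it has no allowance; `p` pays for its `k` steps and the handover.
  silently : ∀ {p q σ τ υ w e} k → p ∶ σ ⟶ τ emits w saving (suc k ℕ.+ e) →
             (∀ out → q ⊢ config τ out ⇓[ k ] config υ out) → p ⨾ q ∶ σ ⟶ υ emits w saving e
  silently {e = e} k P Q = emitting λ out →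
    let (s , run-p , e+s≤) = execution P out
    in s ℕ.+ suc k , ⇓-⨾ run-p (Q _) , ℕ.≤-trans (ℕ.≤-reflexive
      (solve 3 (λ k e s → e :+ (s :+ (con 1 :+ k)) := (con 1 :+ k :+ e) :+ s) refl k e s)) e+s≤
    where open +-*-Solver

  done : ∀ {c p σ} → (∀ out → c (heads (config σ out)) ≡ false) → while c p ∶ σ ⟶ σ emits [] saving 0
  done stop = emitting λ out → 0 , ⇓-stop (stop out) , z≤n

  -- The `2` pays for entering the body and for returning to the test.
  again : ∀ {c p σ τ υ v w d e} → (∀ out → c (heads (config σ out)) ≡ true) →
          p ∶ σ ⟶ τ emits v saving (2 ℕ.+ d) → while c p ∶ τ ⟶ υ emits w saving e →
          while c p ∶ σ ⟶ υ emits v ++ w saving (d ℕ.+ e)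
  again {c} {p} {σ} {υ = υ} {v} {w} {d} {e} go P Q = emitting λ out →
    let (s , run-p , d+s≤) = execution P out
        (t , run-q , e+t≤) = execution Q (List.map just v ʳ++ out)
    in suc (s ℕ.+ suc t)
     , subst (λ o → while c p ⊢ config σ out ⇓[ suc (s ℕ.+ suc t) ] config υ o) (output-++ v w out)
         (⇓-loop (go out) run-p run-q)
     , subst (_≤ length (v ++ w) ℕ.* 20)
         (solve 4 (λ d e s t → (con 2 :+ d :+ s) :+ (e :+ t) := (d :+ e) :+ (con 1 :+ (s :+ (con 1 :+ t)))) refl d e s t)
         (add-lengths (2 ℕ.+ d) s e t v w d+s≤ e+t≤)
    where open +-*-Solver

  rewind-input : ∀ stop v {d ls c rs u z} → All (λ c → stop c ≡ false) v → stop d ≡ true → ∀ out →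
    rewind 0F stop ⊢ config ⟨ at (v ʳ++ d ∷ ls) (c ∷ rs) , u , z ⟩ out ⇓[ 4 ℕ.+ length v ℕ.* 3 ]
      config ⟨ at (d ∷ ls) (v ++ c ∷ rs) , u , z ⟩ out
  rewind-input stop v {d} {ls} {c} {rs} {u} {z} go-v stop-d out =
    rewind-word-⇓ 0F stop (config ⟨ blankTape , u , z ⟩ out) v go-v stop-d

  rewind-unary : ∀ stop v {d ls c rs x z} → All (λ c → stop c ≡ false) v → stop d ≡ true → ∀ out →
    rewind 2F stop ⊢ config ⟨ x , at (v ʳ++ d ∷ ls) (c ∷ rs) , z ⟩ out ⇓[ 4 ℕ.+ length v ℕ.* 3 ]
      config ⟨ x , at (d ∷ ls) (v ++ c ∷ rs) , z ⟩ out
  rewind-unary stop v {d} {ls} {c} {rs} {x} {z} go-v stop-d out =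
    rewind-word-⇓ 2F stop (config ⟨ x , blankTape , z ⟩ out) v go-v stop-d

  rewind-zeroElem : ∀ stop v {d ls c rs x u} → All (λ c → stop c ≡ false) v → stop d ≡ true → ∀ out →
    rewind 3F stop ⊢ config ⟨ x , u , at (v ʳ++ d ∷ ls) (c ∷ rs) ⟩ out ⇓[ 4 ℕ.+ length v ℕ.* 3 ]
      config ⟨ x , u , at (d ∷ ls) (v ++ c ∷ rs) ⟩ out
  rewind-zeroElem stop v {d} {ls} {c} {rs} {x} {u} go-v stop-d out =
    rewind-word-⇓ 3F stop (config ⟨ x , u , blankTape ⟩ out) v go-v stop-d

  emit : Symbol → Program
  emit s = exec λ where
    (x ∷ o ∷ u ∷ z ∷ []) → (x , stay) ∷ (just s , right) ∷ (u , stay) ∷ (z , stay) ∷ []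

  emit-emits : ∀ s {σ} → emit s ∶ σ ⟶ σ emits s ∷ [] saving 19
  emit-emits s = emitting λ out → 1 , ⇓-exec , ℕ.≤-refl

  copy : Program
  copy = exec λ where
    (x ∷ o ∷ u ∷ z ∷ []) → (x , right) ∷ (x , right) ∷ (u , stay) ∷ (z , stay) ∷ []

  copy-emits : ∀ {s ls cs u z} →
    copy ∶ ⟨ at ls (just s ∷ cs) , u , z ⟩ ⟶ ⟨ at (just s ∷ ls) cs , u , z ⟩ emits s ∷ [] saving 19
  copy-emits {cs = []}    = emitting λ out → 1 , ⇓-exec , ℕ.≤-refl
  copy-emits {cs = _ ∷ _} = emitting λ out → 1 , ⇓-exec , ℕ.≤-refl

  copyUntil : (Cell → Bool) → Program
  copyUntil stop = while (λ cs → not (stop (lookup cs 0F))) copy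

  -- A copied symbol uses three of its twenty steps: into the body, the move, and back. The `17`
  -- left over can pay for rewinding, at three steps per cell.
  copyUntil-emits : ∀ stop {w d ls cs u z} → All (λ s → stop (just s) ≡ false) w → stop d ≡ true →
    copyUntil stop ∶ ⟨ at ls (List.map just w ++ d ∷ cs) , u , z ⟩ ⟶
      ⟨ at (List.map just w ʳ++ ls) (d ∷ cs) , u , z ⟩ emits w saving length w ℕ.* 17
  copyUntil-emits stop []          stop-d = done λ out → cong not stop-d
  copyUntil-emits stop (go-s ∷ go) stop-d =
    again (λ out → cong not go-s) copy-emits (copyUntil-emits stop go stop-d)

  -- Inside an element only bits and `endCoeff` occur, so `isDelimiter` recognises both its own
  -- `endElem` and whatever closes the element, row or block before it.
  isBlank isEndBlock isEndRow isDelimiter : Cell → Bool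
  isBlank nothing  = true
  isBlank (just _) = false
  isEndBlock (just endBlock) = true
  isEndBlock _               = false
  isEndRow (just endRow) = true
  isEndRow _             = false
  isDelimiter (just (bit _))  = false
  isDelimiter (just endCoeff) = false
  isDelimiter _               = true

  all-just : ∀ w → All (λ c → isBlank c ≡ false) (List.map just w)
  all-just []      = []
  all-just (s ∷ w) = refl ∷ all-just w

  copyZero : Program
  copyZero = exec λ where
    (x ∷ o ∷ u ∷ z ∷ []) → (x , stay) ∷ (z , right) ∷ (u , stay) ∷ (z , right) ∷ []

  scanZero emitZero : Program
  scanZero = while (λ cs → not (isBlank (lookup cs 3F))) copyZero
  emitZero = scanZero ⨾ rewind 3F isBlank

  copyZero-emits : ∀ {s ls cs x u} →
    copyZero ∶ ⟨ x , u , at ls (just s ∷ cs) ⟩ ⟶ ⟨ x , u , at (just s ∷ ls) cs ⟩ emits s ∷ [] saving 19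
  copyZero-emits {cs = []}    = emitting λ out → 1 , ⇓-exec , ℕ.≤-refl
  copyZero-emits {cs = _ ∷ _} = emitting λ out → 1 , ⇓-exec , ℕ.≤-refl

  scanZero-emits : ∀ w {ls x u} →
    scanZero ∶ ⟨ x , u , at ls (List.map just w ++ nothing ∷ []) ⟩ ⟶
      ⟨ x , u , at (List.map just w ʳ++ ls) (nothing ∷ []) ⟩ emits w saving length w ℕ.* 17
  scanZero-emits []      = done λ out → refl
  scanZero-emits (s ∷ w) = again (λ out → refl) (copyZero-emits) (scanZero-emits w)

  -- The work tapes are extended by a blank on the left, where rewind stops.

  stored : List Symbol → Tape
  stored w = at (nothing ∷ []) (List.map just w ++ nothing ∷ [])

  -- Scanning `l` symbols saves `17 l`; rewinding, the handover and the slack of nine take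
  -- `3 l + 14`, which is covered once `z` has a symbol.
  emitZero-emits : ∀ {z x u} → 1 ≤ length z →
    emitZero ∶ ⟨ x , u , stored z ⟩ ⟶ ⟨ x , u , stored z ⟩ emits z saving 9
  emitZero-emits {z} 1≤z = silently (4 ℕ.+ length (List.map just z) ℕ.* 3)
    (weaken slack (scanZero-emits z))
    (rewind-zeroElem isBlank (List.map just z) (all-just z) refl)
    where
    slack : suc (4 ℕ.+ length (List.map just z) ℕ.* 3) ℕ.+ 9 ≤ length z ℕ.* 17
    slack = ℕ.≤-trans (ℕ.≤-reflexive (trans
        (cong (λ n → suc (4 ℕ.+ n ℕ.* 3) ℕ.+ 9) (List.length-map just z))
        (solve 1 (λ n → con 5 :+ n :* con 3 :+ con 9 := n :* con 3 :+ con 14) refl (length z))))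
      (ℕ.≤-trans (ℕ.+-monoʳ-≤ (length z ℕ.* 3) (ℕ.*-monoˡ-≤ 14 1≤z))
        (ℕ.≤-reflexive (sym (ℕ.*-distribˡ-+ (length z) 3 14))))
      where open +-*-Solver

-- Reading the matrices entry by entry

module Reduction where
  open Programs 2
  open Rewinding 2
  open Emission

  pattern one = bit true

  reading : List Cell → List Symbol → Tape
  reading ls w = at ls (List.map just w)

  -- The invariant on the input tape: the cell before the head is a delimiter, so rewinding over the
  -- next element stops at its beginning.
  data Delimited : List Cell → Set where
    delimited : ∀ {d ls} → isDelimiter d ≡ true → Delimited (d ∷ ls)

  record Memory : Set where
    constructor memory
    field
      unary zeroElem : Tape

  scan : Tape → Memory → Scan
  scan x (memory u z) = ⟨ x , u , z ⟩

  infix 4 _∶_⟶_reads_emits_saving_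

  -- What lies behind the head is forgotten except for being `Delimited`, and the unread `rest` is
  -- arbitrary, so that such statements compose.
  _∶_⟶_reads_emits_saving_ : Program → Memory → Memory → List Symbol → List Symbol → ℕ → Set
  p ∶ μ ⟶ ν reads v emits w saving e = ∀ {ls} rest → Delimited ls →
    ∃[ ls′ ] (Delimited ls′ ×
      p ∶ scan (reading ls (v ++ rest)) μ ⟶ scan (reading ls′ rest) ν emits w saving e)

  read-≡ : ∀ {p τ μ ls v w o e} → v ≡ w → p ∶ scan (reading ls v) μ ⟶ τ emits o saving e →
           p ∶ scan (reading ls w) μ ⟶ τ emits o saving e
  read-≡ refl P = P

  emit-≡ : ∀ {p σ τ v w e} → v ≡ w → p ∶ σ ⟶ τ emits v saving e → p ∶ σ ⟶ τ emits w saving e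
  emit-≡ refl P = P

  relax : ∀ {p μ ν v w d e} → d ≤ e → p ∶ μ ⟶ ν reads v emits w saving e →
          p ∶ μ ⟶ ν reads v emits w saving d
  relax d≤e P rest ls = let (ls′ , δ , run) = P rest ls in ls′ , δ , weaken d≤e run

  infixr 5 _▹_ _▸_

  _▹_ : ∀ {p q μ ν ξ v v′ w w′ d e} → p ∶ μ ⟶ ν reads v emits w saving d →
        q ∶ ν ⟶ ξ reads v′ emits w′ saving suc e →
        p ⨾ q ∶ μ ⟶ ξ reads v ++ v′ emits w ++ w′ saving (d ℕ.+ e)
  _▹_ {v = v} {v′} P Q rest δ =
    let (_ , δ′ , P′)  = P (v′ ++ rest) δ
        (_ , δ″ , Q′) = Q rest δ′
    in _ , δ″ , (read-≡ (sym (List.++-assoc v v′ rest)) P′ ⨟ Q′)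

  _▸_ : ∀ {p q μ ν ξ v w w′ d e} → (∀ x → p ∶ scan x μ ⟶ scan x ν emits w saving d) →
        q ∶ ν ⟶ ξ reads v emits w′ saving suc e →
        p ⨾ q ∶ μ ⟶ ξ reads v emits w ++ w′ saving (d ℕ.+ e)
  (P ▸ Q) rest δ = let (_ , δ′ , Q′) = Q rest δ in _ , δ′ , (P _ ⨟ Q′)

  module _ {A : Set} (word out : A → List Symbol)
    {s : Symbol} {c : Cells → Bool} {p : Program} {μ : Memory}
    (s-delimiter : isDelimiter (just s) ≡ true)
    (go : ∀ {ls : List Cell} (a : A) (rest : List Symbol) (o : List Cell) → c (heads (config (scan (reading ls (word a ++ rest)) μ) o)) ≡ true)
    (stop : ∀ {ls : List Cell} (rest : List Symbol) (o : List Cell) → c (heads (config (scan (reading ls (s ∷ rest)) μ) o)) ≡ false)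
    (body : ∀ (a : A) → p ∶ μ ⟶ μ reads word a emits out a saving 2) where

    private
      loop : ∀ as {ls} rest → Delimited ls → ∃[ ls′ ] (Delimited ls′ ×
        while c p ∶ scan (reading ls (concatMap word as ++ s ∷ rest)) μ ⟶
          scan (reading ls′ (s ∷ rest)) μ emits concatMap out as saving 0)
      loop []       {ls} rest δ = _ , δ , done (stop {ls} rest)
      loop (a ∷ as) {ls} rest δ =
        let (_ , δ′ , P) = body a (concatMap word as ++ s ∷ rest) δ
            (_ , δ″ , Q) = loop as rest δ′
        in _ , δ″ , read-≡ (sym (List.++-assoc (word a) (concatMap word as) (s ∷ rest)))
             (again (go {ls} a (concatMap word as ++ s ∷ rest)) P Q)

    -- Serves both for the elements of a row, closed by `endRow`, and for the rows of a matrix,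
    -- closed by `endBlock`.
    reads-all : ∀ as → while c p ⨾ copy ∶ μ ⟶ μ
      reads concatMap word as ++ s ∷ [] emits concatMap out as ++ s ∷ [] saving 18
    reads-all as rest δ =
      let (_ , _ , P) = loop as rest δ
      in _ , delimited s-delimiter
       , read-≡ (sym (List.++-assoc (concatMap word as) (s ∷ []) rest)) (P ⨟ copy-emits)

  copyUntil-reads : ∀ stop {w s ls rest μ} → All (λ s → stop (just s) ≡ false) w → stop (just s) ≡ true →
    copyUntil stop ∶ scan (reading ls (w ++ s ∷ rest)) μ ⟶
      scan (reading (List.map just w ʳ++ ls) (s ∷ rest)) μ emits w saving length w ℕ.* 17
  copyUntil-reads stop {w} {s} {ls} {rest} {μ} go stop-s =
    subst (λ cs → copyUntil stop ∶ scan (at ls cs) μ ⟶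
        scan (reading (List.map just w ʳ++ ls) (s ∷ rest)) μ emits w saving length w ℕ.* 17)
      (sym (List.map-++ just w (s ∷ rest)))
      (copyUntil-emits stop go stop-s)

  -- An entry is written three times and followed by two zeros, in the order of the gadget. `pass`
  -- takes the closing `endElem` from the program and returns to the start of the entry; only the
  -- third time is `endElem` copied from the tape and left behind.
  pass copyElem copyRow copyRows : Program
  pass     = (copyUntil isDelimiter ⨾ emit endElem) ⨾ rewind 0F isDelimiter
  copyElem = pass ⨾ pass ⨾ copyUntil isDelimiter ⨾ copy ⨾ emitZero ⨾ emitZero
  copyRow  = emitZero ⨾ while (λ cs → not (isEndRow (lookup cs 0F))) copyElem ⨾ copy
  copyRows = while (λ cs → not (isEndBlock (lookup cs 0F))) copyRow ⨾ copy

  pass-emits : ∀ {w d ls rest μ} → All (λ s → isDelimiter (just s) ≡ false) w → isDelimiter d ≡ true →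
    pass ∶ scan (reading (d ∷ ls) (w ++ endElem ∷ rest)) μ ⟶
      scan (reading (d ∷ ls) (w ++ endElem ∷ rest)) μ emits w ++ endElem ∷ [] saving 9
  pass-emits {w} {d} {ls} {rest} {μ} inner d-delimiter =
    subst (λ cs → pass ∶ scan (reading (d ∷ ls) (w ++ endElem ∷ rest)) μ ⟶
        scan (at (d ∷ ls) cs) μ emits w ++ endElem ∷ [] saving 9)
      (sym (List.map-++ just w (endElem ∷ rest)))
      (silently (4 ℕ.+ length (List.map just w) ℕ.* 3)
        (weaken slack (copyUntil-reads isDelimiter inner refl ⨟ emit-emits endElem))
        (rewind-input isDelimiter (List.map just w) (All.map⁺ inner) d-delimiter))
    where
    slack : suc (4 ℕ.+ length (List.map just w) ℕ.* 3) ℕ.+ 9 ≤ length w ℕ.* 17 ℕ.+ 18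
    slack = subst (λ n → suc (4 ℕ.+ n ℕ.* 3) ℕ.+ 9 ≤ length w ℕ.* 17 ℕ.+ 18) (sym (List.length-map just w))
      (ℕ.≤-trans
        (ℕ.m≤m+n (suc (4 ℕ.+ length w ℕ.* 3) ℕ.+ 9) (length w ℕ.* 14 ℕ.+ 4))
        (ℕ.≤-reflexive (solve 1 (λ n → con 5 :+ n :* con 3 :+ con 9 :+ (n :* con 14 :+ con 4) :=
          n :* con 17 :+ con 18) refl (length w))))
      where open +-*-Solver

  module Words {E : Set} (digits : E → List Symbol) (z : List Symbol) where

    elem elem′ : E → List Symbol
    elem  a = digits a ++ endElem ∷ []
    elem′ a = elem a ++ elem a ++ elem a ++ z ++ z

    row row′ : List E → List Symbol
    row  as = concatMap elem as ++ endRow ∷ []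
    row′ as = z ++ concatMap elem′ as ++ endRow ∷ []

    rows rows′ : List (List E) → List Symbol
    rows  A = concatMap row A ++ endBlock ∷ []
    rows′ A = concatMap row′ A ++ endBlock ∷ []

  module _ {E : Set} (digits : E → List Symbol)
    (inner : ∀ a → All (λ s → isDelimiter (just s) ≡ false) (digits a))
    {z : List Symbol} (1≤z : 1 ≤ length z) (u : Tape) where

    private
      μ : Memory
      μ = memory u (stored z)

    open Words digits z

    zero-emits : ∀ x → emitZero ∶ scan x μ ⟶ scan x μ emits z saving 9
    zero-emits x = emitZero-emits 1≤z

    copyElem-reads : ∀ a → copyElem ∶ μ ⟶ μ reads elem a emits elem′ a saving 2
    copyElem-reads a {d ∷ ls} rest (delimited δ) =
      _ , delimited {just endElem} {List.map just (digits a) ʳ++ d ∷ ls} refl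
      , read-≡ (sym (List.++-assoc (digits a) (endElem ∷ []) rest))
          (weaken (ℕ.≤ᵇ⇒≤ 2 50 _)
            (emit-≡ (cong (λ w → elem a ++ elem a ++ w) (sym (List.++-assoc (digits a) (endElem ∷ []) (z ++ z))))
              (pass-emits (inner a) δ ⨟ pass-emits (inner a) δ ⨟
                (weaken z≤n (copyUntil-reads isDelimiter (inner a) refl) ⨟
                  (copy-emits ⨟ zero-emits _ ⨟ zero-emits _)))))

    elem-start : ∀ {ls} a rest → isEndRow (head (reading ls (elem a ++ rest))) ≡ false ×
                                isEndBlock (head (reading ls (elem a ++ rest))) ≡ false
    elem-start a rest = start (digits a) (inner a)
      where
      start : ∀ {ls} w → All (λ s → isDelimiter (just s) ≡ false) w →
              isEndRow (head (reading ls ((w ++ endElem ∷ []) ++ rest))) ≡ false ×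
              isEndBlock (head (reading ls ((w ++ endElem ∷ []) ++ rest))) ≡ false
      start []             _ = refl , refl
      start (bit _ ∷ w)    _ = refl , refl
      start (endCoeff ∷ w) _ = refl , refl
      start (endElem ∷ w)  (() ∷ _)
      start (endRow ∷ w)   (() ∷ _)
      start (endBlock ∷ w) (() ∷ _)

    row-start : ∀ {ls} as rest → isEndBlock (head (reading ls (row as ++ rest))) ≡ false
    row-start []       rest = refl
    row-start {ls} (a ∷ as) rest = subst (λ w → isEndBlock (head (reading ls w)) ≡ false)
      (trans (sym (List.++-assoc (elem a) (row as) rest))
        (cong (_++ rest) (sym (List.++-assoc (elem a) (concatMap elem as) (endRow ∷ [])))))
      (proj₂ (elem-start {ls} a (row as ++ rest)))

    copyRow-reads : ∀ as → copyRow ∶ μ ⟶ μ reads row as emits row′ as saving 2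
    copyRow-reads as = relax (ℕ.≤ᵇ⇒≤ 2 26 _) (zero-emits ▸
      reads-all elem elem′ refl (λ {ls} a rest o → cong not (proj₁ (elem-start {ls} a rest)))
        (λ rest o → refl) copyElem-reads as)

    copyRows-reads : ∀ A → copyRows ∶ μ ⟶ μ reads rows A emits rows′ A saving 18
    copyRows-reads = reads-all row row′ refl (λ {ls} as rest o → cong not (row-start {ls} as rest))
      (λ rest o → refl) copyRow-reads

-- The complete machine

module Transducer where
  open Programs 2
  open Rewinding 2
  open Emission
  open Reduction

  ones : ℕ → List Symbol
  ones n = replicate n one

  -- Erasing the bits of an encoded element leaves empty numerals only, which is the encoding of
  -- zero; the modulus has the right number of coefficients for this.
  skeleton : List Symbol → List Symbol
  skeleton []            = []
  skeleton (bit _ ∷ w)   = skeleton w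
  skeleton (endCoeff ∷ w) = endCoeff ∷ skeleton w
  skeleton (endElem ∷ w)  = endElem ∷ skeleton w
  skeleton (endRow ∷ w)   = endRow ∷ skeleton w
  skeleton (endBlock ∷ w) = endBlock ∷ skeleton w

  length-skeleton : ∀ w → length (skeleton w) ≤ length w
  length-skeleton []             = z≤n
  length-skeleton (bit _ ∷ w)    = ℕ.m≤n⇒m≤1+n (length-skeleton w)
  length-skeleton (endCoeff ∷ w) = s≤s (length-skeleton w)
  length-skeleton (endElem ∷ w)  = s≤s (length-skeleton w)
  length-skeleton (endRow ∷ w)   = s≤s (length-skeleton w)
  length-skeleton (endBlock ∷ w) = s≤s (length-skeleton w)

  blank : List Cell → Tape
  blank ls = tape ls nothing []

  tick : Program
  tick = exec λ where
    (x ∷ o ∷ u ∷ z ∷ []) → (x , stay) ∷ (just one , right) ∷ (u , right) ∷ (z , stay) ∷ []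

  tick-emits : ∀ {x s ls cs z} →
    tick ∶ ⟨ x , at ls (just s ∷ cs) , z ⟩ ⟶ ⟨ x , at (just s ∷ ls) cs , z ⟩ emits one ∷ [] saving 19
  tick-emits {cs = []}    = emitting λ out → 1 , ⇓-exec , ℕ.≤-refl
  tick-emits {cs = _ ∷ _} = emitting λ out → 1 , ⇓-exec , ℕ.≤-refl

  -- Writing `one` in front of the word for zero makes it the word for one. The last `one` of a
  -- block comes from `tick`, which also advances on the stored unary `n` and so counts the blocks.
  emitMarks scanMarks emitBorder : Program
  emitMarks  = emitZero ⨾ emitZero ⨾ emit one ⨾ emitZero ⨾ emit one ⨾ emitZero ⨾ tick ⨾ emitZero
  scanMarks  = while (λ cs → not (isBlank (lookup cs 2F))) emitMarks
  emitBorder = emit one ⨾ emitZero ⨾ (scanMarks ⨾ emit endRow) ⨾ rewind 2F isBlank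

  repeat : ℕ → List Symbol → List Symbol
  repeat zero    w = []
  repeat (suc n) w = w ++ repeat n w

  marks : List Symbol → List Symbol
  marks z = z ++ z ++ one ∷ z ++ one ∷ z ++ one ∷ z

  border : List Symbol → ℕ → List Symbol
  border z n = one ∷ z ++ repeat n (marks z) ++ endRow ∷ []

  module _ {z : List Symbol} (1≤z : 1 ≤ length z) (x : Tape) where

    private
      zero-emits′ : ∀ {u} → emitZero ∶ ⟨ x , u , stored z ⟩ ⟶ ⟨ x , u , stored z ⟩ emits z saving 9
      zero-emits′ = emitZero-emits 1≤z

    -- Of the slack five are kept: two for the loop around it and three for rewinding the unary tape
    -- over this cell.
    emitMarks-emits : ∀ {s ls cs} →
      emitMarks ∶ ⟨ x , at ls (just s ∷ cs) , stored z ⟩ ⟶ ⟨ x , at (just s ∷ ls) cs , stored z ⟩ emits marks z saving 5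
    emitMarks-emits = weaken (ℕ.≤ᵇ⇒≤ 5 95 _)
      (zero-emits′ ⨟ zero-emits′ ⨟ emit-emits one ⨟ zero-emits′ ⨟ emit-emits one ⨟ zero-emits′ ⨟ tick-emits ⨟ zero-emits′)

    scanMarks-emits : ∀ n {ls} →
      scanMarks ∶ ⟨ x , at ls (List.map just (ones n) ++ nothing ∷ []) , stored z ⟩ ⟶
        ⟨ x , at (List.map just (ones n) ʳ++ ls) (nothing ∷ []) , stored z ⟩ emits repeat n (marks z) saving n ℕ.* 3
    scanMarks-emits zero    = done λ _ → refl
    scanMarks-emits (suc n) = again (λ _ → refl) emitMarks-emits (scanMarks-emits n)

    emitBorder-emits : ∀ n → emitBorder ∶ ⟨ x , stored (ones n) , stored z ⟩ ⟶ ⟨ x , stored (ones n) , stored z ⟩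
      emits border z n saving 9
    emitBorder-emits n = weaken (ℕ.≤ᵇ⇒≤ 9 39 _) (emit-emits one ⨟ zero-emits′ ⨟
      silently (4 ℕ.+ length (List.map just (ones n)) ℕ.* 3)
        (weaken slack (scanMarks-emits n ⨟ emit-emits endRow))
        (rewind-unary isBlank (List.map just (ones n)) (all-just (ones n)) refl))
      where
      slack : suc (4 ℕ.+ length (List.map just (ones n)) ℕ.* 3) ℕ.+ 13 ≤ n ℕ.* 3 ℕ.+ 18
      slack = ℕ.≤-reflexive (trans
        (cong (λ m → suc (4 ℕ.+ m ℕ.* 3) ℕ.+ 13)
          (trans (List.length-map just (ones n)) (List.length-replicate n)))
        (solve 1 (λ n → con 5 :+ n :* con 3 :+ con 13 := n :* con 3 :+ con 18) refl n))
        where open +-*-Solver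

  EndBlockFree : List Symbol → Set
  EndBlockFree = All λ s → isEndBlock (just s) ≡ false

  ones-free : ∀ n → EndBlockFree (ones n)
  ones-free zero    = []
  ones-free (suc n) = refl ∷ ones-free n

  copyBlock copyIncremented : Program
  copyBlock       = copyUntil isEndBlock ⨾ copy
  copyIncremented = copyUntil isEndBlock ⨾ emit one ⨾ copy

  copyBlock-reads : ∀ {w μ} → EndBlockFree w →
    copyBlock ∶ μ ⟶ μ reads w ++ endBlock ∷ [] emits w ++ endBlock ∷ [] saving 9
  copyBlock-reads {w} free {ls} rest δ = _ , delimited {just endBlock} {List.map just w ʳ++ ls} refl
    , read-≡ (sym (List.++-assoc w (endBlock ∷ []) rest))
        (weaken (ℕ.≤-trans (ℕ.≤ᵇ⇒≤ 9 18 _) (ℕ.m≤n+m 18 (length w ℕ.* 17)))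
          (copyUntil-reads isEndBlock free refl ⨟ copy-emits))

  copyIncremented-emits : ∀ {w ls rest μ} → EndBlockFree w →
    copyIncremented ∶ scan (reading ls (w ++ endBlock ∷ rest)) μ ⟶
      scan (reading (just endBlock ∷ (List.map just w ʳ++ ls)) rest) μ emits w ++ one ∷ endBlock ∷ [] saving 9
  copyIncremented-emits {w} free =
    weaken (ℕ.≤-trans (ℕ.≤ᵇ⇒≤ 9 36 _) (ℕ.m≤n+m 36 (length w ℕ.* 17)))
      (copyUntil-reads isEndBlock free refl ⨟ emit-emits one ⨟ copy-emits)

  -- In unary, `5n + 1` needs only five strokes per stroke of `n` and one more at the end. The fifth
  -- is written by `storeUnit`, which stores a stroke for the top rows as well.
  copyUnit storeUnit storeUnary copyUnary : Program
  storeUnit = exec λ where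
    (x ∷ o ∷ u ∷ z ∷ []) → (x , right) ∷ (x , right) ∷ (x , right) ∷ (z , stay) ∷ []
  copyUnit   = emit one ⨾ emit one ⨾ emit one ⨾ emit one ⨾ storeUnit
  storeUnary = while (λ cs → not (isEndBlock (lookup cs 0F))) copyUnit
  copyUnary  = ((storeUnary ⨾ emit one) ⨾ rewind 2F isBlank) ⨾ copy

  storeUnit-emits : ∀ {s ls cs us z} →
    storeUnit ∶ ⟨ at ls (just s ∷ cs) , blank us , z ⟩ ⟶ ⟨ at (just s ∷ ls) cs , blank (just s ∷ us) , z ⟩
      emits s ∷ [] saving 19
  storeUnit-emits {cs = []}    = emitting λ out → 1 , ⇓-exec , ℕ.≤-refl
  storeUnit-emits {cs = _ ∷ _} = emitting λ out → 1 , ⇓-exec , ℕ.≤-refl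

  copyUnit-emits : ∀ {ls rest us z} →
    copyUnit ∶ ⟨ reading ls (one ∷ rest) , blank us , z ⟩ ⟶
      ⟨ reading (just one ∷ ls) rest , blank (just one ∷ us) , z ⟩ emits ones 5 saving 5
  copyUnit-emits = weaken (ℕ.≤ᵇ⇒≤ 5 91 _)
    (emit-emits one ⨟ emit-emits one ⨟ emit-emits one ⨟ emit-emits one ⨟ storeUnit-emits)

  storeUnary-emits : ∀ n {ls rest us z} →
    storeUnary ∶ ⟨ reading ls (ones n ++ endBlock ∷ rest) , blank us , z ⟩ ⟶
      ⟨ reading (List.map just (ones n) ʳ++ ls) (endBlock ∷ rest) , blank (List.map just (ones n) ʳ++ us) , z ⟩
      emits ones (n ℕ.* 5) saving n ℕ.* 3
  storeUnary-emits zero    = done λ _ → refl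
  storeUnary-emits (suc n) = again (λ _ → refl) copyUnit-emits (storeUnary-emits n)

  copyUnary-reads : ∀ n {z} →
    copyUnary ∶ memory (blank (nothing ∷ [])) z ⟶ memory (stored (ones n)) z
      reads ones n ++ endBlock ∷ [] emits (ones (n ℕ.* 5) ++ one ∷ []) ++ endBlock ∷ [] saving 9
  copyUnary-reads n {z} {ls} rest δ = _ , delimited {just endBlock} {List.map just (ones n) ʳ++ ls} refl
    , read-≡ (sym (List.++-assoc (ones n) (endBlock ∷ []) rest))
        (weaken (ℕ.≤ᵇ⇒≤ 9 31 _)
          (silently (4 ℕ.+ length (List.map just (ones n)) ℕ.* 3)
            (weaken slack (storeUnary-emits n ⨟ emit-emits one))
            (rewind-unary isBlank (List.map just (ones n)) (all-just (ones n)) refl)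
          ⨟ copy-emits))
    where
    slack : suc (4 ℕ.+ length (List.map just (ones n)) ℕ.* 3) ℕ.+ 13 ≤ n ℕ.* 3 ℕ.+ 18
    slack = ℕ.≤-reflexive (trans
      (cong (λ m → suc (4 ℕ.+ m ℕ.* 3) ℕ.+ 13)
        (trans (List.length-map just (ones n)) (List.length-replicate n)))
      (solve 1 (λ n → con 5 :+ n :* con 3 :+ con 13 := n :* con 3 :+ con 18) refl n))
      where open +-*-Solver

  skeletonCell : Cell → Cell → Cell × Move
  skeletonCell (just (bit _)) z = z , stay
  skeletonCell x              z = x , right

  storeSkeleton scanModulus copyModulus : Program
  storeSkeleton = exec λ where
    (x ∷ o ∷ u ∷ z ∷ []) → (x , right) ∷ (x , right) ∷ (u , stay) ∷ skeletonCell x z ∷ []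
  scanModulus = while (λ cs → not (isEndBlock (lookup cs 0F))) storeSkeleton
  copyModulus = (scanModulus ⨾ copy) ⨾ rewind 3F isBlank

  storeSkeleton-emits : ∀ s {ls rest zs u} →
    storeSkeleton ∶ ⟨ reading ls (s ∷ rest) , u , blank zs ⟩ ⟶
      ⟨ reading (just s ∷ ls) rest , u , blank (List.map just (skeleton (s ∷ [])) ʳ++ zs) ⟩ emits s ∷ [] saving 19
  storeSkeleton-emits s {ls} {rest} {zs} {u} = emitting λ out → 1 ,
    subst (λ t → storeSkeleton ⊢ config ⟨ reading ls (s ∷ rest) , u , blank zs ⟩ out ⇓[ 1 ]
        config ⟨ t , u , blank (List.map just (skeleton (s ∷ [])) ʳ++ zs) ⟩ (just s ∷ out))
      (act-right ls (just s) (just s) (List.map just rest)) (execution-of s) , ℕ.≤-refl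
    where
    execution-of : ∀ s {out} → storeSkeleton ⊢ config ⟨ reading ls (s ∷ rest) , u , blank zs ⟩ out ⇓[ 1 ]
        config ⟨ act (just s , right) (reading ls (s ∷ rest)) , u , blank (List.map just (skeleton (s ∷ [])) ʳ++ zs) ⟩
          (just s ∷ out)
    execution-of (bit _)  = ⇓-exec
    execution-of endCoeff = ⇓-exec
    execution-of endElem  = ⇓-exec
    execution-of endRow   = ⇓-exec
    execution-of endBlock = ⇓-exec

  scanModulus-emits : ∀ {w ls rest zs u} → EndBlockFree w →
    scanModulus ∶ ⟨ reading ls (w ++ endBlock ∷ rest) , u , blank zs ⟩ ⟶
      ⟨ reading (List.map just w ʳ++ ls) (endBlock ∷ rest) , u , blank (List.map just (skeleton w) ʳ++ zs) ⟩
      emits w saving length w ℕ.* 17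
  scanModulus-emits []          = done λ _ → refl
  scanModulus-emits {s ∷ w} {ls} {rest} {zs} {u} (go-s ∷ free) =
    again (λ _ → cong not go-s) (storeSkeleton-emits s)
      (subst (λ zs′ → scanModulus ∶ ⟨ reading (just s ∷ ls) (w ++ endBlock ∷ rest) , u , _ ⟩ ⟶
          ⟨ reading (List.map just w ʳ++ just s ∷ ls) (endBlock ∷ rest) , u , blank zs′ ⟩
          emits w saving length w ℕ.* 17)
        (trans (sym (List.++-ʳ++ (List.map just (skeleton (s ∷ [])))))
          (cong (_ʳ++ zs) (trans (sym (List.map-++ just (skeleton (s ∷ [])) (skeleton w)))
            (cong (List.map just) (skeleton-∷ s)))))
        (scanModulus-emits free))
    where
    skeleton-∷ : ∀ s → skeleton (s ∷ []) ++ skeleton w ≡ skeleton (s ∷ w)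
    skeleton-∷ (bit _)  = refl
    skeleton-∷ endCoeff = refl
    skeleton-∷ endElem  = refl
    skeleton-∷ endRow   = refl
    skeleton-∷ endBlock = refl

  copyModulus-reads : ∀ {w u} → EndBlockFree w →
    copyModulus ∶ memory u (blank (nothing ∷ [])) ⟶ memory u (stored (skeleton w))
      reads w ++ endBlock ∷ [] emits w ++ endBlock ∷ [] saving 9
  copyModulus-reads {w} free {ls} rest δ = _ , delimited {just endBlock} {List.map just w ʳ++ ls} refl
    , read-≡ (sym (List.++-assoc w (endBlock ∷ []) rest))
        (silently (4 ℕ.+ length (List.map just (skeleton w)) ℕ.* 3)
          (weaken slack (scanModulus-emits free ⨟ copy-emits))
          (rewind-zeroElem isBlank (List.map just (skeleton w)) (all-just (skeleton w)) refl))
    where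
    slack : suc (4 ℕ.+ length (List.map just (skeleton w)) ℕ.* 3) ℕ.+ 9 ≤ length w ℕ.* 17 ℕ.+ 18
    slack = subst (λ n → suc (4 ℕ.+ n ℕ.* 3) ℕ.+ 9 ≤ length w ℕ.* 17 ℕ.+ 18) (sym (List.length-map just (skeleton w)))
      (ℕ.≤-trans
        (ℕ.+-monoˡ-≤ 9 (ℕ.+-monoʳ-≤ 5 (ℕ.*-monoˡ-≤ 3 (length-skeleton w))))
        (ℕ.≤-trans (ℕ.m≤m+n (suc (4 ℕ.+ length w ℕ.* 3) ℕ.+ 9) (length w ℕ.* 14 ℕ.+ 4))
        (ℕ.≤-reflexive (solve 1 (λ n → con 5 :+ n :* con 3 :+ con 9 :+ (n :* con 14 :+ con 4) :=
          n :* con 17 :+ con 18) refl (length w)))))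
      where open +-*-Solver

  -- `shift` lists a blank to the left of the output and work tapes, where rewinding stops. The
  -- final rewinding is due because the output is read from the head onwards.
  shift transform main : Program
  shift     = exec λ where
    (x ∷ o ∷ u ∷ z ∷ []) → (x , stay) ∷ (o , right) ∷ (u , right) ∷ (z , right) ∷ []
  transform = copyIncremented ⨾ copyUnary ⨾ copyBlock ⨾ copyModulus ⨾
              emitBorder ⨾ copyRows ⨾ emitBorder ⨾ copyRows
  main      = shift ⨾ transform ⨾ rewind 1F isBlank

  module _ {E : Set} (digits : E → List Symbol)
    (inner : ∀ a → All (λ s → isDelimiter (just s) ≡ false) (digits a))
    (w₁ w₂ w₃ : List Symbol) (n : ℕ)
    (free₁ : EndBlockFree w₁) (free₂ : EndBlockFree w₂) (free₃ : EndBlockFree w₃)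
    (1≤z : 1 ≤ length (skeleton w₃)) where

    private
      z = skeleton w₃

    open Words digits z

    source target : List (List E) → List (List E) → List Symbol
    source A B = w₁ ++ endBlock ∷
      ((ones n ++ endBlock ∷ []) ++ (w₂ ++ endBlock ∷ []) ++ (w₃ ++ endBlock ∷ []) ++ rows A ++ rows B) ++ []
    target A B = (w₁ ++ one ∷ endBlock ∷ []) ++
      ((ones (n ℕ.* 5) ++ one ∷ []) ++ endBlock ∷ []) ++
      (w₂ ++ endBlock ∷ []) ++ (w₃ ++ endBlock ∷ []) ++
      border z n ++ rows′ A ++ border z n ++ rows′ B

    -- The first block is treated apart, since nothing precedes it on the tape; the `endBlock` after
    -- it establishes `Delimited` for the rest.
    transform-emits : ∀ A B → ∃[ ls ]
      (transform ∶ scan (reading [] (source A B)) (memory (blank (nothing ∷ [])) (blank (nothing ∷ []))) ⟶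
        scan (reading ls []) (memory (stored (ones n)) (stored z)) emits target A B saving 0)
    transform-emits A B =
      let (ls , _ , P) = (copyUnary-reads n ▹ copyBlock-reads free₂ ▹ copyModulus-reads free₃ ▹
            ((λ x → emitBorder-emits 1≤z x n) ▸ copyRows-reads digits inner 1≤z (stored (ones n)) A ▹
              ((λ x → emitBorder-emits 1≤z x n) ▸ copyRows-reads digits inner 1≤z (stored (ones n)) B)))
            [] (delimited {just endBlock} {List.map just w₁ ʳ++ []} refl)
      in ls , weaken z≤n (copyIncremented-emits free₁ ⨟ P)

    -- Each output symbol costs twenty steps for writing and three for the final rewinding. The `7`
    -- is one step for `shift`, two handovers and four steps of rewinding that do not depend on the
    -- length.
    main-run : ∀ A B → ∃[ t ] (t ≤ 7 ℕ.+ length (target A B) ℕ.* 23 ×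
      ∃[ ts ] (main ⊢ written (source A B) ∷ blankTape ∷ blankTape ∷ blankTape ∷ [] ⇓[ t ] ts ×
               wordAtHead (lookup ts 1F) ≡ target A B))
    main-run A B = finish (proj₂ (transform-emits A B))
      where
      output : ∀ w → wordAtHead (stored w) ≡ w
      output []      = refl
      output (s ∷ w) = cong (s ∷_) (rest w)
        where
        rest : ∀ w → uptoBlank (List.map just w ++ nothing ∷ []) ≡ w
        rest []      = refl
        rest (s ∷ w) = cong (s ∷_) (rest w)

      bound : ∀ t → t ≤ length (target A B) ℕ.* 20 →
              1 ℕ.+ suc (t ℕ.+ suc (4 ℕ.+ length (List.map {A = Symbol} just (target A B)) ℕ.* 3)) ≤
              7 ℕ.+ length (target A B) ℕ.* 23
      bound t t≤ = subst (λ l → 1 ℕ.+ suc (t ℕ.+ suc (4 ℕ.+ l ℕ.* 3)) ≤ 7 ℕ.+ length (target A B) ℕ.* 23)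
        (sym (List.length-map just (target A B)))
        (ℕ.≤-trans (s≤s (s≤s (ℕ.+-monoˡ-≤ (suc (4 ℕ.+ length (target A B) ℕ.* 3)) t≤)))
          (ℕ.≤-reflexive (solve 1 (λ l → con 2 :+ (l :* con 20 :+ (con 5 :+ l :* con 3)) := con 7 :+ l :* con 23)
            refl (length (target A B)))))
        where open +-*-Solver

      finish : ∀ {ls} →
        transform ∶ scan (reading [] (source A B)) (memory (blank (nothing ∷ [])) (blank (nothing ∷ []))) ⟶
          scan (reading ls []) (memory (stored (ones n)) (stored z)) emits target A B saving 0 →
        ∃[ t ] (t ≤ 7 ℕ.+ length (target A B) ℕ.* 23 ×
          ∃[ ts ] (main ⊢ written (source A B) ∷ blankTape ∷ blankTape ∷ blankTape ∷ [] ⇓[ t ] ts ×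
                   wordAtHead (lookup ts 1F) ≡ target A B))
      finish {ls} P =
        let (t , run , t≤) = execution P (nothing ∷ [])
            τ = config (scan (reading ls []) (memory (stored (ones n)) (stored z))) []
        in 1 ℕ.+ suc (t ℕ.+ suc (4 ℕ.+ length (List.map {A = Symbol} just (target A B)) ℕ.* 3))
         , bound t t≤
         , τ [ 1F ]≔ stored (target A B)
         , subst (λ x → main ⊢ x ∷ blankTape ∷ blankTape ∷ blankTape ∷ []
               ⇓[ 1 ℕ.+ suc (t ℕ.+ suc (4 ℕ.+ length (List.map {A = Symbol} just (target A B)) ℕ.* 3)) ]
               τ [ 1F ]≔ stored (target A B))
             (sym (written≡at (source A B)))
             (⇓-⨾ ⇓-exec (⇓-⨾ run
               (rewind-word-⇓ 1F isBlank τ (List.map just (target A B)) {ls = []} {rs = []} (all-just (target A B)) refl)))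
         , output (target A B)

-- Sizes

-- The most significant bit comes last, so this excludes leading zeros, without which the length
-- would not be bounded by the value.
data EndsWithOne : List Bool → Set where
  [one] : EndsWithOne (true ∷ [])
  _∷_   : ∀ b {bs} → EndsWithOne bs → EndsWithOne (b ∷ bs)

increment-ends : ∀ {bs} → EndsWithOne bs → EndsWithOne (increment bs)
increment-ends [one]         = false ∷ [one]
increment-ends (false ∷ end) = true ∷ end
increment-ends (true ∷ end)  = false ∷ increment-ends end

binary-ends : ∀ m → EndsWithOne (binary (suc m))
binary-ends zero    = [one]
binary-ends (suc m) = increment-ends (binary-ends m)

value : List Bool → ℕ
value []           = 0
value (false ∷ bs) = value bs ℕ.+ value bs
value (true ∷ bs)  = suc (value bs ℕ.+ value bs)

value-increment : ∀ bs → value (increment bs) ≡ suc (value bs)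
value-increment []           = refl
value-increment (false ∷ bs) = refl
value-increment (true ∷ bs)  = trans (cong (λ v → v ℕ.+ v) (value-increment bs))
  (cong suc (ℕ.+-suc (value bs) (value bs)))

value-binary : ∀ m → value (binary m) ≡ m
value-binary zero    = refl
value-binary (suc m) = trans (value-increment (binary m)) (cong suc (value-binary m))

value-large : ∀ {bs} → EndsWithOne bs → ∃[ l ] (length bs ≡ suc l × 2 ℕ.^ l ≤ value bs)
value-large [one] = 0 , refl , s≤s z≤n
value-large {b ∷ bs} (b ∷ end) =
  let (l , len , 2^l≤) = value-large end
  in suc l , cong suc len , ℕ.≤-trans (ℕ.+-mono-≤ 2^l≤ (ℕ.≤-trans (ℕ.≤-reflexive (ℕ.+-identityʳ _)) 2^l≤)) (double b)
  where
  double : ∀ b → value bs ℕ.+ value bs ≤ value (b ∷ bs)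
  double false = ℕ.≤-refl
  double true  = ℕ.n≤1+n _

length-increment : ∀ bs → length bs ≤ length (increment bs)
length-increment []           = z≤n
length-increment (false ∷ bs) = ℕ.≤-refl
length-increment (true ∷ bs)  = s≤s (length-increment bs)

length-binary-mono : ∀ {m n} → m ≤ n → length (binary m) ≤ length (binary n)
length-binary-mono {n = zero}  z≤n = z≤n
length-binary-mono {m} {suc n} m≤1+n = by (m ℕ.≤? n)
  where
  by : Dec (m ≤ n) → length (binary m) ≤ length (binary (suc n))
  by (yes m≤n) = ℕ.≤-trans (length-binary-mono m≤n) (length-increment (binary n))
  by (no  m≰n) = ℕ.≤-reflexive (cong (length ∘ binary) (ℕ.≤-antisym m≤1+n (ℕ.≰⇒> m≰n)))

length-concatMap : ∀ {A : Set} (f : A → List Symbol) b → (∀ a → length (f a) ≤ b) →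
  ∀ as → length (concatMap f as) ≤ length as ℕ.* b
length-concatMap f b f≤b []       = z≤n
length-concatMap f b f≤b (a ∷ as) = ℕ.≤-trans (ℕ.≤-reflexive (List.length-++ (f a)))
  (ℕ.+-mono-≤ (f≤b a) (length-concatMap f b f≤b as))

-- Size bounds in terms of n and log q

module Sizes (I : CodePair) where
  open CodePair I
  open FieldProperties field-q using (isNonAssociativeRing; _≟ᶠ_; 1≢0; 1<p; 0<r)
  open MatrixProperties isNonAssociativeRing _≟ᶠ_ 1≢0 using (combination-injective)

  private
    Element = Vec (Fin p) r

    encodeElement : Element → Fin q
    encodeElement v = funToFin (lookup v)

    decodeElement : Fin q → Element
    decodeElement x = tabulate (finToFun {p} {r} x)

    funToFin-cong : ∀ {m n} {f g : Fin m → Fin n} → (∀ i → f i ≡ g i) → funToFin f ≡ funToFin g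
    funToFin-cong {zero}  f≡g = refl
    funToFin-cong {suc m} f≡g = cong₂ Fin.combine (f≡g zero) (funToFin-cong (f≡g ∘ suc))

    finToFun-injective : ∀ {m n} {x y : Fin (n ℕ.^ m)} → (∀ i → finToFun {n} {m} x i ≡ finToFun y i) → x ≡ y
    finToFun-injective {m} {n} {x} {y} eq =
      trans (sym (Fin.funToFin-finToFin {m} x)) (trans (funToFin-cong eq) (Fin.funToFin-finToFin {m} y))

    funToFin-injective : ∀ {m n} {f g : Fin m → Fin n} → funToFin f ≡ funToFin g → ∀ i → f i ≡ g i
    funToFin-injective {f = f} {g} eq i = trans (sym (Fin.finToFun-funToFin f i))
      (trans (cong (λ x → finToFun x i) eq) (Fin.finToFun-funToFin g i))

    encode-injective : ∀ {v w} → encodeElement v ≡ encodeElement w → v ≡ w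
    encode-injective {v} {w} eq = trans (sym (Vec.tabulate∘lookup v))
      (trans (Vec.tabulate-cong (funToFin-injective eq)) (Vec.tabulate∘lookup w))

    decode-injective : ∀ {x y} → decodeElement x ≡ decodeElement y → x ≡ y
    decode-injective {x} {y} eq = finToFun-injective {r} λ i →
      trans (sym (Vec.lookup∘tabulate (finToFun x) i))
        (trans (cong (λ v → lookup v i) eq) (Vec.lookup∘tabulate (finToFun y) i))

  1<q : 1 < q
  1<q = ℕ.≤-trans (ℕ.≤-trans 1<p (ℕ.≤-reflexive (sym (ℕ.^-identityʳ p))))
    (ℕ.^-monoʳ-≤ p {{ℕ.>-nonZero (ℕ.<-trans (s≤s z≤n) 1<p)}} 0<r)

  -- A count instead of elimination: the rows of `B` are independent, so distinct coefficient
  -- vectors give distinct codewords, and the `q ^ k` former inject into the `q ^ n` vectors of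
  -- length `n`.
  k≤n : k ≤ n
  k≤n = ℕ.≮⇒≥ λ n<k → ℕ.<-irrefl refl
    (ℕ.<-≤-trans (ℕ.^-monoʳ-< q 1<q n<k) (Fin.injective⇒≤ {f = code} code-injective))
    where
    B = proj₁ G-generator
    independent = proj₁ (proj₂ G-generator)

    coefficients : Fin (q ℕ.^ k) → Fin k → Element
    coefficients x i = decodeElement (finToFun x i)

    code : Fin (q ℕ.^ k) → Fin (q ℕ.^ n)
    code x = funToFin λ j → encodeElement (combination (coefficients x) B j)

    code-injective : Injective _≡_ _≡_ code
    code-injective {x} {y} eq = finToFun-injective {k} λ i → decode-injective
      (combination-injective B independent (coefficients x) (coefficients y)
        (λ j → encode-injective (funToFin-injective eq j)) i)

  -- `β` bounds the numeral of a coefficient, being that of `p`, and `e` bounds an encoded element.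
  -- All sizes are compared with `X`, the base of the final time bound.
  Q β X e : ℕ
  Q = ⌈log₂ q ⌉
  β = length (binary p)
  X = 1 ℕ.+ n ℕ.+ Q
  e = r ℕ.* (β ℕ.+ 1) ℕ.+ 1

  exponent≤Q : ∀ {m} → 2 ℕ.^ m ≤ q → m ≤ Q
  exponent≤Q {m} 2^m≤q = ℕ.≤-trans (ℕ.≤-reflexive (sym (⌈log₂2^n⌉≡n m))) (⌈log₂⌉-mono-≤ 2^m≤q)

  r≤Q : r ≤ Q
  r≤Q = exponent≤Q (ℕ.^-monoˡ-≤ r 1<p)

  binary-p : ∃[ l ] (β ≡ suc l × 2 ℕ.^ l ≤ p)
  binary-p = large 1<p
    where
    large : ∀ {p} → 1 < p → ∃[ l ] (length (binary p) ≡ suc l × 2 ℕ.^ l ≤ p)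
    large {suc p} _ = subst (λ v → ∃[ l ] (length (binary (suc p)) ≡ suc l × 2 ℕ.^ l ≤ v))
      (value-binary (suc p)) (value-large (binary-ends p))

  -- From `2 ^ l ≤ p` follows `2 ^ (l * r) ≤ q`. Bounding the product as a whole keeps an encoded
  -- element linear in `X`; separate bounds for `r` and `β` would make it quadratic.
  l*r≤Q : proj₁ binary-p ℕ.* r ≤ Q
  l*r≤Q = let (l , _ , 2^l≤p) = binary-p in
    exponent≤Q (ℕ.≤-trans (ℕ.≤-reflexive (sym (ℕ.^-*-assoc 2 l r))) (ℕ.^-monoˡ-≤ r 2^l≤p))

  1≤X : 1 ≤ X
  1≤X = s≤s z≤n

  n≤X : n ≤ X
  n≤X = ℕ.≤-trans (ℕ.m≤n+m n 1) (ℕ.m≤m+n (1 ℕ.+ n) Q)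

  1+Q≤X : 1 ℕ.+ Q ≤ X
  1+Q≤X = ℕ.+-monoˡ-≤ Q (ℕ.m≤m+n 1 n)

  β≤X : β ≤ X
  β≤X = let (l , β≡ , _) = binary-p in
    ℕ.≤-trans (ℕ.≤-reflexive β≡) (ℕ.≤-trans (s≤s
      (ℕ.≤-trans (ℕ.≤-reflexive (sym (ℕ.*-identityʳ l))) (ℕ.≤-trans (ℕ.*-monoʳ-≤ l 0<r) l*r≤Q))) 1+Q≤X)

  e≤3X : e ≤ 3 ℕ.* X
  e≤3X = let (l , β≡ , _) = binary-p in begin
    r ℕ.* (β ℕ.+ 1) ℕ.+ 1            ≡⟨ cong (λ b → r ℕ.* (b ℕ.+ 1) ℕ.+ 1) β≡ ⟩
    r ℕ.* (suc l ℕ.+ 1) ℕ.+ 1        ≡⟨ solve 2 (λ r l → r :* (con 1 :+ l :+ con 1) :+ con 1 :=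
                                          l :* r :+ (con 2 :* r :+ con 1)) refl r l ⟩
    l ℕ.* r ℕ.+ (2 ℕ.* r ℕ.+ 1)      ≤⟨ ℕ.+-mono-≤ l*r≤Q (ℕ.+-monoˡ-≤ 1 (ℕ.*-monoʳ-≤ 2 r≤Q)) ⟩
    Q ℕ.+ (2 ℕ.* Q ℕ.+ 1)            ≤⟨ ℕ.m≤m+n _ 2 ⟩
    Q ℕ.+ (2 ℕ.* Q ℕ.+ 1) ℕ.+ 2      ≡⟨ solve 1 (λ Q → Q :+ (con 2 :* Q :+ con 1) :+ con 2 :=
                                          con 3 :* (con 1 :+ Q)) refl Q ⟩
    3 ℕ.* (1 ℕ.+ Q)                  ≤⟨ ℕ.*-monoʳ-≤ 3 1+Q≤X ⟩
    3 ℕ.* X                          ∎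
    where
    open ℕ.≤-Reasoning
    open +-*-Solver

  digits : Element → List Symbol
  digits a = concatMap (λ aᵢ → encodeBinary (toℕ aᵢ) ++ endCoeff ∷ []) (toList a)

  length-elem : ∀ a → length (digits a ++ endElem ∷ []) ≤ e
  length-elem a = ℕ.≤-trans (ℕ.≤-reflexive (List.length-++ (digits a)))
    (ℕ.+-monoˡ-≤ 1 (ℕ.≤-trans
      (length-concatMap _ (β ℕ.+ 1) coeff≤ (toList a))
      (ℕ.≤-reflexive (cong (ℕ._* (β ℕ.+ 1)) (Vec.length-toList a)))))
    where
    coeff≤ : ∀ (aᵢ : Fin p) → length (encodeBinary (toℕ aᵢ) ++ endCoeff ∷ []) ≤ β ℕ.+ 1
    coeff≤ aᵢ = ℕ.≤-trans
      (ℕ.≤-reflexive (trans (List.length-++ (encodeBinary (toℕ aᵢ)))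
        (cong (ℕ._+ 1) (List.length-map bit (binary (toℕ aᵢ))))))
      (ℕ.+-monoˡ-≤ 1 (length-binary-mono (ℕ.<⇒≤ (Fin.toℕ<n aᵢ))))

  module _ {z : List Symbol} (z≤e : length z ≤ e) where
    open Transducer using (border; marks; repeat; ones)
    open Reduction.Words digits z

    length-marks : length (marks z) ≤ 5 ℕ.* e ℕ.+ 3
    length-marks = begin
      length (marks z)
        ≡⟨ trans (List.length-++ z) (cong (length z ℕ.+_) (trans (List.length-++ z) (cong (λ l → length z ℕ.+ suc l)
             (trans (List.length-++ z) (cong (λ l → length z ℕ.+ suc l) (List.length-++ z)))))) ⟩
      length z ℕ.+ (length z ℕ.+ suc (length z ℕ.+ suc (length z ℕ.+ suc (length z))))
        ≡⟨ solve 1 (λ l → l :+ (l :+ (con 1 :+ (l :+ (con 1 :+ (l :+ (con 1 :+ l)))))) := con 5 :* l :+ con 3)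
             refl (length z) ⟩
      5 ℕ.* length z ℕ.+ 3
        ≤⟨ ℕ.+-monoˡ-≤ 3 (ℕ.*-monoʳ-≤ 5 z≤e) ⟩
      5 ℕ.* e ℕ.+ 3 ∎
      where
      open ℕ.≤-Reasoning
      open +-*-Solver

    length-repeat : ∀ n w → length (repeat n w) ≡ n ℕ.* length w
    length-repeat zero    w = refl
    length-repeat (suc n) w = trans (List.length-++ w) (cong (length w ℕ.+_) (length-repeat n w))

    length-border : length (border z n) ≤ 1 ℕ.+ (3 ℕ.* X ℕ.+ (X ℕ.* (5 ℕ.* (3 ℕ.* X) ℕ.+ 3) ℕ.+ 1))
    length-border = ℕ.≤-trans
      (ℕ.≤-reflexive (cong suc (trans (List.length-++ z) (cong (length z ℕ.+_)
        (trans (List.length-++ (repeat n (marks z))) (cong (ℕ._+ 1) (length-repeat n (marks z))))))))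
      (s≤s (ℕ.+-mono-≤ (ℕ.≤-trans z≤e e≤3X) (ℕ.+-monoˡ-≤ 1 (ℕ.*-mono-≤ n≤X
        (ℕ.≤-trans length-marks (ℕ.+-monoˡ-≤ 3 (ℕ.*-monoʳ-≤ 5 e≤3X)))))))

    length-elem′ : ∀ a → length (elem′ a) ≤ 5 ℕ.* (3 ℕ.* X)
    length-elem′ a = begin
      length (elem′ a)
        ≡⟨ trans (List.length-++ (elem a)) (cong (length (elem a) ℕ.+_) (trans (List.length-++ (elem a))
             (cong (length (elem a) ℕ.+_) (trans (List.length-++ (elem a)) (cong (length (elem a) ℕ.+_) (List.length-++ z)))))) ⟩
      length (elem a) ℕ.+ (length (elem a) ℕ.+ (length (elem a) ℕ.+ (length z ℕ.+ length z)))
        ≤⟨ ℕ.+-mono-≤ (length-elem a) (ℕ.+-mono-≤ (length-elem a) (ℕ.+-mono-≤ (length-elem a) (ℕ.+-mono-≤ z≤e z≤e))) ⟩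
      e ℕ.+ (e ℕ.+ (e ℕ.+ (e ℕ.+ e)))
        ≡⟨ solve 1 (λ e → e :+ (e :+ (e :+ (e :+ e))) := con 5 :* e) refl e ⟩
      5 ℕ.* e
        ≤⟨ ℕ.*-monoʳ-≤ 5 e≤3X ⟩
      5 ℕ.* (3 ℕ.* X) ∎
      where
      open ℕ.≤-Reasoning
      open +-*-Solver

    Row Rows : ℕ
    Row  = 3 ℕ.* X ℕ.+ (X ℕ.* (5 ℕ.* (3 ℕ.* X)) ℕ.+ 1)
    Rows = X ℕ.* Row ℕ.+ 1

    length-row′ : ∀ (as : List Element) → length as ≡ n → length (row′ as) ≤ Row
    length-row′ as refl = ℕ.≤-trans
      (ℕ.≤-reflexive (trans (List.length-++ z) (cong (length z ℕ.+_) (List.length-++ (concatMap elem′ as)))))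
      (ℕ.+-mono-≤ (ℕ.≤-trans z≤e e≤3X) (ℕ.+-monoˡ-≤ 1
        (ℕ.≤-trans (length-concatMap elem′ _ length-elem′ as) (ℕ.*-monoˡ-≤ _ n≤X))))

    length-rows′ : ∀ (A : Fin k → Fin n → Element) →
      length (rows′ (List.tabulate λ i → List.tabulate (A i))) ≤ Rows
    length-rows′ A = ℕ.≤-trans
      (ℕ.≤-reflexive (List.length-++ (concatMap row′ (List.tabulate λ i → List.tabulate (A i)))))
      (ℕ.+-monoˡ-≤ 1 (ℕ.≤-trans (go A) (ℕ.*-monoˡ-≤ Row (ℕ.≤-trans k≤n n≤X))))
      where
      go : ∀ {m} (A : Fin m → Fin n → Element) →
        length (concatMap row′ (List.tabulate λ i → List.tabulate (A i))) ≤ m ℕ.* Row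
      go {zero}  A = z≤n
      go {suc m} A = ℕ.≤-trans (ℕ.≤-reflexive (List.length-++ (row′ (List.tabulate (A zero)))))
        (ℕ.+-mono-≤ (length-row′ (List.tabulate (A zero)) (List.length-tabulate (A zero))) (go (A ∘ suc)))

-- Encodings of the instances and the final bounds

open import Data.Nat using (_+_; _*_; _^_)

concatMap-tabulate : ∀ {A B : Set} {n} {f : A → List Symbol} {g : B → List Symbol}
  {x : Fin n → A} {y : Fin n → B} → (∀ i → f (x i) ≡ g (y i)) →
  concatMap f (List.tabulate x) ≡ concatMap g (List.tabulate y)
concatMap-tabulate {n = zero}  f≡g = refl
concatMap-tabulate {n = suc n} f≡g = cong₂ _++_ (f≡g zero) (concatMap-tabulate (f≡g ∘ suc))

concatMap-blocks : ∀ {A B : Set} n (f : A → List Symbol) {g : B → List Symbol}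
  (x : Fin n × Fin 5 → A) (y : Fin n → B) →
  (∀ i → f (x (i , 0F)) ++ f (x (i , 1F)) ++ f (x (i , 2F)) ++ f (x (i , 3F)) ++ f (x (i , 4F)) ≡ g (y i)) →
  concatMap f (List.tabulate (x ∘ remQuot {n} 5)) ≡ concatMap g (List.tabulate y)
concatMap-blocks zero    f     x y block = refl
concatMap-blocks (suc n) f {g} x y block = trans
  (cong (λ w → b 0F ++ b 1F ++ b 2F ++ b 3F ++ b 4F ++ w)
    (concatMap-blocks n f {g} (λ (i , c) → x (suc i , c)) (y ∘ suc) (block ∘ suc)))
  (trans (assoc₅ (b 0F) (b 1F) (b 2F) (b 3F) (b 4F)) (cong (_++ concatMap g (List.tabulate (y ∘ suc))) (block zero)))
  where
  b : Fin 5 → List Symbol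
  b c = f (x (zero , c))
  assoc₅ : ∀ (v₀ v₁ v₂ v₃ v₄ {w} : List Symbol) →
    v₀ ++ v₁ ++ v₂ ++ v₃ ++ v₄ ++ w ≡ (v₀ ++ v₁ ++ v₂ ++ v₃ ++ v₄) ++ w
  assoc₅ v₀ v₁ v₂ v₃ v₄ {w} = sym (trans (List.++-assoc v₀ _ w) (cong (v₀ ++_)
    (trans (List.++-assoc v₁ _ w) (cong (v₁ ++_)
      (trans (List.++-assoc v₂ _ w) (cong (v₂ ++_) (List.++-assoc v₃ v₄ w)))))))

snoc-++ : ∀ w {s : Symbol} v → (w ++ s ∷ []) ++ v ≡ w ++ s ∷ v
snoc-++ w {s} v = List.++-assoc w (s ∷ []) v

open Transducer
open Reduction using (one; module Words)
open Emission using (isDelimiter; isEndBlock)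

skeleton-++ : ∀ v w → skeleton (v ++ w) ≡ skeleton v ++ skeleton w
skeleton-++ []             w = refl
skeleton-++ (bit _ ∷ v)    w = skeleton-++ v w
skeleton-++ (endCoeff ∷ v) w = cong (endCoeff ∷_) (skeleton-++ v w)
skeleton-++ (endElem ∷ v)  w = cong (endElem ∷_) (skeleton-++ v w)
skeleton-++ (endRow ∷ v)   w = cong (endRow ∷_) (skeleton-++ v w)
skeleton-++ (endBlock ∷ v) w = cong (endBlock ∷_) (skeleton-++ v w)

skeleton-bits : ∀ bs → skeleton (List.map bit bs) ≡ []
skeleton-bits []       = refl
skeleton-bits (b ∷ bs) = skeleton-bits bs

concatMap-one : ∀ n w {A : Set} (y : Fin n → A) → concatMap (λ _ → w) (List.tabulate y) ≡ repeat n w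
concatMap-one zero    w y = refl
concatMap-one (suc n) w y = cong (w ++_) (concatMap-one n w (y ∘ suc))

ones-snoc : ∀ n → ones n ++ one ∷ [] ≡ ones (suc n)
ones-snoc zero    = refl
ones-snoc (suc n) = cong (one ∷_) (ones-snoc n)

delimiter-free : ∀ {w} → All (λ s → isDelimiter (just s) ≡ false) w → EndBlockFree w
delimiter-free = All.map λ {s} → free s
  where
  free : ∀ s → isDelimiter (just s) ≡ false → isEndBlock (just s) ≡ false
  free (bit _)  _ = refl
  free endCoeff _ = refl
  free endElem  _ = refl
  free endRow   _ = refl

module GadgetInstance (I : CodePair) where
  open CodePair I
  open FieldProperties field-q
  open CodeGadget isNonAssociativeRing _≟ᶠ_ 1≢0 renaming (marks to marks5)
  open GadgetCorrectness isNonAssociativeRing _≟ᶠ_ 1≢0 using (gadget-correct)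
  open Sizes I

  reduced : CodePair
  reduced = record
    { field-q     = field-q
    ; k           = suc k
    ; n           = suc (n * 5)
    ; G           = gadget G
    ; H           = gadget H
    ; G-generator = gadget-generator G G-generator
    ; H-generator = gadget-generator H H-generator
    }

  correct : PCE I ⇔ SPCE reduced
  correct = gadget-correct G H

  private
    coefficient : Fin p → List Symbol
    coefficient a = encodeBinary (toℕ a) ++ endCoeff ∷ []

  bits-inner : ∀ bs → All (λ s → isDelimiter (just s) ≡ false) (List.map bit bs)
  bits-inner []       = []
  bits-inner (b ∷ bs) = refl ∷ bits-inner bs

  digits-inner : ∀ a → All (λ s → isDelimiter (just s) ≡ false) (digits a)
  digits-inner a = go (toList a)
    where
    go : ∀ as → All (λ s → isDelimiter (just s) ≡ false) (concatMap coefficient as)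
    go []       = []
    go (a ∷ as) = All.++⁺ (All.++⁺ (bits-inner (binary (toℕ a))) (refl ∷ [])) (go as)

  z : List Symbol
  z = skeleton (encodeElem modulus)

  z≡ : z ≡ replicate r endCoeff ++ endElem ∷ []
  z≡ = trans (skeleton-++ (digits modulus) (endElem ∷ [])) (cong (_++ endElem ∷ []) (go modulus))
    where
    go : ∀ {r} (a : Vec (Fin p) r) → skeleton (concatMap coefficient (toList a)) ≡ replicate r endCoeff
    go []       = refl
    go (a ∷ as) = trans (skeleton-++ (coefficient a) (concatMap coefficient (toList as)))
      (cong₂ _++_ (trans (skeleton-++ (encodeBinary (toℕ a)) (endCoeff ∷ []))
        (cong (_++ endCoeff ∷ []) (skeleton-bits (binary (toℕ a))))) (go as))

  private
    zero-coefficients : ∀ m → concatMap coefficient (toList (Vec.replicate m (RawRing.0# 𝔽ₚ))) ≡ replicate m endCoeff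
    zero-coefficients zero    = refl
    zero-coefficients (suc m) = cong₂ _++_
      (cong (λ a → encodeBinary a ++ endCoeff ∷ []) toℕ-zero) (zero-coefficients m)

  encode-zero : encodeElem (RawRing.0# 𝔽) ≡ z
  encode-zero = trans (cong (_++ endElem ∷ []) (go r)) (sym z≡)
    where
    go : ∀ r → concatMap coefficient (toList (Polynomials.constant 𝔽ₚ {r} (RawRing.0# 𝔽ₚ))) ≡ replicate r endCoeff
    go zero    = refl
    go (suc r) = zero-coefficients (suc r)

  -- Needs a constant coefficient, from `0<r`, and that `1` is not reduced modulo `p`; its numeral
  -- is then a single bit in front of the word for zero.
  encode-one : encodeElem (RawRing.1# 𝔽) ≡ one ∷ z
  encode-one = trans (cong (_++ endElem ∷ []) (go 0<r)) (cong (one ∷_) (sym z≡))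
    where
    go : ∀ {r} → 0 < r →
      concatMap coefficient (toList (Polynomials.constant 𝔽ₚ {r} (RawRing.1# 𝔽ₚ))) ≡ one ∷ replicate r endCoeff
    go {suc r} _ = cong₂ _++_
      (cong (λ a → encodeBinary a ++ endCoeff ∷ []) toℕ-one) (zero-coefficients r)

  1≤z : 1 ≤ length z
  1≤z = subst (λ w → 1 ≤ length w) (sym z≡)
    (ℕ.≤-trans (ℕ.m≤n+m 1 (length (replicate r endCoeff)))
      (ℕ.≤-reflexive (sym (List.length-++ (replicate r endCoeff)))))

  z≤e : length z ≤ e
  z≤e = ℕ.≤-trans (length-skeleton (encodeElem modulus)) (length-elem modulus)

  open Words digits z

  rowsOf : ∀ {m l} → (Fin m → Fin l → Vec (Fin p) r) → List (List (Vec (Fin p) r))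
  rowsOf A = List.tabulate λ i → List.tabulate (A i)

  encode-matrix : ∀ {m l} (A : Fin m → Fin l → Vec (Fin p) r) →
    encodeMatrix A ++ endBlock ∷ [] ≡ rows (rowsOf A)
  encode-matrix A = cong (_++ endBlock ∷ []) (concatMap-tabulate {f = encodeRow} {row} {A} {List.tabulate ∘ A} λ i → refl)

  encode-gadget : ∀ (A : Fin k → Fin n → Vec (Fin p) r) →
    encodeMatrix (gadget A) ++ endBlock ∷ [] ≡ border z n ++ rows′ (rowsOf A)
  encode-gadget A = trans
    (cong₂ (λ v w → (v ++ w) ++ endBlock ∷ []) border≡ (concatMap-tabulate row≡))
    (List.++-assoc (border z n) _ (endBlock ∷ []))
    where
    marks≡ : concatMap encodeElem (List.tabulate λ j → marks5 (proj₂ (remQuot {n} 5 j))) ≡ repeat n (marks z)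
    marks≡ = trans
      (concatMap-blocks n encodeElem {λ _ → marks z} (λ (_ , c) → marks5 c) (λ i → i)
        (λ i → cong₂ (λ o l → o ++ o ++ l ++ l ++ l) encode-zero encode-one))
      (concatMap-one n (marks z) (λ i → i))

    border≡ : encodeRow (gadget A zero) ≡ border z n
    border≡ = trans (cong₂ (λ v w → (v ++ w) ++ endRow ∷ []) encode-one marks≡)
      (cong (one ∷_) (List.++-assoc z (repeat n (marks z)) (endRow ∷ [])))

    row≡ : ∀ i → encodeRow (gadget A (suc i)) ≡ row′ (List.tabulate (A i))
    row≡ i = trans
      (cong₂ (λ v w → (v ++ w) ++ endRow ∷ []) encode-zero
        (concatMap-blocks n encodeElem {elem′} (λ (l , c) → copies (A i l) c) (A i)
          (λ l → cong (λ o → elem (A i l) ++ elem (A i l) ++ elem (A i l) ++ o ++ o) encode-zero)))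
      (List.++-assoc z (concatMap elem′ (List.tabulate (A i))) (endRow ∷ []))


  binary-free : EndBlockFree (encodeBinary p)
  binary-free = delimiter-free (bits-inner (binary p))

  modulus-free : EndBlockFree (encodeElem modulus)
  modulus-free = All.++⁺ (delimiter-free (digits-inner modulus)) (refl ∷ [])

  private
    w₁ = encodeUnary k
    w₂ = encodeBinary p
    w₃ = encodeElem modulus
    A  = rowsOf G
    B  = rowsOf H

  input output : List Symbol
  input  = source digits digits-inner w₁ w₂ w₃ n (ones-free k) binary-free modulus-free 1≤z A B
  output = target digits digits-inner w₁ w₂ w₃ n (ones-free k) binary-free modulus-free 1≤z A B

  encode-input : input ≡ encode I
  encode-input = cong (λ v → w₁ ++ endBlock ∷ v)
    (trans (List.++-identityʳ _) (trans (snoc-++ (ones n) _) (cong (λ v → ones n ++ endBlock ∷ v)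
      (trans (snoc-++ w₂ _) (cong (λ v → w₂ ++ endBlock ∷ v)
        (trans (snoc-++ w₃ _) (cong (λ v → w₃ ++ endBlock ∷ v)
          (trans (cong₂ _++_ (sym (encode-matrix G)) (sym (encode-matrix H)))
            (snoc-++ (encodeMatrix G) _)))))))))

  encode-output : output ≡ encode reduced
  encode-output = trans
    (trans (List.++-assoc w₁ (one ∷ endBlock ∷ []) _)
      (trans (sym (snoc-++ w₁ _)) (cong (_++ endBlock ∷ tail) (ones-snoc k))))
    (cong (λ v → ones (suc k) ++ endBlock ∷ v)
      (trans (snoc-++ (ones (n * 5) ++ one ∷ []) _)
        (cong₂ (λ w v → w ++ endBlock ∷ v) (ones-snoc (n * 5))
          (trans (snoc-++ w₂ _) (cong (λ v → w₂ ++ endBlock ∷ v)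
            (trans (snoc-++ w₃ _) (cong (λ v → w₃ ++ endBlock ∷ v)
              (trans (sym (List.++-assoc (border z n) (rows′ A) _))
                (trans (cong₂ _++_ (sym (encode-gadget G)) (sym (encode-gadget H)))
                  (snoc-++ (encodeMatrix (gadget G)) _))))))))))
    where
    tail = ((ones (n * 5) ++ one ∷ []) ++ endBlock ∷ []) ++ (w₂ ++ endBlock ∷ []) ++ (w₃ ++ endBlock ∷ []) ++
           border z n ++ rows′ A ++ border z n ++ rows′ B

  length-output : length output ≤ 102 * X ^ 3
  length-output = begin
    length output
      ≡⟨ trans (length-++₂ w₁ (one ∷ endBlock ∷ []))
         (cong ((length w₁ + 2) +_) (trans (length-++₂ (ones (n * 5) ++ one ∷ []) (endBlock ∷ []))
           (cong₂ (λ a b → (a + 1) + b) (List.length-++ (ones (n * 5)))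
             (trans (length-++₂ w₂ (endBlock ∷ [])) (cong ((length w₂ + 1) +_)
               (trans (length-++₂ w₃ (endBlock ∷ [])) (cong ((length w₃ + 1) +_)
                 (trans (List.length-++ (border z n)) (cong (length (border z n) +_)
                   (trans (List.length-++ (rows′ A)) (cong (length (rows′ A) +_)
                     (List.length-++ (border z n))))))))))))) ⟩
    (length w₁ + 2) + ((length (ones (n * 5)) + 1 + 1) + ((length w₂ + 1) + ((length w₃ + 1) +
      (length (border z n) + (length (rows′ A) + (length (border z n) + length (rows′ B)))))))
      ≤⟨ ℕ.+-mono-≤ (ℕ.+-monoˡ-≤ 2 (ℕ.≤-trans (ℕ.≤-reflexive (List.length-replicate k)) (ℕ.≤-trans k≤n n≤X)))
         (ℕ.+-mono-≤ (ℕ.+-monoˡ-≤ 1 (ℕ.+-monoˡ-≤ 1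
             (ℕ.≤-trans (ℕ.≤-reflexive (List.length-replicate (n * 5))) (ℕ.*-monoˡ-≤ 5 n≤X))))
         (ℕ.+-mono-≤ (ℕ.+-monoˡ-≤ 1 (ℕ.≤-trans (ℕ.≤-reflexive (List.length-map bit (binary p))) β≤X))
         (ℕ.+-mono-≤ (ℕ.+-monoˡ-≤ 1 (ℕ.≤-trans (length-elem modulus) e≤3X))
         (ℕ.+-mono-≤ (length-border {z} z≤e) (ℕ.+-mono-≤ (length-rows′ {z} z≤e G)
         (ℕ.+-mono-≤ (length-border {z} z≤e) (length-rows′ {z} z≤e H))))))) ⟩
    polynomial X
      ≤⟨ cubic (n + ⌈log₂ q ⌉) ⟩
    102 * X ^ 3 ∎
    where
    open ℕ.≤-Reasoning

    length-++₂ : ∀ (u v : List Symbol) {w} → length ((u ++ v) ++ w) ≡ (length u + length v) + length w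
    length-++₂ u v {w} = trans (List.length-++ (u ++ v)) (cong (_+ length w) (List.length-++ u))

    polynomial : ℕ → ℕ
    polynomial X = (X + 2) + ((X * 5 + 1 + 1) + ((X + 1) + ((3 * X + 1) + (Border + (Rows₀ + (Border + Rows₀))))))
      where
      Border = 1 + (3 * X + (X * (5 * (3 * X) + 3) + 1))
      Rows₀  = X * (3 * X + (X * (5 * (3 * X)) + 1)) + 1

    -- The polynomial is `30 X³ + 36 X² + 24 X + 12`, and `102` is the sum of its coefficients. With
    -- `X = 1 + x` the difference of the two sides has natural coefficients, so it can be added
    -- explicitly.
    cubic : ∀ x → polynomial (suc x) ≤ 102 * suc x ^ 3
    cubic x = ℕ.≤-trans (ℕ.m≤m+n (polynomial (suc x)) (120 * x + (180 * (x * x) + 72 * (x * (x * x)))))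
      (ℕ.≤-reflexive (solve 1 (λ x →
        let X = con 1 :+ x
            Border = con 1 :+ (con 3 :* X :+ (X :* (con 5 :* (con 3 :* X) :+ con 3) :+ con 1))
            Rows₀  = X :* (con 3 :* X :+ (X :* (con 5 :* (con 3 :* X)) :+ con 1)) :+ con 1
        in (X :+ con 2) :+ ((X :* con 5 :+ con 1 :+ con 1) :+ ((X :+ con 1) :+ ((con 3 :* X :+ con 1) :+
             (Border :+ (Rows₀ :+ (Border :+ Rows₀)))))) :+
             (con 120 :* x :+ (con 180 :* (x :* x) :+ con 72 :* (x :* (x :* x))))
           := con 102 :* (X :* (X :* (X :* con 1)))) refl x))
      where open +-*-Solver

  -- `2353` is `7 + 102 * 23`; the constant `7` is absorbed because `X ^ 3` is at least one.
  time-bound : ∀ {t} → t ≤ 7 + length output * 23 → t ≤ 2353 * X ^ 3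
  time-bound {t} t≤ = begin
    t                                   ≤⟨ t≤ ⟩
    7 + length output * 23              ≤⟨ ℕ.+-mono-≤ (ℕ.*-monoʳ-≤ 7 (ℕ.^-monoˡ-≤ 3 1≤X))
                                             (ℕ.*-monoˡ-≤ 23 length-output) ⟩
    7 * X ^ 3 + 102 * X ^ 3 * 23        ≡⟨ solve 1 (λ y → con 7 :* y :+ con 102 :* y :* con 23 := con 2353 :* y)
                                             refl (X ^ 3) ⟩
    2353 * X ^ 3                        ∎
    where
    open ℕ.≤-Reasoning
    open +-*-Solver

  computation : Σ[ t ∈ ℕ ]
    (TuringMachine._maps_to_in-time_ (Programs.machine 2 main) (encode I) (encode reduced) t × t ≤ 2353 * X ^ 3)
  computation =
    let (t , t≤ , ts , run , out) = main-run digits digits-inner w₁ w₂ w₃ n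
          (ones-free k) binary-free modulus-free 1≤z A B
    in t
     , subst₂ (λ v w → TuringMachine._maps_to_in-time_ (Programs.machine 2 main) v w t) encode-input
         (trans out encode-output) (Programs.halts 2 run)
     , time-bound t≤

theorem3p2 : Σ[ M ∈ TuringMachine ] Σ[ c ∈ ℕ ] Σ[ d ∈ ℕ ]
    ((I : CodePair) →
    Σ[ J ∈ CodePair ] Σ[ t ∈ ℕ ]
    ( TuringMachine._maps_to_in-time_ M (encode I) (encode J) t
    × t ≤ c * (1 + CodePair.n I + ⌈log₂ CodePair.q I ⌉) ^ d
    × (PCE I ⇔ SPCE J) ))
theorem3p2 = Programs.machine 2 Transducer.main , 2353 , 3 , λ I →
  let open GadgetInstance I
      (t , computes , t≤) = computation
  in reduced , t , computes , t≤ , correct
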